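{- For every integer $u\ge1$ and every partition $\mu$, $$D_{u,0}\,s_\mu\Big[\frac{X}{1-q}\Big]=\Big(1-(1-q^{ -u})(1-q^u)\,B_\mu(q^u,q^{ -u})\Big)\,s_\mu\Big[\frac{X}{1-q}\Big].$$
   Context: Let $\Lambda$ be the ring of symmetric functions in $X=x_1+x_2+\cdots$ over $\mathbb{Q}(q)$, with plethystic notation: $p_k[E]$ replaces every variable in $E$ (including $q$ and an auxiliary $z$) by its $k$-th power, $F[E]$ substitutes $p_k\mapsto p_k[E]$ (e.g. $p_k[X/(1-q)]=p_k[X]/(1-q^k)$), and $\Omega[E]=\exp(\sum_{k\ge1}p_k[E]/k)$. For an integer $u$, $[u]_q=(1-q^u)/(1-q)$; $t=1/q$, $[u]_t=(1-q^{ -u})/(1-q^{ -1})$, $M=(1-t)(1-q)$. For integers $u,v$, $D_{u,v}F[X]=F[X+M[u]_q/z]\,\Omega[-z[u]_tX]\big|_{z^v}$ (coefficient of $z^v$). For a partition $\mu=(\mu_1\ge\mu_2\ge\cdots\ge\mu_\ell>0)$, $B_\mu(q,t)=\sum_{i=1}^{\ell}t^{i-1}(1+q+\cdots+q^{\mu_i-1})$. -}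

module Defs where

open import Data.Nat as ℕ using (ℕ; zero; suc)
open import Data.Integer as ℤ using (ℤ; +_; -[1+_])
open import Data.List using (List; []; _∷_; _++_; map; foldr; length; concatMap)
open import Data.List.Properties using (≡-dec)
open import Data.List.Relation.Unary.All using (All)
open import Data.List.Relation.Unary.Linked using (Linked)
open import Data.Product using (_×_; _,_; proj₁; proj₂)
open import Data.Bool using (if_then_else_)
open import Relation.Nullary using (¬_)
open import Relation.Nullary.Decidable using (⌊_⌋)
open import Relation.Binary.PropositionalEquality using (_≡_)

-- Polynomials in q with integer coefficients (lowest degree first)

Poly : Set
Poly = List ℤ

coeffP : Poly → ℕ → ℤ
coeffP []       _       = + 0
coeffP (a ∷ _)  zero    = a
coeffP (_ ∷ as) (suc n) = coeffP as n

_≈P_ : Poly → Poly → Set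
p ≈P r = ∀ n → coeffP p n ≡ coeffP r n

padd : Poly → Poly → Poly
padd []       g        = g
padd f        []       = f
padd (a ∷ f)  (b ∷ g)  = (a ℤ.+ b) ∷ padd f g

pscale : ℤ → Poly → Poly
pscale c = map (c ℤ.*_)

pmul : Poly → Poly → Poly
pmul []      g = []
pmul (a ∷ f) g = padd (pscale a g) (+ 0 ∷ pmul f g)

pvar : Poly
pvar = + 0 ∷ + 1 ∷ []

pone : Poly
pone = + 1 ∷ []

ppow : Poly → ℕ → Poly
ppow p zero    = pone
ppow p (suc n) = pmul p (ppow p n)

psubst : ℕ → Poly → Poly
psubst k []       = []
psubst k (a ∷ as) = padd (a ∷ []) (pmul (ppow pvar k) (psubst k as))

-- The field ℚ(q) = Frac(ℤ[q]) as formal fractions (numerator, denominator).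
-- Equality requires both denominators to be nonzero.

K : Set
K = Poly × Poly

_≈K_ : K → K → Set
(a , b) ≈K (c , d) = (¬ (b ≈P [])) × (¬ (d ≈P [])) × (pmul a d ≈P pmul c b)

kconstℤ : ℤ → K
kconstℤ c = (c ∷ [] , pone)

k0 k1 kq : K
k0 = ([] , pone)
k1 = kconstℤ (+ 1)
kq = (pvar , pone)

kadd : K → K → K
kadd (a , b) (c , d) = (padd (pmul a d) (pmul c b) , pmul b d)

kmul : K → K → K
kmul (a , b) (c , d) = (pmul a c , pmul b d)

kneg : K → K
kneg (a , b) = (pscale (ℤ.- (+ 1)) a , b)

ksub : K → K → K
ksub x y = kadd x (kneg y)

kdiv : K → K → K
kdiv (a , b) (c , d) = (pmul a d , pmul b c)

kpowℕ : K → ℕ → K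
kpowℕ x zero    = k1
kpowℕ x (suc n) = kmul x (kpowℕ x n)

qpow : ℤ → K
qpow (+ n)      = (ppow pvar n , pone)
qpow -[1+ n ]   = (pone , ppow pvar (suc n))

kt : K
kt = qpow (ℤ.- (+ 1))

qint : ℤ → K
qint u = kdiv (ksub k1 (qpow u)) (ksub k1 kq)

tint : ℤ → K
tint u = kdiv (ksub k1 (qpow (ℤ.- u))) (ksub k1 kt)

kM : K
kM = kmul (ksub k1 kt) (ksub k1 kq)

-- plethystic p_k on scalars: q ↦ q^k
kpk : ℕ → K → K
kpk k (a , b) = (psubst k a , psubst k b)

-- Symmetric functions over ℚ(q), in the power-sum basis:
-- a finite K-linear combination of p_λ, λ a weakly decreasing list.

Λ : Set
Λ = List (K × List ℕ)

insertPart : ℕ → List ℕ → List ℕ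
insertPart k []       = k ∷ []
insertPart k (m ∷ ms) = if ⌊ m ℕ.≤? k ⌋ then k ∷ m ∷ ms else m ∷ insertPart k ms

mergePart : List ℕ → List ℕ → List ℕ
mergePart λ₁ ν = foldr insertPart ν λ₁

Λ0 Λ1 : Λ
Λ0 = []
Λ1 = (k1 , []) ∷ []

Λadd : Λ → Λ → Λ
Λadd = _++_

Λscale : K → Λ → Λ
Λscale c = map (λ t → (kmul c (proj₁ t) , proj₂ t))

Λmul : Λ → Λ → Λ
Λmul F G = concatMap (λ s → map (λ t → (kmul (proj₁ s) (proj₁ t) , mergePart (proj₂ s) (proj₂ t))) G) F

pΛ : ℕ → Λ
pΛ k = (k1 , k ∷ []) ∷ []

coeffΛ : Λ → List ℕ → K
coeffΛ []             λ₁ = k0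
coeffΛ ((c , ν) ∷ F)  λ₁ = if ⌊ ≡-dec ℕ._≟_ ν λ₁ ⌋ then kadd c (coeffΛ F λ₁) else coeffΛ F λ₁

_≈Λ_ : Λ → Λ → Set
F ≈Λ G = ∀ λ₁ → coeffΛ F λ₁ ≈K coeffΛ G λ₁

substΛ : (ℕ → Λ) → Λ → Λ
substΛ P []            = Λ0
substΛ P ((c , λ₁) ∷ F) = Λadd (Λscale c (foldr (λ k acc → Λmul (P k) acc) Λ1 λ₁)) (substΛ P F)

ΛPoly : Set
ΛPoly = List Λ

wadd : ΛPoly → ΛPoly → ΛPoly
wadd []      g       = g
wadd f       []      = f
wadd (a ∷ f) (b ∷ g) = Λadd a b ∷ wadd f g

wmul : ΛPoly → ΛPoly → ΛPoly
wmul []      g = []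
wmul (a ∷ f) g = wadd (map (Λmul a) g) (Λ0 ∷ wmul f g)

wscale : K → ΛPoly → ΛPoly
wscale c = map (Λscale c)

wpow : ΛPoly → ℕ → ΛPoly
wpow f zero    = Λ1 ∷ []
wpow f (suc n) = wmul f (wpow f n)

wcoeff : ΛPoly → ℕ → Λ
wcoeff []      _       = Λ0
wcoeff (a ∷ _) zero    = a
wcoeff (_ ∷ f) (suc n) = wcoeff f n

wmono : ℕ → Λ → ΛPoly
wmono zero    a = a ∷ []
wmono (suc k) a = Λ0 ∷ wmono k a

substΛw : (ℕ → ΛPoly) → Λ → ΛPoly
substΛw P []             = []
substΛw P ((c , λ₁) ∷ F) = wadd (wscale c (foldr (λ k acc → wmul (P k) acc) (Λ1 ∷ []) λ₁)) (substΛw P F)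

fact : ℕ → ℕ
fact zero    = 1
fact (suc n) = suc n ℕ.* fact n

sumTo : ℕ → (ℕ → ΛPoly) → ΛPoly
sumTo zero    f = []
sumTo (suc n) f = wadd (sumTo n f) (f n)

-- Coefficient of z^m in Ω[zY] = exp(Σ_{k≥1} z^k p_k[Y]/k), where y k = p_k[Y].
-- Only k ≤ m and exponential terms of order ≤ m contribute to z^m,
-- so the series is truncated accordingly.
omegaCoeff : (ℕ → Λ) → ℕ → Λ
omegaCoeff y m = wcoeff expS m
  where
  S : ΛPoly
  S = sumTo m (λ i → wmono (suc i) (Λscale (kdiv k1 (kconstℤ (+ suc i))) (y (suc i))))
  expS : ΛPoly
  expS = sumTo (suc m) (λ j → wscale (kdiv k1 (kconstℤ (+ fact j))) (wpow S j))

omegaCoeffℤ : (ℕ → Λ) → ℤ → Λ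
omegaCoeffℤ y (+ n)    = omegaCoeff y n
omegaCoeffℤ y -[1+ n ] = Λ0

-- Schur functions via the Jacobi–Trudi identity s_μ = det(h_{μ_i - i + j})

hΛ : ℕ → Λ
hΛ n = omegaCoeff pΛ n

hℤ : ℤ → Λ
hℤ (+ n)    = hΛ n
hℤ -[1+ n ] = Λ0

removeAt : {A : Set} → ℕ → List A → List A
removeAt _       []       = []
removeAt zero    (_ ∷ xs) = xs
removeAt (suc i) (x ∷ xs) = x ∷ removeAt i xs

-- determinant by cofactor expansion along the first row
-- (the ℕ argument is the number of rows, used for structural recursion)
mutual
  detN : ℕ → List (List Λ) → Λ
  detN zero    _            = Λ1
  detN (suc n) []           = Λ1
  detN (suc n) (row ∷ rows) = detRow n rows zero row

  detRow : ℕ → List (List Λ) → ℕ → List Λ → Λ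
  detRow n rows j []       = Λ0
  detRow n rows j (a ∷ as) =
    Λadd (Λscale (kpowℕ (kconstℤ (ℤ.- (+ 1))) j)
                 (Λmul a (detN n (map (removeAt j) rows))))
         (detRow n rows (suc j) as)

det : List (List Λ) → Λ
det rows = detN (length rows) rows

upTo : ℕ → List ℕ
upTo zero    = []
upTo (suc n) = upTo n ++ (n ∷ [])

jtRows : ℕ → ℕ → List ℕ → List (List Λ)
jtRows ℓ i []       = []
jtRows ℓ i (m ∷ ms) = map (λ j → hℤ ((+ m) ℤ.- (+ i) ℤ.+ (+ j))) (upTo ℓ) ∷ jtRows ℓ (suc i) ms

schur : List ℕ → Λ
schur μ = det (jtRows (length μ) zero μ)

IsPartition : List ℕ → Set
IsPartition μ = All (λ x → 1 ℕ.≤ x) μ × Linked ℕ._≥_ μ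

plethXover1mq : Λ → Λ
plethXover1mq = substΛ (λ k → Λscale (kpk k (kdiv k1 (ksub k1 kq))) (pΛ k))

-- D_{u,v} F = F[X + M[u]_q/z] Ω[-z[u]_t X] |_{z^v}
-- F[X + E/z] is a polynomial in w = 1/z:  p_k ↦ p_k + p_k[E] w^k.
Dop : ℤ → ℤ → Λ → Λ
Dop u v F = sumΛ (upTo (length G))
  where
  E : K
  E = kmul kM (qint u)
  G : ΛPoly
  G = substΛw (λ k → wadd (pΛ k ∷ []) (wmono k (Λscale (kpk k E) Λ1))) F
  y : ℕ → Λ
  y k = Λscale (kneg (kpk k (tint u))) (pΛ k)
  sumΛ : List ℕ → Λ
  sumΛ []       = Λ0
  sumΛ (m ∷ ms) = Λadd (Λmul (wcoeff G m) (omegaCoeffℤ y ((+ m) ℤ.+ v))) (sumΛ ms)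

geomK : K → ℕ → K
geomK a zero    = k0
geomK a (suc n) = kadd k1 (kmul a (geomK a n))

Bμ : List ℕ → K → K → K
Bμ []       a b = k0
Bμ (m ∷ μ)  a b = kadd (geomK a m) (kmul b (Bμ μ a b))

{-# OPTIONS --safe #-}

-- Put Y = X/(1−q), a = q^u, h_n for the complete function h_n[Y], and x for 1/(qz). Then D_{u,0} F is the image of
-- F[Y + (a−1)x] under the linear map L : x^m ↦ g_m, where Σ g_m z^m = Ω[(1−1/a)zY]. The substitution h_n ↦ ĥ_n
-- satisfies ĥ_{n+1} − a x ĥ_n = h_{n+1} − x h_n, so column operations turn the Jacobi–Trudi determinant
-- det(ĥ_{μ_i−i+j}), 0 ≤ i,j < ℓ, into Σ_r det(A with column r replaced by x^r ĥ_{μ_i−i}), where A = (h_{μ_i−i+j}).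
-- Now L acts on a single column, and since h(z/a) g(z) = h(z) it makes column r equal to
-- (1−1/a)(a^{μ_i−i} A_{ir} − Σ_{j≤r} a^{−j} g_{r−j} A_{ij}) + g_r A_{i0}. In the sum over r, the row scaling contributes
-- the sum of its factors and each triangular combination of columns the sum of its diagonal coefficients; together
-- they give 1 + (1−1/a) Σ_i (a^{μ_i} − 1) a^{−i}, the stated eigenvalue.
module Submission where

open import Algebra.Bundles using (CommutativeRing)
open import Data.Integer as ℤ using (ℤ; +_; -[1+_])
import Data.Integer.Properties as ℤₚ
open import Data.List using (List; []; _∷_; _++_; map; length; foldr; concatMap)
import Data.List.Properties as Listₚ
open import Data.Nat as ℕ using (ℕ; zero; suc)
import Data.Nat.Properties as ℕₚ
open import Data.Product using (Σ; ∃; _,_; proj₁; proj₂)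
open import Data.Sum using (inj₁; inj₂)
open import Function using (_∘_)
open import Level using (0ℓ)
open import Relation.Binary.PropositionalEquality as ≡ using (_≡_; _≢_)
open import Relation.Nullary using (¬_; yes; no; contradiction)

-- The constants come from two scalar identities with a = q^u: M[u]_q/(1-q) = (1-1/q)(1-a)/(1-q) =
-- (a-1)/q, which is the translation of Y, and -[u]_t = (1-1/a)·q/(1-q), which makes Ω[-z[u]_tX] a
-- series in qz. No Ω is manipulated as an exponential. A series f = Ω[zE] is encoded by f(0) = 1
-- and f′ = y f, where y lists the p_k[E]; this determines f wherever positive integers can be
-- cancelled. The obstacle is that the definitions in the statement are lists without ring laws:
-- fractions whose denominator may vanish (p_0 already sends 1/(1-q) to denominator 0), on which
-- `_≈K_` is not reflexive, and combinations of power sums that agree only coefficientwise. Hence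
-- the determinant argument is run over an arbitrary commutative ring, rings are built for ℚ(q) and
-- Λ, and the relations `_⊩_`, `_⊩Λ_` and `_⊩S_` follow every raw operation into them.

-- Ring homomorphisms, interpretations in a ring, and tools for calculation

record RingHom (R S : CommutativeRing 0ℓ 0ℓ) : Set where
  private
    module R = CommutativeRing R
    module S = CommutativeRing S
  field
    φ      : R.Carrier → S.Carrier
    φ-cong : ∀ {x y} → x R.≈ y → φ x S.≈ φ y
    φ-+    : ∀ x y → φ (x R.+ y) S.≈ φ x S.+ φ y
    φ-*    : ∀ x y → φ (x R.* y) S.≈ φ x S.* φ y
    φ-0    : φ R.0# S.≈ S.0#
    φ-1    : φ R.1# S.≈ S.1#

-- No laws are assumed on `A`: they are inherited through `ι`, as `Pullback` shows. Coefficient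
-- lists become rings in this way, with trailing zeros identified.
record Embedding (A : Set) (R : CommutativeRing 0ℓ 0ℓ) : Set where
  open CommutativeRing R
  field
    ι      : A → Carrier
    _⊕_    : A → A → A
    _⊗_    : A → A → A
    ⊖_     : A → A
    𝟘 𝟙    : A
    ⊕-homo : ∀ x y → ι (x ⊕ y) ≈ ι x + ι y
    ⊗-homo : ∀ x y → ι (x ⊗ y) ≈ ι x * ι y
    ⊖-homo : ∀ x → ι (⊖ x) ≈ - ι x
    𝟘-homo : ι 𝟘 ≈ 0#
    𝟙-homo : ι 𝟙 ≈ 1#

module IntegerSolver (R : CommutativeRing 0ℓ 0ℓ) where
  open import Data.Maybe using (just; nothing)
  import Algebra.Solver.Ring as Solver
  open import Algebra.Solver.Ring.AlmostCommutativeRing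
    using (fromCommutativeRing; _-Raw-AlmostCommutative⟶_; Induced-equivalence)
  open import Relation.Binary.Definitions using (WeaklyDecidable)

  open CommutativeRing R hiding (zero)
  open import Algebra.Properties.Ring ring
    using (-‿+-comm; -‿involutive; -0#≈0#; -‿distribˡ-*; -‿distribʳ-*)
  open import Algebra.Properties.Semiring.Mult.TCOptimised semiring using (_×_; ×-homo-+; ×1-homo-*; 1+×)
  open import Relation.Binary.Reasoning.Setoid setoid

  fromℤ : ℤ → Carrier
  fromℤ (+ n)    = n × 1#
  fromℤ -[1+ n ] = - (suc n × 1#)

  fromℤ-⊖ : ∀ m n → fromℤ (m ℤ.⊖ n) ≈ m × 1# + - (n × 1#)
  fromℤ-⊖ m zero = sym (trans (+-congˡ -0#≈0#) (+-identityʳ _))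
  fromℤ-⊖ zero (suc n) = sym (+-identityˡ _)
  fromℤ-⊖ (suc m) (suc n) = begin
    fromℤ (suc m ℤ.⊖ suc n)                    ≡⟨ ≡.cong fromℤ (ℤₚ.[1+m]⊖[1+n]≡m⊖n m n) ⟩
    fromℤ (m ℤ.⊖ n)                            ≈⟨ fromℤ-⊖ m n ⟩
    m × 1# + - (n × 1#)                        ≈⟨ +-congˡ (+-identityˡ _) ⟨
    m × 1# + (0# + - (n × 1#))                 ≈⟨ +-congˡ (+-congʳ (-‿inverseʳ 1#)) ⟨
    m × 1# + ((1# + - 1#) + - (n × 1#))        ≈⟨ +-congˡ (+-assoc _ _ _) ⟩
    m × 1# + (1# + (- 1# + - (n × 1#)))        ≈⟨ +-assoc _ _ _ ⟨
    (m × 1# + 1#) + (- 1# + - (n × 1#))        ≈⟨ +-cong (+-comm _ _) (-‿+-comm _ _) ⟩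
    (1# + m × 1#) + - (1# + n × 1#)            ≈⟨ +-cong (1+× m 1#) (-‿cong (1+× n 1#)) ⟨
    suc m × 1# + - (suc n × 1#)                ∎

  fromℤ-neg : ∀ i → fromℤ (ℤ.- i) ≈ - fromℤ i
  fromℤ-neg (+ zero)  = sym -0#≈0#
  fromℤ-neg (+ suc n) = refl
  fromℤ-neg -[1+ n ]  = sym (-‿involutive _)

  fromℤ-+ : ∀ i j → fromℤ (i ℤ.+ j) ≈ fromℤ i + fromℤ j
  fromℤ-+ (+ m)    (+ n)    = ×-homo-+ 1# m n
  fromℤ-+ (+ m)    -[1+ n ] = fromℤ-⊖ m (suc n)
  fromℤ-+ -[1+ m ] (+ n)    = trans (fromℤ-⊖ n (suc m)) (+-comm _ _)
  fromℤ-+ -[1+ m ] -[1+ n ] = begin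
    - (suc (suc (m ℕ.+ n)) × 1#)         ≡⟨ ≡.cong (λ k → - (suc k × 1#)) (ℕₚ.+-suc m n) ⟨
    - ((suc m ℕ.+ suc n) × 1#)           ≈⟨ -‿cong (×-homo-+ 1# (suc m) (suc n)) ⟩
    - (suc m × 1# + suc n × 1#)          ≈⟨ -‿+-comm _ _ ⟨
    - (suc m × 1#) + - (suc n × 1#)      ∎

  fromℤ-*⁺ : ∀ m j → fromℤ (+ m ℤ.* j) ≈ m × 1# * fromℤ j
  fromℤ-*⁺ m (+ n) = trans (reflexive (≡.cong fromℤ (≡.sym (ℤₚ.pos-* m n)))) (×1-homo-* m n)
  fromℤ-*⁺ m -[1+ n ] = begin
    fromℤ (+ m ℤ.* -[1+ n ])        ≡⟨ ≡.cong fromℤ (ℤₚ.neg-distribʳ-* (+ m) (+ suc n)) ⟨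
    fromℤ (ℤ.- (+ m ℤ.* + suc n))   ≈⟨ fromℤ-neg (+ m ℤ.* + suc n) ⟩
    - fromℤ (+ m ℤ.* + suc n)       ≈⟨ -‿cong (fromℤ-*⁺ m (+ suc n)) ⟩
    - (m × 1# * (suc n × 1#))       ≈⟨ -‿distribʳ-* _ _ ⟩
    m × 1# * - (suc n × 1#)         ∎

  fromℤ-* : ∀ i j → fromℤ (i ℤ.* j) ≈ fromℤ i * fromℤ j
  fromℤ-* (+ m) j = fromℤ-*⁺ m j
  fromℤ-* -[1+ m ] j = begin
    fromℤ (-[1+ m ] ℤ.* j)          ≡⟨ ≡.cong fromℤ (ℤₚ.neg-distribˡ-* (+ suc m) j) ⟨
    fromℤ (ℤ.- (+ suc m ℤ.* j))     ≈⟨ fromℤ-neg (+ suc m ℤ.* j) ⟩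
    - fromℤ (+ suc m ℤ.* j)         ≈⟨ -‿cong (fromℤ-*⁺ (suc m) j) ⟩
    - (suc m × 1# * fromℤ j)        ≈⟨ -‿distribˡ-* _ _ ⟩
    - (suc m × 1#) * fromℤ j        ∎

  fromℤ-morphism : ℤ.+-*-rawRing -Raw-AlmostCommutative⟶ fromCommutativeRing R
  fromℤ-morphism = record
    { ⟦_⟧    = fromℤ
    ; +-homo = fromℤ-+
    ; *-homo = fromℤ-*
    ; -‿homo = fromℤ-neg
    ; 0-homo = refl
    ; 1-homo = refl
    }

  private
    -- The solver compares integer coefficients, where equality is decidable, and so can cancel
    -- opposite terms over any `R`.
    weakly≟ : WeaklyDecidable (Induced-equivalence fromℤ-morphism)
    weakly≟ i j with i ℤ.≟ j
    ... | yes i≡j = just (reflexive (≡.cong fromℤ i≡j))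
    ... | no  _   = nothing

  open Solver ℤ.+-*-rawRing (fromCommutativeRing R) fromℤ-morphism weakly≟ public
    using (solve; _:=_; _:+_; _:*_; _:-_; :-_; con)

module FiniteSum (R : CommutativeRing 0ℓ 0ℓ) where
  open import Data.Nat using (_<_; s≤s)
  open CommutativeRing R hiding (zero)

  ∑< : ℕ → (ℕ → Carrier) → Carrier
  ∑< zero    f = 0#
  ∑< (suc n) f = ∑< n f + f n

  ∑<-cong : ∀ {f f′} → (∀ i → f i ≈ f′ i) → ∀ n → ∑< n f ≈ ∑< n f′
  ∑<-cong eq zero    = refl
  ∑<-cong eq (suc n) = +-cong (∑<-cong eq n) (eq n)

  ∑<-head : ∀ f n → ∑< (suc n) f ≈ f 0 + ∑< n (f ∘ suc)
  ∑<-head f zero    = +-comm _ _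
  ∑<-head f (suc n) = trans (+-congʳ (∑<-head f n)) (+-assoc _ _ _)

  ∑<-scale : ∀ t f n → ∑< n (λ i → t * f i) ≈ t * ∑< n f
  ∑<-scale t f zero    = sym (zeroʳ t)
  ∑<-scale t f (suc n) = trans (+-congʳ (∑<-scale t f n)) (sym (distribˡ t _ _))

  ∑<-zero : ∀ {f} n → (∀ i → i < n → f i ≈ 0#) → ∑< n f ≈ 0#
  ∑<-zero zero    eq = refl
  ∑<-zero (suc n) eq =
    trans (+-cong (∑<-zero n (λ i i<n → eq i (ℕₚ.m≤n⇒m≤1+n i<n))) (eq n ℕₚ.≤-refl)) (+-identityˡ _)

  ∑<-single : ∀ {f} m n → m < n → (∀ i → i ≢ m → f i ≈ 0#) → ∑< n f ≈ f m
  ∑<-single m (suc n) (s≤s m≤n) eq with ℕₚ.m≤n⇒m<n∨m≡n m≤n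
  ... | inj₁ m<n    = trans (+-cong (∑<-single m n m<n eq) (eq n (ℕₚ.>⇒≢ m<n))) (+-identityʳ _)
  ... | inj₂ ≡.refl = trans (+-congʳ (∑<-zero n (λ i i<n → eq i (ℕₚ.<⇒≢ i<n)))) (+-identityˡ _)

-- Ring structure transported along an interpretation

module Pullback {A : Set} {R : CommutativeRing 0ℓ 0ℓ} (E : Embedding A R) where
  open CommutativeRing R
  open Embedding E

  -- A record, so that the two sides can be inferred from a proof.
  infix 4 _≃_
  record _≃_ (x y : A) : Set where
    constructor by-image
    field image : ι x ≈ ι y
  open _≃_ public

  private
    via : ∀ {x y x′ y′} → ι x ≈ x′ → ι y ≈ y′ → x′ ≈ y′ → x ≃ y
    via p q e = by-image (trans p (trans e (sym q)))

    2⊕ : ∀ x y {x′ y′} → ι x ≈ x′ → ι y ≈ y′ → ι (x ⊕ y) ≈ x′ + y′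
    2⊕ x y p q = trans (⊕-homo x y) (+-cong p q)

    2⊗ : ∀ x y {x′ y′} → ι x ≈ x′ → ι y ≈ y′ → ι (x ⊗ y) ≈ x′ * y′
    2⊗ x y p q = trans (⊗-homo x y) (*-cong p q)

  pullback : CommutativeRing 0ℓ 0ℓ
  pullback = record
    { Carrier = A
    ; _≈_ = _≃_
    ; _+_ = _⊕_ ; _*_ = _⊗_ ; -_ = ⊖_ ; 0# = 𝟘 ; 1# = 𝟙
    ; isCommutativeRing = record
      { isRing = record
        { +-isAbelianGroup = record
          { isGroup = record
            { isMonoid = record
              { isSemigroup = record
                { isMagma = record
                  { isEquivalence = record
                    { refl = by-image refl
                    ; sym = λ p → by-image (sym (image p))
                    ; trans = λ p q → by-image (trans (image p) (image q)) }
                  ; ∙-cong = λ {x} {y} {u} {v} p q → via (⊕-homo x u) (⊕-homo y v) (+-cong (image p) (image q)) }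
                ; assoc = λ x y z → via (2⊕ _ _ (⊕-homo x y) refl) (2⊕ _ _ refl (⊕-homo y z)) (+-assoc _ _ _) }
              ; identity = (λ x → by-image (trans (2⊕ _ _ 𝟘-homo refl) (+-identityˡ _)))
                         , (λ x → by-image (trans (2⊕ _ _ refl 𝟘-homo) (+-identityʳ _))) }
            ; inverse = (λ x → via (2⊕ _ _ (⊖-homo x) refl) 𝟘-homo (-‿inverseˡ _))
                      , (λ x → via (2⊕ _ _ refl (⊖-homo x)) 𝟘-homo (-‿inverseʳ _))
            ; ⁻¹-cong = λ {x} {y} p → via (⊖-homo x) (⊖-homo y) (-‿cong (image p)) }
          ; comm = λ x y → via (⊕-homo x y) (⊕-homo y x) (+-comm _ _) }
        ; *-cong = λ {x} {y} {u} {v} p q → via (⊗-homo x u) (⊗-homo y v) (*-cong (image p) (image q))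
        ; *-assoc = λ x y z → via (2⊗ _ _ (⊗-homo x y) refl) (2⊗ _ _ refl (⊗-homo y z)) (*-assoc _ _ _)
        ; *-identity = (λ x → by-image (trans (2⊗ _ _ 𝟙-homo refl) (*-identityˡ _)))
                     , (λ x → by-image (trans (2⊗ _ _ refl 𝟙-homo) (*-identityʳ _)))
        ; distrib = (λ x y z → via (2⊗ _ _ refl (⊕-homo y z)) (2⊕ _ _ (⊗-homo x y) (⊗-homo x z)) (distribˡ _ _ _))
                  , (λ x y z → via (2⊗ _ _ (⊕-homo y z) refl) (2⊕ _ _ (⊗-homo y x) (⊗-homo z x)) (distribʳ _ _ _)) }
      ; *-comm = λ x y → via (⊗-homo x y) (⊗-homo y x) (*-comm _ _) } }

-- Formal power series and the differential equation of Ω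

module Series (R : CommutativeRing 0ℓ 0ℓ) where
  open import Data.Nat using (_≤_; z≤n; s≤s)

  open CommutativeRing R hiding (zero)
  import Relation.Binary.Reasoning.Setoid as SetoidReasoning
  open import Algebra.Properties.Semiring.Mult.TCOptimised semiring using (_×_; 1+×)
  open import Relation.Binary.Reasoning.Setoid setoid
  open IntegerSolver R

  Ser : Set
  Ser = ℕ → Carrier

  infix  4 _≋_
  infixl 7 _⊛_
  infixl 6 _⊞_

  _≋_ : Ser → Ser → Set
  f ≋ g = ∀ n → f n ≈ g n

  -- The Cauchy product through f = f(0) + z f₁, by recursion on the degree; this avoids subtracting
  -- indices.
  _⊞_ _⊛_ : Ser → Ser → Ser
  (f ⊞ g) n = f n + g n
  (f ⊛ g) zero    = f 0 * g 0
  (f ⊛ g) (suc n) = f 0 * g (suc n) + ((f ∘ suc) ⊛ g) n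

  one : Ser
  one zero    = 1#
  one (suc _) = 0#

  -- Degree n sees only degrees up to n of both factors. The bound is what allows comparison with
  -- truncated series and induction on the degree.
  ⊛-cong≤ : ∀ {f f′ g g′} n → (∀ i → i ≤ n → f i ≈ f′ i) → (∀ i → i ≤ n → g i ≈ g′ i) →
    (f ⊛ g) n ≈ (f′ ⊛ g′) n
  ⊛-cong≤ zero    p q = *-cong (p 0 z≤n) (q 0 z≤n)
  ⊛-cong≤ (suc n) p q =
    +-cong (*-cong (p 0 z≤n) (q (suc n) ℕₚ.≤-refl))
           (⊛-cong≤ n (λ i i≤n → p (suc i) (s≤s i≤n)) (λ i i≤n → q i (ℕₚ.m≤n⇒m≤1+n i≤n)))

  ⊛-cong : ∀ {f f′ g g′} → f ≋ f′ → g ≋ g′ → f ⊛ g ≋ f′ ⊛ g′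
  ⊛-cong p q n = ⊛-cong≤ n (λ i _ → p i) (λ i _ → q i)

  -- The mirror image of the defining equation, splitting off the constant term of the right factor;
  -- commutativity rests on it.
  ⊛-suc : ∀ f g n → (f ⊛ g) (suc n) ≈ (f ⊛ (g ∘ suc)) n + f (suc n) * g 0
  ⊛-suc f g zero    = refl
  ⊛-suc f g (suc n) = trans (+-congˡ (⊛-suc (f ∘ suc) g n)) (sym (+-assoc _ _ _))

  ⊛-comm : ∀ f g → f ⊛ g ≋ g ⊛ f
  ⊛-comm f g zero    = *-comm _ _
  ⊛-comm f g (suc n) = begin
    f 0 * g (suc n) + ((f ∘ suc) ⊛ g) n   ≈⟨ +-cong (*-comm _ _) (⊛-comm (f ∘ suc) g n) ⟩
    g (suc n) * f 0 + (g ⊛ (f ∘ suc)) n   ≈⟨ +-comm _ _ ⟩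
    (g ⊛ (f ∘ suc)) n + g (suc n) * f 0   ≈⟨ ⊛-suc g f n ⟨
    (g ⊛ f) (suc n)                       ∎

  -- Stated with one scaled summand because `(f ⊛ g) ∘ suc` has exactly this shape, which is the
  -- inductive step of associativity; scaling and distributivity are special cases.
  ⊛-linearˡ : ∀ s f g h n → ((λ i → s * f i + g i) ⊛ h) n ≈ s * (f ⊛ h) n + (g ⊛ h) n
  ⊛-linearˡ s f g h zero = solve 4 (λ s f g h → (s :* f :+ g) :* h := s :* (f :* h) :+ g :* h) refl s _ _ _
  ⊛-linearˡ s f g h (suc n) =
    trans (+-congˡ (⊛-linearˡ s (f ∘ suc) (g ∘ suc) h n))
          (solve 6 (λ s f g h p q → (s :* f :+ g) :* h :+ (s :* p :+ q) := s :* (f :* h :+ p) :+ (g :* h :+ q))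
             refl s _ _ _ _ _)

  ⊛-distribʳ : ∀ h f g → (f ⊞ g) ⊛ h ≋ (f ⊛ h) ⊞ (g ⊛ h)
  ⊛-distribʳ h f g n =
    trans (⊛-cong {g = h} (λ i → +-congʳ (sym (*-identityˡ _))) (λ _ → refl) n)
          (trans (⊛-linearˡ 1# f g h n) (+-congʳ (*-identityˡ _)))

  ⊛-zeroˡ : ∀ f h → (∀ n → f n ≈ 0#) → ∀ n → (f ⊛ h) n ≈ 0#
  ⊛-zeroˡ f h f0 zero    = trans (*-congʳ (f0 0)) (zeroˡ _)
  ⊛-zeroˡ f h f0 (suc n) =
    trans (+-cong (trans (*-congʳ (f0 0)) (zeroˡ _)) (⊛-zeroˡ (f ∘ suc) h (f0 ∘ suc) n)) (+-identityˡ _)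

  ⊛-scaleˡ : ∀ s f h n → ((λ i → s * f i) ⊛ h) n ≈ s * (f ⊛ h) n
  ⊛-scaleˡ s f h n =
    trans (⊛-cong {g = h} (λ i → sym (+-identityʳ _)) (λ _ → refl) n)
          (trans (⊛-linearˡ s f (λ _ → 0#) h n) (trans (+-congˡ (⊛-zeroˡ _ h (λ _ → refl) n)) (+-identityʳ _)))

  ⊛-assoc : ∀ f g h → (f ⊛ g) ⊛ h ≋ f ⊛ (g ⊛ h)
  ⊛-assoc f g h zero    = *-assoc _ _ _
  ⊛-assoc f g h (suc n) =
    trans (+-congˡ (trans (⊛-linearˡ (f 0) (g ∘ suc) ((f ∘ suc) ⊛ g) h n) (+-congˡ (⊛-assoc (f ∘ suc) g h n))))
          (solve 5 (λ f g h p q → f :* g :* h :+ (f :* p :+ q) := f :* (g :* h :+ p) :+ q) refl (f 0) (g 0) _ _ _)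

  ⊛-identityˡ : ∀ f → one ⊛ f ≋ f
  ⊛-identityˡ f zero    = *-identityˡ _
  ⊛-identityˡ f (suc n) =
    trans (+-cong (*-identityˡ _) (⊛-zeroˡ (one ∘ suc) f (λ _ → refl) n)) (+-identityʳ _)

  series : CommutativeRing 0ℓ 0ℓ
  series = record
    { Carrier = Ser ; _≈_ = _≋_ ; _+_ = _⊞_ ; _*_ = _⊛_ ; -_ = λ f n → - f n ; 0# = λ _ → 0# ; 1# = one
    ; isCommutativeRing = record
      { isRing = record
        { +-isAbelianGroup = record
          { isGroup = record
            { isMonoid = record
              { isSemigroup = record
                { isMagma = record
                  { isEquivalence = record
                    { refl = λ _ → refl ; sym = λ p n → sym (p n) ; trans = λ p q n → trans (p n) (q n) }
                  ; ∙-cong = λ p q n → +-cong (p n) (q n) }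
                ; assoc = λ f g h n → +-assoc _ _ _ }
              ; identity = (λ f n → +-identityˡ _) , (λ f n → +-identityʳ _) }
            ; inverse = (λ f n → -‿inverseˡ _) , (λ f n → -‿inverseʳ _)
            ; ⁻¹-cong = λ p n → -‿cong (p n) }
          ; comm = λ f g n → +-comm _ _ }
        ; *-cong = ⊛-cong
        ; *-assoc = ⊛-assoc
        ; *-identity = ⊛-identityˡ , λ f n → trans (⊛-comm f one n) (⊛-identityˡ f n)
        ; distrib = (λ f g h n → trans (⊛-comm f (g ⊞ h) n) (trans (⊛-distribʳ f g h n) (+-cong (⊛-comm g f n) (⊛-comm h f n))))
                  , ⊛-distribʳ }
      ; *-comm = ⊛-comm } }

  ν : ℕ → Carrier
  ν n = n × 1#

  ν-suc : ∀ n → ν (suc n) ≈ 1# + ν n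
  ν-suc n = 1+× n 1#

  -- The Euler operator z·d/dz and the derivative d/dz. The product rule is proved for `θ` first,
  -- since it preserves degrees; `∂` is `θ` shifted by one.
  θ ∂ : Ser → Ser
  θ f n = ν n * f n
  ∂ f n = ν (suc n) * f (suc n)

  θ-⊛ : ∀ f g n → θ (f ⊛ g) n ≈ (θ f ⊛ g) n + (f ⊛ θ g) n
  θ-⊛ f g zero    = solve 2 (λ f g → con (+ 0) :* (f :* g) := (con (+ 0) :* f) :* g :+ f :* (con (+ 0) :* g)) refl (f 0) (g 0)
  θ-⊛ f g (suc n) = begin
    ν (suc n) * (f 0 * g (suc n) + (f′ ⊛ g) n)
      ≈⟨ solve 3 (λ s p q → s :* (p :+ q) := s :* p :+ s :* q) refl _ _ _ ⟩
    ν (suc n) * (f 0 * g (suc n)) + ν (suc n) * (f′ ⊛ g) n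
      ≈⟨ +-congˡ (trans (*-congʳ (ν-suc n)) (trans (distribʳ _ _ _) (+-congˡ (θ-⊛ f′ g n)))) ⟩
    ν (suc n) * (f 0 * g (suc n)) + (1# * (f′ ⊛ g) n + ((θ f′ ⊛ g) n + (f′ ⊛ θ g) n))
      ≈⟨ solve 6 (λ s f g p q r → s :* (f :* g) :+ (con (+ 1) :* p :+ (q :+ r))
            := (con (+ 0) :* f :* g :+ (con (+ 1) :* p :+ q)) :+ (f :* (s :* g) :+ r)) refl _ (f 0) _ _ _ _ ⟩
    (ν 0 * f 0 * g (suc n) + (1# * (f′ ⊛ g) n + (θ f′ ⊛ g) n)) + (f ⊛ θ g) (suc n)
      ≈⟨ +-congʳ (+-congˡ (trans (sym (⊛-linearˡ 1# f′ (θ f′) g n)) (⊛-cong {g = g} shift (λ _ → refl) n))) ⟩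
    (θ f ⊛ g) (suc n) + (f ⊛ θ g) (suc n) ∎
    where
    f′ = f ∘ suc
    shift : ∀ i → 1# * f′ i + θ f′ i ≈ θ f (suc i)
    shift i = trans (sym (distribʳ _ _ _)) (*-congʳ (sym (ν-suc i)))

  leibniz : ∀ f g → ∂ (f ⊛ g) ≋ (∂ f ⊛ g) ⊞ (f ⊛ ∂ g)
  leibniz f g n =
    trans (θ-⊛ f g (suc n))
          (+-cong (trans (+-congʳ (solve 2 (λ f g → con (+ 0) :* f :* g := con (+ 0)) refl _ _)) (+-identityˡ _))
                  (trans (⊛-suc f (θ g) n)
                         (trans (+-congˡ (solve 2 (λ f g → f :* (con (+ 0) :* g) := con (+ 0)) refl _ _)) (+-identityʳ _))))

  -- If y_i = p_{i+1}[E] for all i, this says that f = Ω[zE]: the equation f′ = y f is Newton's identity.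
  record IsExp (y f : Ser) : Set where
    field
      initial : f 0 ≈ 1#
      deriv : ∂ f ≋ y ⊛ f
  open IsExp public

  module _ (ν-cancel : ∀ n {x y} → ν (suc n) * x ≈ ν (suc n) * y → x ≈ y) where

    -- The equation f′ = y f expresses (n+1) f_{n+1} through lower coefficients. The extra bound in
    -- `go` makes the strong induction structural.
    IsExp-unique : ∀ {y f g} → IsExp y f → IsExp y g → f ≋ g
    IsExp-unique {y} {f} {g} F G n = go n n ℕₚ.≤-refl
      where
      go : ∀ n i → i ≤ n → f i ≈ g i
      go n       zero    _         = trans (initial F) (sym (initial G))
      go (suc n) (suc i) (s≤s i≤n) = ν-cancel i
        (trans (deriv F i) (trans (⊛-cong≤ {f = y} i (λ _ _ → refl) (λ j j≤i → go n j (ℕₚ.≤-trans j≤i i≤n)))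
                                  (sym (deriv G i))))

  IsExp-cong : ∀ {y y′ f} → y ≋ y′ → IsExp y f → IsExp y′ f
  IsExp-cong {f = f} eq F .initial = initial F
  IsExp-cong {f = f} eq F .deriv n = trans (deriv F n) (⊛-cong {g = f} eq (λ _ → refl) n)

  -- Ω[E + E′] = Ω[E] Ω[E′]: logarithmic derivatives add under multiplication.
  IsExp-⊛ : ∀ {y z f g} → IsExp y f → IsExp z g → IsExp (y ⊞ z) (f ⊛ g)
  IsExp-⊛ F G .initial = trans (*-cong (initial F) (initial G)) (*-identityˡ _)
  IsExp-⊛ {y} {z} {f} {g} F G .deriv = S.begin
    ∂ (f ⊛ g)                       S.≈⟨ leibniz f g ⟩
    (∂ f ⊛ g) ⊞ (f ⊛ ∂ g)           S.≈⟨ (λ n → +-cong (⊛-cong {g = g} (deriv F) (λ _ → refl) n)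
                                                        (⊛-cong {f = f} (λ _ → refl) (deriv G) n)) ⟩
    ((y ⊛ f) ⊛ g) ⊞ (f ⊛ (z ⊛ g))   S.≈⟨ T.solve 4 (λ y z f g → (y T.:* f) T.:* g T.:+ f T.:* (z T.:* g)
                                                     T.:= (y T.:+ z) T.:* (f T.:* g)) (λ _ → refl) y z f g ⟩
    (y ⊞ z) ⊛ (f ⊛ g)               S.∎
    where
    module S = SetoidReasoning (CommutativeRing.setoid series)
    module T = IntegerSolver series

  powers : Carrier → Ser
  powers x zero    = 1#
  powers x (suc n) = x * powers x n

  powers-cong : ∀ {x y} n → x ≈ y → powers x n ≈ powers y n
  powers-cong zero    p = refl
  powers-cong (suc n) p = *-cong p (powers-cong n p)

  ⊛-rescale : ∀ s f g n → powers s n * (f ⊛ g) n ≈ ((λ i → powers s i * f i) ⊛ (λ i → powers s i * g i)) n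
  ⊛-rescale s f g zero = solve 2 (λ f g → con (+ 1) :* (f :* g) := con (+ 1) :* f :* (con (+ 1) :* g)) refl (f 0) (g 0)
  ⊛-rescale s f g (suc n) = begin
    s * p * (f 0 * g (suc n) + (f′ ⊛ g) n)
      ≈⟨ solve 5 (λ s p f g q → s :* p :* (f :* g :+ q) := con (+ 1) :* f :* (s :* p :* g) :+ s :* (p :* q)) refl s p (f 0) _ _ ⟩
    1# * f 0 * (s * p * g (suc n)) + s * (p * (f′ ⊛ g) n)
      ≈⟨ +-congˡ (trans (*-congˡ (⊛-rescale s f′ g n)) (trans (sym (⊛-scaleˡ s _ _ n))
           (⊛-cong {g = λ i → powers s i * g i} (λ i → sym (*-assoc _ _ _)) (λ _ → refl) n))) ⟩
    ((λ i → powers s i * f i) ⊛ (λ i → powers s i * g i)) (suc n) ∎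
    where
    p = powers s n
    f′ = f ∘ suc

  -- Chain rule for z ↦ sz. As y_i stands for p_{i+1}, it acquires the factor s^{i+1}.
  IsExp-rescale : ∀ s {y f} → IsExp y f → IsExp (λ i → powers s (suc i) * y i) (λ i → powers s i * f i)
  IsExp-rescale s F .initial = trans (*-identityˡ _) (initial F)
  IsExp-rescale s {y} {f} F .deriv n = begin
    ν (suc n) * (s * powers s n * f (suc n))
      ≈⟨ solve 4 (λ v s p f → v :* (s :* p :* f) := s :* (p :* (v :* f))) refl _ s _ _ ⟩
    s * (powers s n * ∂ f n)
      ≈⟨ *-congˡ (trans (*-congˡ (deriv F n)) (⊛-rescale s y f n)) ⟩
    s * ((λ i → powers s i * y i) ⊛ (λ i → powers s i * f i)) n
      ≈⟨ ⊛-scaleˡ s _ _ n ⟨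
    ((λ i → s * (powers s i * y i)) ⊛ (λ i → powers s i * f i)) n
      ≈⟨ ⊛-cong {g = λ i → powers s i * f i} (λ i → sym (*-assoc _ _ _)) (λ _ → refl) n ⟩
    ((λ i → s * powers s i * y i) ⊛ (λ i → powers s i * f i)) n ∎

  -- The geometric series 1/(1 - xz) is Ω of the single variable x, for which p_k = x^k.
  IsExp-powers : ∀ x → IsExp (λ i → powers x (suc i)) (powers x)
  IsExp-powers x .initial = refl
  IsExp-powers x .deriv n = go n
    where
    go : ∀ n → ν (suc n) * powers x (suc n) ≈ ((λ i → powers x (suc i)) ⊛ powers x) n
    go zero    = *-comm _ _
    go (suc n) = begin
      ν (suc (suc n)) * (x * (x * p))
        ≈⟨ *-congʳ (ν-suc (suc n)) ⟩
      (1# + ν (suc n)) * (x * (x * p))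
        ≈⟨ solve 3 (λ v x p → (con (+ 1) :+ v) :* (x :* (x :* p)) := x :* con (+ 1) :* (x :* p) :+ x :* (v :* (x :* p))) refl _ x p ⟩
      x * 1# * (x * p) + x * (ν (suc n) * (x * p))
        ≈⟨ +-congˡ (trans (*-congˡ (go n)) (sym (⊛-scaleˡ x _ _ n))) ⟩
      x * 1# * (x * p) + ((λ i → x * (x * powers x i)) ⊛ powers x) n ∎
      where p = powers x n

module SeriesMap {R S : CommutativeRing 0ℓ 0ℓ} (f : RingHom R S) where
  open RingHom f

  private
    module S  = CommutativeRing S
    module SR = Series R
    module SS = Series S

  φ-ν : ∀ n → φ (SR.ν n) S.≈ SS.ν n
  φ-ν zero    = φ-0
  φ-ν (suc n) = S.trans (φ-cong (SR.ν-suc n))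
    (S.trans (φ-+ _ _) (S.trans (S.+-cong φ-1 (φ-ν n)) (S.sym (SS.ν-suc n))))

  φ-⊛ : ∀ f g n → φ ((f SR.⊛ g) n) S.≈ ((φ ∘ f) SS.⊛ (φ ∘ g)) n
  φ-⊛ f g zero    = φ-* _ _
  φ-⊛ f g (suc n) = S.trans (φ-+ _ _) (S.+-cong (φ-* _ _) (φ-⊛ (f ∘ suc) g n))

  IsExp-map : ∀ {y f} → SR.IsExp y f → SS.IsExp (φ ∘ y) (φ ∘ f)
  IsExp-map F .SS.IsExp.initial = S.trans (φ-cong (SR.IsExp.initial F)) φ-1
  IsExp-map {y} {f} F .SS.IsExp.deriv n =
    S.trans (S.sym (S.trans (φ-* _ _) (S.*-congʳ (φ-ν (suc n)))))
            (S.trans (φ-cong (SR.IsExp.deriv F n)) (φ-⊛ y f n))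

-- The exponential series over a ring containing 1/n

record NatInverses (R : CommutativeRing 0ℓ 0ℓ) : Set where
  open CommutativeRing R
  field
    inv   : ℕ → Carrier
    inv-ν : ∀ i → Series.ν R (suc i) * inv i ≈ 1#

module ExpSeries {R : CommutativeRing 0ℓ 0ℓ} (N : NatInverses R) where
  open import Data.Nat using (_≤_; _<_; s≤s)
  open CommutativeRing R hiding (zero)
  open NatInverses N
  open Series R
  open import Relation.Binary.Reasoning.Setoid setoid
  open IntegerSolver R
  open FiniteSum R

  ν-cancel : ∀ n {x y} → ν (suc n) * x ≈ ν (suc n) * y → x ≈ y
  ν-cancel n {x} {y} eq = trans (expand x) (trans (*-congˡ eq) (sym (expand y)))
    where
    expand : ∀ z → z ≈ inv n * (ν (suc n) * z)
    expand z = trans (sym (*-identityˡ z)) (trans (*-congʳ (trans (sym (inv-ν n)) (*-comm _ _))) (*-assoc _ _ _))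

  invFact : ℕ → Carrier
  invFact zero    = 1#
  invFact (suc j) = inv j * invFact j

  spow : Ser → ℕ → Ser
  spow f zero    = one
  spow f (suc j) = f ⊛ spow f j

  spow-cong≤ : ∀ {f f′} n → (∀ i → i ≤ n → f i ≈ f′ i) → ∀ j i → i ≤ n → spow f j i ≈ spow f′ j i
  spow-cong≤ n eq zero    i i≤n = refl
  spow-cong≤ n eq (suc j) i i≤n =
    ⊛-cong≤ i (λ k k≤i → eq k (ℕₚ.≤-trans k≤i i≤n)) (λ k k≤i → spow-cong≤ n eq j k (ℕₚ.≤-trans k≤i i≤n))

  partialExp : Ser → ℕ → Ser
  partialExp f J n = ∑< J (λ j → invFact j * spow f j n)

  module _ (y : Ser) where

    antiderivative : Ser
    antiderivative zero    = 0#
    antiderivative (suc i) = inv i * y i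

    -- In degree n only the powers S^0, ..., S^n of the antiderivative S are used. S has no constant
    -- term, so the later ones have order above n and this is the full exponential.
    expSeries : Ser
    expSeries n = partialExp antiderivative (suc n) n

    private
      s = antiderivative

      ∂s : ∂ s ≋ y
      ∂s i = trans (sym (*-assoc _ _ _)) (trans (*-congʳ (inv-ν i)) (*-identityˡ _))

      ∂-spow : ∀ j n → ∂ (spow s (suc j)) n ≈ ν (suc j) * (y ⊛ spow s j) n
      ∂-spow zero n = trans (leibniz s one n) (trans
        (+-cong (⊛-cong {g = one} ∂s (λ _ → refl) n)
                (trans (⊛-comm s (∂ one) n) (⊛-zeroˡ (∂ one) s (λ _ → zeroʳ _) n)))
        (trans (+-identityʳ _) (sym (*-identityˡ _))))
      ∂-spow (suc j) n = begin
        ∂ (s ⊛ spow s (suc j)) n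
          ≈⟨ leibniz s (spow s (suc j)) n ⟩
        (∂ s ⊛ spow s (suc j)) n + (s ⊛ ∂ (spow s (suc j))) n
          ≈⟨ +-cong (⊛-cong {g = spow s (suc j)} ∂s (λ _ → refl) n)
               (trans (⊛-cong {f = s} (λ _ → refl) (∂-spow j) n)
                 (trans (⊛-comm s _ n) (trans (⊛-scaleˡ (ν (suc j)) _ s n) (*-congˡ (rearrange n))))) ⟩
        (y ⊛ spow s (suc j)) n + ν (suc j) * (y ⊛ spow s (suc j)) n
          ≈⟨ solve 2 (λ u v → u :+ v :* u := (con (+ 1) :+ v) :* u) refl _ _ ⟩
        (1# + ν (suc j)) * (y ⊛ spow s (suc j)) n
          ≈⟨ *-congʳ (ν-suc (suc j)) ⟨
        ν (suc (suc j)) * (y ⊛ spow s (suc j)) n ∎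
        where
        rearrange : ∀ n → ((y ⊛ spow s j) ⊛ s) n ≈ (y ⊛ (s ⊛ spow s j)) n
        rearrange n = trans (⊛-assoc y (spow s j) s n) (⊛-cong {f = y} (λ _ → refl) (⊛-comm (spow s j) s) n)

      spow-order : ∀ j n → n < j → spow s j n ≈ 0#
      spow-order (suc j) zero    n<j       = zeroˡ _
      spow-order (suc j) (suc n) (s≤s n<j) =
        trans (+-cong (zeroˡ _) (trans
                 (⊛-cong≤ {s ∘ suc} {s ∘ suc} {spow s j} {λ _ → 0#} n (λ _ _ → refl)
                   (λ i i≤n → spow-order j i (ℕₚ.≤-<-trans i≤n n<j)))
                 (trans (⊛-comm (s ∘ suc) (λ _ → 0#) n) (⊛-zeroˡ _ (s ∘ suc) (λ _ → refl) n))))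
              (+-identityˡ _)

      stable : ∀ k n → partialExp s (k ℕ.+ suc n) n ≈ expSeries n
      stable zero    n = refl
      stable (suc k) n = trans (+-cong (stable k n)
        (trans (*-congˡ (spow-order _ n (ℕₚ.m≤n+m (suc n) k))) (zeroʳ _))) (+-identityʳ _)

      stable≤ : ∀ n i → i ≤ n → partialExp s (suc n) i ≈ expSeries i
      stable≤ n i i≤n = trans (reflexive (≡.cong (λ J → partialExp s J i)
        (≡.trans (≡.cong suc (≡.sym (ℕₚ.m∸n+n≡m i≤n))) (≡.sym (ℕₚ.+-suc (n ℕ.∸ i) i))))) (stable (n ℕ.∸ i) i)

      -- Differentiation lowers the truncation order by one; `stable≤` removes the discrepancy in
      -- the degrees that count.
      ∂-partialExp : ∀ J n → ∂ (partialExp s (suc J)) n ≈ (y ⊛ partialExp s J) n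
      ∂-partialExp zero n =
        trans (solve 1 (λ v → v :* (con (+ 0) :+ con (+ 1) :* con (+ 0)) := con (+ 0)) refl (ν (suc n)))
              (sym (trans (⊛-comm y _ n) (⊛-zeroˡ (λ _ → 0#) y (λ _ → refl) n)))
      ∂-partialExp (suc J) n = begin
        ν (suc n) * (partialExp s (suc J) (suc n) + inv J * invFact J * spow s (suc J) (suc n))
          ≈⟨ solve 5 (λ v p i f q → v :* (p :+ i :* f :* q) := v :* p :+ i :* f :* (v :* q)) refl _ _ (inv J) _ _ ⟩
        ∂ (partialExp s (suc J)) n + inv J * invFact J * ∂ (spow s (suc J)) n
          ≈⟨ +-cong (∂-partialExp J n) (*-congˡ (∂-spow J n)) ⟩
        (y ⊛ partialExp s J) n + inv J * invFact J * (ν (suc J) * (y ⊛ spow s J) n)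
          ≈⟨ solve 5 (λ p i f v q → p :+ i :* f :* (v :* q) := v :* i :* (f :* q) :+ p) refl _ (inv J) _ _ _ ⟩
        ν (suc J) * inv J * (invFact J * (y ⊛ spow s J) n) + (y ⊛ partialExp s J) n
          ≈⟨ +-cong (trans (*-congʳ (inv-ν J)) (trans (*-identityˡ _) (*-congˡ (⊛-comm y (spow s J) n)))) (⊛-comm y _ n) ⟩
        invFact J * (spow s J ⊛ y) n + (partialExp s J ⊛ y) n
          ≈⟨ ⊛-linearˡ (invFact J) (spow s J) (partialExp s J) y n ⟨
        ((λ i → invFact J * spow s J i + partialExp s J i) ⊛ y) n
          ≈⟨ ⊛-comm _ y n ⟩
        (y ⊛ (λ i → invFact J * spow s J i + partialExp s J i)) n
          ≈⟨ ⊛-cong {f = y} (λ _ → refl) (λ _ → +-comm _ _) n ⟩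
        (y ⊛ partialExp s (suc J)) n ∎

    expSeries-IsExp : IsExp y expSeries
    expSeries-IsExp .initial = solve 0 (con (+ 0) :+ con (+ 1) :* con (+ 1) := con (+ 1)) refl
    expSeries-IsExp .deriv n =
      trans (∂-partialExp (suc n) n) (⊛-cong≤ {f = y} n (λ _ _ → refl) (stable≤ n))

    -- Allows S to be replaced by a polynomial that agrees with it up to degree n, as the definition
    -- of `omegaCoeff` does.
    expSeries-truncated : ∀ n f → (∀ i → i ≤ n → f i ≈ antiderivative i) → partialExp f (suc n) n ≈ expSeries n
    expSeries-truncated n f eq = ∑<-cong (λ j → *-congˡ (spow-cong≤ n eq j n ℕₚ.≤-refl)) (suc n)

-- Determinants as alternating functions of a list of columns

module Determinant (R : CommutativeRing 0ℓ 0ℓ) (X : Set) where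
  open import Data.Nat using (_<_; s≤s)

  open CommutativeRing R hiding (zero)
  open import Algebra.Properties.Ring ring using (-0#≈0#)
  open import Relation.Binary.Reasoning.Setoid setoid
  open IntegerSolver R
  open FiniteSum R

  -- Columns are functions of a row label. For Jacobi-Trudi matrices the label is μ_i - i, so that
  -- all rows of column j come from one function and column operations are operations on list
  -- entries.
  Column : Set
  Column = X → Carrier

  sumOver : (X → Carrier) → List X → Carrier
  sumOver d []       = 0#
  sumOver d (n ∷ ns) = d n + sumOver d ns

  -- Σ_j (−1)^j c_j(n) k(cs without c_j); columns passed over are absorbed into k.
  expand : X → (List Column → Carrier) → List Column → Carrier
  expand n k []       = 0#
  expand n k (c ∷ cs) = c n * k cs - expand n (k ∘ (c ∷_)) cs

  -- The value 0 on surplus columns makes multilinearity and alternation valid for lists of every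
  -- length.
  det : List X → List Column → Carrier
  det []       []      = 1#
  det []       (_ ∷ _) = 0#
  det (n ∷ ns) cs      = expand n (det ns) cs

  expand-linear : ∀ n {k k₁ k₂} a b → (∀ cs → k cs ≈ a * k₁ cs + b * k₂ cs) →
    ∀ cs → expand n k cs ≈ a * expand n k₁ cs + b * expand n k₂ cs
  expand-linear n a b eq [] = solve 2 (λ a b → con (+ 0) := a :* con (+ 0) :+ b :* con (+ 0)) refl a b
  expand-linear n a b eq (c ∷ cs) =
    trans (+-cong (*-congˡ (eq cs)) (-‿cong (expand-linear n a b (λ ys → eq (c ∷ ys)) cs)))
          (solve 7 (λ a b c p q u v → c :* (a :* p :+ b :* q) :- (a :* u :+ b :* v)
                      := a :* (c :* p :- u) :+ b :* (c :* q :- v)) refl a b (c n) _ _ _ _)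

  expand-cong : ∀ n {k k′} → (∀ cs → k cs ≈ k′ cs) → ∀ cs → expand n k cs ≈ expand n k′ cs
  expand-cong n eq []       = refl
  expand-cong n eq (c ∷ cs) = +-cong (*-congˡ (eq cs)) (-‿cong (expand-cong n (λ ys → eq (c ∷ ys)) cs))

  expand-zero : ∀ n {k} → (∀ cs → k cs ≈ 0#) → ∀ cs → expand n k cs ≈ 0#
  expand-zero n eq []       = refl
  expand-zero n eq (c ∷ cs) =
    trans (+-cong (*-congˡ (eq cs)) (-‿cong (expand-zero n (λ ys → eq (c ∷ ys)) cs)))
          (solve 1 (λ c → c :* con (+ 0) :- con (+ 0) := con (+ 0)) refl (c n))

  -- Vanishing is required for adjacent equal columns only, which is the form that passes through
  -- `expand`; exchanges and repetitions at a distance are derived below.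
  record Alternating (k : List Column → Carrier) : Set where
    field
      linear : ∀ pre post {x y z} a b → (∀ n → z n ≈ a * x n + b * y n) →
               k (pre ++ z ∷ post) ≈ a * k (pre ++ x ∷ post) + b * k (pre ++ y ∷ post)
      alt    : ∀ pre x post → k (pre ++ x ∷ x ∷ post) ≈ 0#

  open Alternating

  module _ {k} (A : Alternating k) where

    alternating-∷ : ∀ c → Alternating (k ∘ (c ∷_))
    alternating-∷ c .linear pre = linear A (c ∷ pre)
    alternating-∷ c .alt pre    = alt A (c ∷ pre)

    linear₀ : ∀ {x y z} post a b → (∀ n → z n ≈ a * x n + b * y n) →
              k (z ∷ post) ≈ a * k (x ∷ post) + b * k (y ∷ post)
    linear₀ post = linear A [] post

    slot-cong : ∀ pre {x y} post → (∀ n → x n ≈ y n) → k (pre ++ x ∷ post) ≈ k (pre ++ y ∷ post)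
    slot-cong pre {x} {y} post eq =
      trans (linear A pre post {x = y} {y = y} 1# 0#
               (λ n → trans (eq n) (solve 1 (λ y → y := con (+ 1) :* y :+ con (+ 0) :* y) refl (y n))))
            (solve 1 (λ y → con (+ 1) :* y :+ con (+ 0) :* y := y) refl _)

    -- Polarisation: k vanishes on (x+y, x+y), (x, x) and (y, y), and multilinearity relates these
    -- values to the mixed ones.
    swap₀ : ∀ x y post → k (x ∷ y ∷ post) ≈ - k (y ∷ x ∷ post)
    swap₀ x y post = begin
      k (x ∷ y ∷ post)
        ≈⟨ solve 4 (λ xx xy yx yy → xy := (con (+ 1) :* (con (+ 1) :* xx :+ con (+ 1) :* xy)
                       :+ con (+ 1) :* (con (+ 1) :* yx :+ con (+ 1) :* yy)) :- xx :- yy :- yx)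
             refl (k (x ∷ x ∷ post)) _ (k (y ∷ x ∷ post)) (k (y ∷ y ∷ post)) ⟩
      (1# * (1# * k (x ∷ x ∷ post) + 1# * k (x ∷ y ∷ post))
        + 1# * (1# * k (y ∷ x ∷ post) + 1# * k (y ∷ y ∷ post)))
        - k (x ∷ x ∷ post) - k (y ∷ y ∷ post) - k (y ∷ x ∷ post)
        ≈⟨ +-congʳ (+-congʳ (+-congʳ (+-cong (*-congˡ (sym (split x))) (*-congˡ (sym (split y)))))) ⟩
      (1# * k (x ∷ x+y ∷ post) + 1# * k (y ∷ x+y ∷ post))
        - k (x ∷ x ∷ post) - k (y ∷ y ∷ post) - k (y ∷ x ∷ post)
        ≈⟨ +-congʳ (+-cong (+-cong (sym (linear₀ _ 1# 1# (λ _ → refl))) (-‿cong (alt A [] x post)))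
                           (-‿cong (alt A [] y post))) ⟩
      k (x+y ∷ x+y ∷ post) - 0# - 0# - k (y ∷ x ∷ post)
        ≈⟨ +-congʳ (+-congʳ (+-congʳ (alt A [] x+y post))) ⟩
      0# - 0# - 0# - k (y ∷ x ∷ post)
        ≈⟨ solve 1 (λ u → con (+ 0) :- con (+ 0) :- con (+ 0) :- u := :- u) refl _ ⟩
      - k (y ∷ x ∷ post) ∎
      where
      x+y : Column
      x+y n = 1# * x n + 1# * y n
      split : ∀ z → k (z ∷ x+y ∷ post) ≈ 1# * k (z ∷ x ∷ post) + 1# * k (z ∷ y ∷ post)
      split z = linear A (z ∷ []) post 1# 1# (λ _ → refl)

  -- The first copy of x moves right by exchanges until the two copies meet; columns already passed
  -- are absorbed into k.
  repeated-column : ∀ {k} → Alternating k → ∀ x mid post → k (x ∷ mid ++ x ∷ post) ≈ 0#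
  repeated-column A x []        post = alt A [] x post
  repeated-column A x (m ∷ mid) post =
    trans (swap₀ A x m _) (trans (-‿cong (repeated-column (alternating-∷ A m) x mid post)) -0#≈0#)

  expand-alternating : ∀ n {k} → Alternating k → Alternating (expand n k)
  expand-alternating n {k} A .linear [] post {x} {y} {z} a b eq =
    trans (+-cong (*-congʳ (eq n)) (-‿cong (expand-linear n a b (λ cs → linear₀ A cs a b eq) post)))
          (solve 7 (λ a b x y p u v → (a :* x :+ b :* y) :* p :- (a :* u :+ b :* v)
                      := a :* (x :* p :- u) :+ b :* (y :* p :- v)) refl a b (x n) (y n) _ _ _)
  expand-alternating n {k} A .linear (c ∷ pre) post {x} {y} {z} a b eq =
    trans (+-cong (*-congˡ (linear A pre post a b eq))
                  (-‿cong (linear (expand-alternating n (alternating-∷ A c)) pre post a b eq)))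
          (solve 7 (λ a b c p q u v → c :* (a :* p :+ b :* q) :- (a :* u :+ b :* v)
                      := a :* (c :* p :- u) :+ b :* (c :* q :- v)) refl a b (c n) _ _ _ _)
  -- The two terms that expand along a copy of x cancel; every later term keeps both copies in its
  -- minor and vanishes.
  expand-alternating n {k} A .alt [] x post =
    trans (+-congˡ (-‿cong (+-congˡ (-‿cong (expand-zero n (λ cs → alt A [] x cs) post)))))
          (solve 1 (λ u → u :- (u :- con (+ 0)) := con (+ 0)) refl _)
  expand-alternating n {k} A .alt (c ∷ pre) x post =
    trans (+-cong (*-congˡ (alt A pre x post))
                  (-‿cong (alt (expand-alternating n (alternating-∷ A c)) pre x post)))
          (solve 1 (λ c → c :* con (+ 0) :- con (+ 0) := con (+ 0)) refl (c n))

  det-alternating : ∀ ns → Alternating (det ns)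
  det-alternating [] .linear []      post a b eq = solve 2 (λ a b → con (+ 0) := a :* con (+ 0) :+ b :* con (+ 0)) refl a b
  det-alternating [] .linear (_ ∷ _) post a b eq = solve 2 (λ a b → con (+ 0) := a :* con (+ 0) :+ b :* con (+ 0)) refl a b
  det-alternating [] .alt []      x post = refl
  det-alternating [] .alt (_ ∷ _) x post = refl
  det-alternating (n ∷ ns) = expand-alternating n (det-alternating ns)

  columns : (ℕ → Column) → ℕ → ℕ → List Column
  columns c j zero    = []
  columns c j (suc m) = c j ∷ columns c (suc j) m

  columns-cong : ∀ {k} → Alternating k → ∀ {c c′} → (∀ j n → c j n ≈ c′ j n) →
    ∀ j m → k (columns c j m) ≈ k (columns c′ j m)
  columns-cong A eq j zero    = refl
  columns-cong A {c} {c′} eq j (suc m) =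
    trans (columns-cong (alternating-∷ A (c j)) eq (suc j) m) (slot-cong A [] _ (eq j))

  -- Σ_r k(c with c_r replaced by Y_r)
  replaceSum : (Y c : ℕ → Column) → (List Column → Carrier) → ℕ → ℕ → Carrier
  replaceSum Y c k j zero    = 0#
  replaceSum Y c k j (suc m) = k (Y j ∷ columns c (suc j) m) + replaceSum Y c (k ∘ (c j ∷_)) (suc j) m

  -- The elimination runs from the last column to the left, so that each column meets its left
  -- neighbour while that one is still unaltered.
  shear : ∀ {k} → Alternating k → ∀ y (c e : ℕ → Column) →
    (∀ j n → c (suc j) n ≈ e (suc j) n + y * c j n) →
    ∀ j m → k (columns c j (suc m)) ≈ k (c j ∷ columns e (suc j) m)
  shear A y c e rel j zero = refl
  shear {k} A y c e rel j (suc m) = begin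
    k (c j ∷ columns c (suc j) (suc m))
      ≈⟨ shear (alternating-∷ A (c j)) y c e rel (suc j) m ⟩
    k (c j ∷ c (suc j) ∷ es)
      ≈⟨ linear A (c j ∷ []) es 1# y (λ n → trans (rel j n) (+-congʳ (sym (*-identityˡ _)))) ⟩
    1# * k (c j ∷ e (suc j) ∷ es) + y * k (c j ∷ c j ∷ es)
      ≈⟨ +-congˡ (*-congˡ (alt A [] (c j) es)) ⟩
    1# * k (c j ∷ e (suc j) ∷ es) + y * 0#
      ≈⟨ solve 2 (λ u y → con (+ 1) :* u :+ y :* con (+ 0) := u) refl _ y ⟩
    k (c j ∷ e (suc j) ∷ es) ∎
    where es = columns e (suc (suc j)) m

  -- Choosing one term in each difference c_{i+1} − x c_i, only the choices omitting a single index r survive;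
  -- v moves to the free place, and the sign of this move cancels the sign of (−x)^r.
  unshear : ∀ {k} → Alternating k → ∀ x (p : ℕ → Carrier) (c e Y : ℕ → Column) (v : Column) →
    (∀ j n → c (suc j) n ≈ e (suc j) n + x * c j n) →
    (∀ j → p (suc j) ≈ x * p j) → (∀ j n → Y j n ≈ p j * v n) →
    ∀ j m → p j * k (v ∷ columns e (suc j) m) ≈ replaceSum Y c k j (suc m)
  unshear {k} A x p c e Y v rel pj Yj j m = trans (sym (scaled (columns e (suc j) m))) (go m)
    where
    scaled : ∀ post → k (Y j ∷ post) ≈ p j * k (v ∷ post)
    scaled post = trans (linear₀ A {x = v} {y = v} post (p j) 0# (λ n → trans (Yj j n) (sym (trans (+-congˡ (zeroˡ _)) (+-identityʳ _)))))
                        (trans (+-congˡ (zeroˡ _)) (+-identityʳ _))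
    go : ∀ m → k (Y j ∷ columns e (suc j) m) ≈ replaceSum Y c k j (suc m)
    go zero = sym (+-identityʳ _)
    go (suc m) = begin
      k (Y j ∷ e (suc j) ∷ es)
        ≈⟨ linear A (Y j ∷ []) es 1# (- x) (λ n →
             trans (solve 3 (λ e x c → e := con (+ 1) :* (e :+ x :* c) :+ (:- x) :* c) refl _ x (c j n))
                   (+-congʳ (*-congˡ (sym (rel j n))))) ⟩
      1# * k (Y j ∷ c (suc j) ∷ es) + - x * k (Y j ∷ c j ∷ es)
        ≈⟨ +-cong (*-congˡ (sym (shear (alternating-∷ A (Y j)) x c e rel (suc j) m)))
                  (*-congˡ (trans (scaled _) (*-congˡ (swap₀ A v (c j) es)))) ⟩
      1# * k (Y j ∷ columns c (suc j) (suc m)) + - x * (p j * - k (c j ∷ v ∷ es))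
        ≈⟨ solve 4 (λ u x p w → con (+ 1) :* u :+ (:- x) :* (p :* (:- w)) := u :+ (x :* p) :* w) refl _ x (p j) _ ⟩
      k (Y j ∷ columns c (suc j) (suc m)) + (x * p j) * k (c j ∷ v ∷ es)
        ≈⟨ +-congˡ (*-congʳ (sym (pj j))) ⟩
      k (Y j ∷ columns c (suc j) (suc m)) + p (suc j) * k (c j ∷ v ∷ es)
        ≈⟨ +-congˡ (unshear (alternating-∷ A (c j)) x p c e Y v rel pj Yj (suc j) m) ⟩
      replaceSum Y c k j (suc (suc m)) ∎
      where es = columns e (suc (suc j)) m

  replaceSum-linear : ∀ {k} → Alternating k → ∀ (c Y Y₁ Y₂ : ℕ → Column) a b →
    (∀ j n → Y j n ≈ a * Y₁ j n + b * Y₂ j n) →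
    ∀ j m → replaceSum Y c k j m ≈ a * replaceSum Y₁ c k j m + b * replaceSum Y₂ c k j m
  replaceSum-linear A c Y Y₁ Y₂ a b eq j zero = solve 2 (λ a b → con (+ 0) := a :* con (+ 0) :+ b :* con (+ 0)) refl a b
  replaceSum-linear A c Y Y₁ Y₂ a b eq j (suc m) =
    trans (+-cong (linear₀ A _ a b (eq j)) (replaceSum-linear (alternating-∷ A (c j)) c Y Y₁ Y₂ a b eq (suc j) m))
          (solve 6 (λ a b p q u v → (a :* p :+ b :* q) :+ (a :* u :+ b :* v) := a :* (p :+ u) :+ b :* (q :+ v)) refl a b _ _ _ _)

  Kills : (List Column → Carrier) → Column → Set
  Kills k v = ∀ pre post → k (pre ++ v ∷ post) ≈ 0#

  -- In Y_j the multiples of c_i with i < j repeat a column standing further left, so only the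
  -- diagonal coefficient survives. In the recursion those columns are hidden inside k, and `Kills`
  -- remembers them; the partial sum on the left-hand side avoids sums over a range starting at j.
  replaceSum-triangular : ∀ {k} → Alternating k → ∀ (c Y : ℕ → Column) (B : ℕ → ℕ → Carrier) →
    (∀ j n → Y j n ≈ ∑< (suc j) (λ i → B j i * c i n)) →
    ∀ j m → (∀ i → i < j → Kills k (c i)) →
    replaceSum Y c k j m + ∑< j (λ i → B i i) * k (columns c j m) ≈ ∑< (m ℕ.+ j) (λ i → B i i) * k (columns c j m)
  replaceSum-triangular A c Y B eq j zero kills = +-identityˡ _
  replaceSum-triangular {k} A c Y B eq j (suc m) kills = begin
    (k (Y j ∷ cs) + replaceSum Y c (k ∘ (c j ∷_)) (suc j) m) + ∑< j b * k (c j ∷ cs)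
      ≈⟨ +-congʳ (+-congʳ diagonal) ⟩
    (B j j * k (c j ∷ cs) + replaceSum Y c (k ∘ (c j ∷_)) (suc j) m) + ∑< j b * k (c j ∷ cs)
      ≈⟨ solve 4 (λ b k r s → b :* k :+ r :+ s :* k := r :+ (s :+ b) :* k) refl _ _ _ _ ⟩
    replaceSum Y c (k ∘ (c j ∷_)) (suc j) m + ∑< (suc j) b * k (c j ∷ cs)
      ≈⟨ replaceSum-triangular (alternating-∷ A (c j)) c Y B eq (suc j) m kills′ ⟩
    ∑< (m ℕ.+ suc j) b * k (c j ∷ cs)
      ≡⟨ ≡.cong (λ t → ∑< t b * k (c j ∷ cs)) (ℕₚ.+-suc m j) ⟩
    ∑< (suc m ℕ.+ j) b * k (c j ∷ cs) ∎
    where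
    cs = columns c (suc j) m
    b : ℕ → Carrier
    b i = B i i
    lower : ∀ t → t ℕ.≤ j → k ((λ n → ∑< t (λ i → B j i * c i n)) ∷ cs) ≈ 0#
    -- The zero column is written as 0·c + 0·c, since linearity is stated for two summands.
    lower zero t≤j = trans (linear₀ A {x = c j} {y = c j} cs 0# 0# (λ n → solve 1 (λ c → con (+ 0) := con (+ 0) :* c :+ con (+ 0) :* c) refl (c j n)))
                       (solve 1 (λ c → con (+ 0) :* c :+ con (+ 0) :* c := con (+ 0)) refl _)
    lower (suc t) t≤j =
      trans (linear₀ A cs 1# (B j t) (λ n → +-congʳ (sym (*-identityˡ _))))
        (trans (+-cong (*-congˡ (lower t (ℕₚ.<⇒≤ t≤j))) (*-congˡ (kills t t≤j [] cs)))
               (solve 1 (λ b → con (+ 1) :* con (+ 0) :+ b :* con (+ 0) := con (+ 0)) refl (B j t)))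
    diagonal : k (Y j ∷ cs) ≈ B j j * k (c j ∷ cs)
    diagonal =
      trans (linear₀ A cs 1# (B j j) (λ n → trans (eq j n) (+-congʳ (sym (*-identityˡ _)))))
        (trans (+-congʳ (*-congˡ (lower j ℕₚ.≤-refl)))
               (solve 1 (λ u → con (+ 1) :* con (+ 0) :+ u := u) refl _))
    kills′ : ∀ i → i < suc j → Kills (k ∘ (c j ∷_)) (c i)
    kills′ i (s≤s i≤j) pre post with ℕₚ.m≤n⇒m<n∨m≡n i≤j
    ... | inj₁ i<j    = kills i i<j (c j ∷ pre) post
    ... | inj₂ ≡.refl = repeated-column A (c j) pre post

  module _ (d : X → Carrier) where

    rowScaled : Column → Column
    rowScaled c n = d n * c n

    derivative : (List Column → Carrier) → List Column → Carrier
    derivative k []       = 0#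
    derivative k (c ∷ cs) = k (rowScaled c ∷ cs) + derivative (k ∘ (c ∷_)) cs

    derivative-combine : ∀ f {k₁ k₂} cs →
      derivative (λ ys → f * k₁ ys - k₂ ys) cs ≈ f * derivative k₁ cs - derivative k₂ cs
    derivative-combine f [] = solve 1 (λ f → con (+ 0) := f :* con (+ 0) :- con (+ 0)) refl f
    derivative-combine f (c ∷ cs) =
      trans (+-congˡ (derivative-combine f cs))
            (solve 5 (λ f p q u v → (f :* p :- q) :+ (f :* u :- v) := f :* (p :+ u) :- (q :+ v)) refl f _ _ _ _)

    -- Leibniz rule along the first row: the scaled column is either the one expanded, contributing
    -- d n, or it remains in the minor.
    derivative-expand : ∀ n k cs →
      derivative (expand n k) cs ≈ d n * expand n k cs + expand n (derivative k) cs
    derivative-expand n k [] = solve 1 (λ d → con (+ 0) := d :* con (+ 0) :+ con (+ 0)) refl (d n)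
    derivative-expand n k (c ∷ cs) = begin
      (d n * c n * k cs - P) + derivative (λ ys → c n * k ys - expand n (k ∘ (c ∷_)) ys) cs
        ≈⟨ +-congˡ (trans (derivative-combine (c n) cs) (+-congˡ (-‿cong (derivative-expand n (k ∘ (c ∷_)) cs)))) ⟩
      (d n * c n * k cs - P) + (c n * derivative k cs - (d n * Q + S))
        ≈⟨ solve 7 (λ d c k p r q s → (d :* c :* k :- p) :+ (c :* r :- (d :* q :+ s))
              := d :* (c :* k :- q) :+ (c :* r :- (con (+ 1) :* p :+ con (+ 1) :* s))) refl (d n) (c n) _ P _ Q S ⟩
      d n * (c n * k cs - Q) + (c n * derivative k cs - (1# * P + 1# * S))
        ≈⟨ +-congˡ (+-congˡ (-‿cong (sym (expand-linear n 1# 1# (λ ys →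
              sym (+-cong (*-identityˡ _) (*-identityˡ _))) cs)))) ⟩
      d n * (c n * k cs - Q) + (c n * derivative k cs - expand n (derivative k ∘ (c ∷_)) cs) ∎
      where
      P = expand n (k ∘ (rowScaled c ∷_)) cs
      Q = expand n (k ∘ (c ∷_)) cs
      S = expand n (derivative (k ∘ (c ∷_))) cs

    expand-scale : ∀ n {k} s cs → expand n (λ ys → s * k ys) cs ≈ s * expand n k cs
    expand-scale n {k} s cs =
      trans (expand-linear n {k₁ = k} {k₂ = k} s 0# (λ ys → sym (trans (+-congˡ (zeroˡ _)) (+-identityʳ _))) cs)
            (trans (+-congˡ (zeroˡ _)) (+-identityʳ _))

    derivative-zero : ∀ {k} → (∀ c cs → k (c ∷ cs) ≈ 0#) → ∀ cs → derivative k cs ≈ 0#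
    derivative-zero eq []       = refl
    derivative-zero eq (c ∷ cs) =
      trans (+-cong (eq _ cs) (derivative-zero (λ c′ ys → eq c (c′ ∷ ys)) cs)) (+-identityˡ 0#)

    -- The first-order part of det((1 + εD)A) = det(1 + εD) det A for a diagonal D: scaling one
    -- column at a time by the row factors yields the trace.
    derivative-det : ∀ ns cs → derivative (det ns) cs ≈ sumOver d ns * det ns cs
    derivative-det []       cs = trans (derivative-zero (λ _ _ → refl) cs) (sym (zeroˡ _))
    derivative-det (n ∷ ns) cs = begin
      derivative (expand n (det ns)) cs
        ≈⟨ derivative-expand n (det ns) cs ⟩
      d n * expand n (det ns) cs + expand n (derivative (det ns)) cs
        ≈⟨ +-congˡ (trans (expand-cong n (derivative-det ns) cs) (expand-scale n _ cs)) ⟩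
      d n * expand n (det ns) cs + sumOver d ns * expand n (det ns) cs
        ≈⟨ distribʳ _ _ _ ⟨
      (d n + sumOver d ns) * expand n (det ns) cs ∎

    replaceSum-derivative : ∀ c k j m →
      replaceSum (rowScaled ∘ c) c k j m ≡ derivative k (columns c j m)
    replaceSum-derivative c k j zero    = ≡.refl
    replaceSum-derivative c k j (suc m) = ≡.cong (_+_ _) (replaceSum-derivative c (k ∘ (c j ∷_)) (suc j) m)

-- Determinants under ring homomorphisms

module DeterminantMap {R S : CommutativeRing 0ℓ 0ℓ} (f : RingHom R S) (X : Set) where
  private
    module R = CommutativeRing R
    module S = CommutativeRing S
  open RingHom f
  open import Algebra.Properties.Group S.+-group using (inverseˡ-unique)

  private
    module DR = Determinant R X
    module DS = Determinant S X

  φ-neg : ∀ x → φ (R.- x) S.≈ S.- φ x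
  φ-neg x = inverseˡ-unique _ _ (S.trans (S.sym (φ-+ (R.- x) x)) (S.trans (φ-cong (R.-‿inverseˡ x)) φ-0))

  φ-expand : ∀ n {k k′} → (∀ cs → φ (k cs) S.≈ k′ (map (φ ∘_) cs)) →
    ∀ cs → φ (DR.expand n k cs) S.≈ DS.expand n k′ (map (φ ∘_) cs)
  φ-expand n eq []       = φ-0
  φ-expand n eq (c ∷ cs) = S.trans (φ-+ _ _) (S.+-cong (S.trans (φ-* _ _) (S.*-congˡ (eq cs)))
    (S.trans (φ-neg _) (S.-‿cong (φ-expand n (λ ys → eq (c ∷ ys)) cs))))

  φ-det : ∀ ns cs → φ (DR.det ns cs) S.≈ DS.det ns (map (φ ∘_) cs)
  φ-det []       []      = φ-1
  φ-det []       (_ ∷ _) = φ-0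
  φ-det (n ∷ ns) cs      = φ-expand n (φ-det ns) cs

  map-columns : ∀ c j m → map (φ ∘_) (DR.columns c j m) ≡ DS.columns (λ i → φ ∘ c i) j m
  map-columns c j zero    = ≡.refl
  map-columns c j (suc m) = ≡.cong (_ ∷_) (map-columns c (suc j) m)

-- Polynomials and their pairing with a power series

module PolyRing (R : CommutativeRing 0ℓ 0ℓ) where
  open import Data.Nat using (_≤_; z≤n; s≤s)

  open CommutativeRing R hiding (zero)
  open import Relation.Binary.Reasoning.Setoid setoid
  open IntegerSolver R
  open Series R
  open FiniteSum R

  Pol : Set
  Pol = List Carrier

  coeff : Pol → Ser
  coeff []      _       = 0#
  coeff (a ∷ _) zero    = a
  coeff (_ ∷ f) (suc n) = coeff f n

  infixl 6 _⊕_
  infixl 7 _⊗_ _·_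

  _⊕_ : Pol → Pol → Pol
  []      ⊕ g       = g
  (a ∷ f) ⊕ []      = a ∷ f
  (a ∷ f) ⊕ (b ∷ g) = (a + b) ∷ (f ⊕ g)

  _·_ : Carrier → Pol → Pol
  s · f = map (s *_) f

  _⊗_ : Pol → Pol → Pol
  []      ⊗ g = []
  (a ∷ f) ⊗ g = a · g ⊕ (0# ∷ f ⊗ g)

  ⊖_ : Pol → Pol
  ⊖ f = map -_ f

  const linearTerm : Carrier → Pol
  const a      = a ∷ []
  linearTerm a = 0# ∷ a ∷ []

  coeff-⊕ : ∀ f g → coeff (f ⊕ g) ≋ coeff f ⊞ coeff g
  coeff-⊕ []      g       n       = sym (+-identityˡ _)
  coeff-⊕ (a ∷ f) []      n       = sym (+-identityʳ _)
  coeff-⊕ (a ∷ f) (b ∷ g) zero    = refl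
  coeff-⊕ (a ∷ f) (b ∷ g) (suc n) = coeff-⊕ f g n

  coeff-· : ∀ s f n → coeff (s · f) n ≈ s * coeff f n
  coeff-· s []      n       = sym (zeroʳ s)
  coeff-· s (a ∷ f) zero    = refl
  coeff-· s (a ∷ f) (suc n) = coeff-· s f n

  coeff-⊗ : ∀ f g → coeff (f ⊗ g) ≋ coeff f ⊛ coeff g
  coeff-⊗ []      g n       = sym (⊛-zeroˡ _ (coeff g) (λ _ → refl) n)
  coeff-⊗ (a ∷ f) g zero    =
    trans (coeff-⊕ (a · g) (0# ∷ f ⊗ g) zero) (trans (+-identityʳ _) (coeff-· a g zero))
  coeff-⊗ (a ∷ f) g (suc n) =
    trans (coeff-⊕ (a · g) (0# ∷ f ⊗ g) (suc n)) (+-cong (coeff-· a g (suc n)) (coeff-⊗ f g n))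

  coeff-const-⊗ : ∀ r f n → coeff (const r ⊗ f) n ≈ r * coeff f n
  coeff-const-⊗ r f n =
    trans (coeff-⊕ (r · f) (0# ∷ []) n)
          (trans (+-cong (coeff-· r f n) (0-coeff n)) (+-identityʳ _))
    where
    0-coeff : ∀ n → coeff (0# ∷ []) n ≈ 0#
    0-coeff zero    = refl
    0-coeff (suc _) = refl

  coeff-⊖ : ∀ f n → coeff (⊖ f) n ≈ - coeff f n
  coeff-⊖ []      n       = solve 0 (con (+ 0) := :- con (+ 0)) refl
  coeff-⊖ (a ∷ f) zero    = refl
  coeff-⊖ (a ∷ f) (suc n) = coeff-⊖ f n

  coeff-one : coeff (const 1#) ≋ one
  coeff-one zero    = refl
  coeff-one (suc n) = refl

  coefficients : Embedding Pol series
  coefficients = record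
    { ι = coeff ; _⊕_ = _⊕_ ; _⊗_ = _⊗_ ; ⊖_ = ⊖_ ; 𝟘 = [] ; 𝟙 = const 1#
    ; ⊕-homo = coeff-⊕ ; ⊗-homo = coeff-⊗ ; ⊖-homo = coeff-⊖ ; 𝟘-homo = λ _ → refl ; 𝟙-homo = coeff-one }

  open Pullback coefficients public renaming (pullback to polRing)

  module P = CommutativeRing polRing

  -- The constant term in z of f(1/z)·g(z), for f a polynomial in 1/z: the coefficient extraction of
  -- `Dop` at v = 0.
  pair : Pol → Ser → Carrier
  pair []      g = 0#
  pair (a ∷ f) g = a * g 0 + pair f (g ∘ suc)

  pair-zero : ∀ f g → (∀ n → coeff f n ≈ 0#) → pair f g ≈ 0#
  pair-zero []      g f0 = refl
  pair-zero (a ∷ f) g f0 =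
    trans (+-cong (trans (*-congʳ (f0 0)) (zeroˡ _)) (pair-zero f (g ∘ suc) (f0 ∘ suc))) (+-identityˡ _)

  pair-cong : ∀ g {f f′} → f P.≈ f′ → pair f g ≈ pair f′ g
  pair-cong g {f} {f′} eq = go f f′ g (image eq)
    where
    go : ∀ f f′ g → coeff f ≋ coeff f′ → pair f g ≈ pair f′ g
    go []      f′       g eq = sym (pair-zero f′ g (λ n → sym (eq n)))
    go (a ∷ f) []       g eq = pair-zero (a ∷ f) g eq
    go (a ∷ f) (b ∷ f′) g eq = +-cong (*-congʳ (eq 0)) (go f f′ (g ∘ suc) (eq ∘ suc))

  pair-⊕ : ∀ f f′ g → pair (f ⊕ f′) g ≈ pair f g + pair f′ g
  pair-⊕ []      f′       g = sym (+-identityˡ _)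
  pair-⊕ (a ∷ f) []       g = sym (+-identityʳ _)
  pair-⊕ (a ∷ f) (b ∷ f′) g =
    trans (+-congˡ (pair-⊕ f f′ (g ∘ suc)))
          (solve 5 (λ a b g p q → (a :+ b) :* g :+ (p :+ q) := (a :* g :+ p) :+ (b :* g :+ q)) refl a b _ _ _)

  pair-· : ∀ s f g → pair (s · f) g ≈ s * pair f g
  pair-· s []      g = sym (zeroʳ s)
  pair-· s (a ∷ f) g =
    trans (+-congˡ (pair-· s f (g ∘ suc)))
          (solve 4 (λ s a g p → s :* a :* g :+ s :* p := s :* (a :* g :+ p)) refl s a _ _)

  pair-⊖ : ∀ f g → pair (⊖ f) g ≈ - pair f g
  pair-⊖ []      g = solve 0 (con (+ 0) := :- con (+ 0)) refl
  pair-⊖ (a ∷ f) g =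
    trans (+-congˡ (pair-⊖ f (g ∘ suc)))
          (solve 3 (λ a g p → :- a :* g :+ :- p := :- (a :* g :+ p)) refl a _ _)

  pair-const : ∀ a f g → pair (const a ⊗ f) g ≈ a * pair f g
  pair-const a f g =
    trans (pair-⊕ (a · f) (0# ∷ []) g)
          (trans (+-cong (pair-· a f g) (solve 1 (λ g → con (+ 0) :* g :+ con (+ 0) := con (+ 0)) refl _)) (+-identityʳ _))

  pair-shift : ∀ s f g → pair (linearTerm s ⊗ f) g ≈ s * pair f (g ∘ suc)
  pair-shift s f g = begin
    pair (0# · f ⊕ (0# ∷ const s ⊗ f)) g
      ≈⟨ pair-⊕ (0# · f) (0# ∷ const s ⊗ f) g ⟩
    pair (0# · f) g + (0# * g 0 + pair (const s ⊗ f) (g ∘ suc))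
      ≈⟨ +-cong (pair-· 0# f g) (+-congˡ (pair-const s f (g ∘ suc))) ⟩
    0# * pair f g + (0# * g 0 + s * pair f (g ∘ suc))
      ≈⟨ solve 3 (λ p g q → con (+ 0) :* p :+ (con (+ 0) :* g :+ q) := q) refl _ _ _ ⟩
    s * pair f (g ∘ suc) ∎

  const-+ : ∀ a b → const (a + b) P.≈ const a ⊕ const b
  const-+ a b = by-image λ n → refl

  const-* : ∀ a b → const (a * b) P.≈ const a ⊗ const b
  const-* a b = by-image λ { zero → sym (+-identityʳ _) ; (suc n) → refl }

  const-neg : ∀ a → const (- a) P.≈ P.- const a
  const-neg a = by-image λ _ → refl

  const-cong : ∀ {a b} → a ≈ b → const a P.≈ const b
  const-cong eq = by-image λ { zero → eq ; (suc n) → refl }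

  pair-∑< : ∀ f g n → (∀ m → n ≤ m → coeff f m ≈ 0#) → pair f g ≈ ∑< n (λ m → coeff f m * g m)
  pair-∑< f       g zero    f0 = pair-zero f g (λ m → f0 m z≤n)
  pair-∑< []      g (suc n) f0 = sym (∑<-zero (suc n) (λ _ _ → zeroˡ _))
  pair-∑< (a ∷ f) g (suc n) f0 =
    trans (+-congˡ (pair-∑< f (g ∘ suc) n (λ m n≤m → f0 (suc m) (s≤s n≤m)))) (sym (∑<-head _ n))

  monomial : ℕ → Carrier → Pol
  monomial zero    a = const a
  monomial (suc k) a = 0# ∷ monomial k a

  monomial-cong : ∀ k {a b} → a ≈ b → coeff (monomial k a) ≋ coeff (monomial k b)
  monomial-cong zero    eq n       = image (const-cong eq) n
  monomial-cong (suc k) eq zero    = refl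
  monomial-cong (suc k) eq (suc n) = monomial-cong k eq n

  monomial-linear : ∀ k r a b → coeff (monomial k (r * a + b)) ≋ λ n → r * coeff (monomial k a) n + coeff (monomial k b) n
  monomial-linear zero    r a b zero    = refl
  monomial-linear zero    r a b (suc n) = sym (trans (+-congʳ (zeroʳ r)) (+-identityʳ 0#))
  monomial-linear (suc k) r a b zero    = sym (trans (+-congʳ (zeroʳ r)) (+-identityʳ 0#))
  monomial-linear (suc k) r a b (suc n) = monomial-linear k r a b n

  coeff-linearTerm-⊗ : ∀ s f n → coeff (linearTerm s ⊗ f) n ≈ coeff (0# ∷ s · f) n
  coeff-linearTerm-⊗ s f zero    = trans (coeff-⊗ (linearTerm s) f 0) (zeroˡ _)
  coeff-linearTerm-⊗ s f (suc n) = trans (coeff-⊗ (linearTerm s) f (suc n))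
    (trans (+-cong (zeroˡ _) (sym (coeff-⊗ (const s) f n)))
      (trans (+-identityˡ _) (trans (coeff-const-⊗ s f n) (sym (coeff-· s f n)))))

  powers-linearTerm : ∀ s k → Series.powers polRing (linearTerm s) k P.≈ monomial k (powers s k)
  powers-linearTerm s zero    = P.refl
  powers-linearTerm s (suc k) = P.trans (P.*-congˡ {linearTerm s} (powers-linearTerm s k))
    (by-image λ n → trans (coeff-linearTerm-⊗ s (monomial k (powers s k)) n) (shifted n))
    where
    scaled : ∀ k a n → s * coeff (monomial k a) n ≈ coeff (monomial k (s * a)) n
    scaled zero    a zero    = refl
    scaled zero    a (suc n) = zeroʳ s
    scaled (suc k) a zero    = zeroʳ s
    scaled (suc k) a (suc n) = scaled k a n
    shifted : ∀ n → coeff (0# ∷ s · monomial k (powers s k)) n ≈ coeff (monomial (suc k) (s * powers s k)) n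
    shifted zero    = refl
    shifted (suc n) = trans (coeff-· s (monomial k (powers s k)) n) (scaled k (powers s k) n)

  constHom : RingHom R polRing
  constHom = record
    { φ = const ; φ-cong = const-cong ; φ-+ = const-+ ; φ-* = const-*
    ; φ-0 = by-image λ { zero → refl ; (suc _) → refl } ; φ-1 = P.refl }

  module PairDet (X : Set) (g : Ser) where
    module DR = Determinant R X
    module DP = Determinant polRing X

    constColumn : DR.Column → DP.Column
    constColumn c n = const (c n)

    pairColumn : DP.Column → DR.Column
    pairColumn y n = pair (y n) g

    -- Pairing with g is linear over `R` but not multiplicative, so it passes through a determinant
    -- only while all columns but one are constant. `onConst` serves the minors from which the
    -- exceptional column has been removed.
    record PairCompatible (kP : List DP.Column → Pol) (kR : List DR.Column → Carrier) : Set where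
      field
        onConst : ∀ cs → kP (map constColumn cs) P.≈ const (kR cs)
        onPair  : ∀ pre y post → pair (kP (map constColumn pre ++ y ∷ map constColumn post)) g
                                 ≈ kR (pre ++ pairColumn y ∷ post)
    open PairCompatible

    compatible-∷ : ∀ {kP kR} → PairCompatible kP kR → ∀ c → PairCompatible (kP ∘ (constColumn c ∷_)) (kR ∘ (c ∷_))
    compatible-∷ C c .onConst cs  = onConst C (c ∷ cs)
    compatible-∷ C c .onPair pre  = onPair C (c ∷ pre)

    pair-minus : ∀ f f′ → pair (f P.- f′) g ≈ pair f g - pair f′ g
    pair-minus f f′ = trans (pair-⊕ f (⊖ f′) g) (+-congˡ (pair-⊖ f′ g))

    pair-const-right : ∀ f a → pair (f ⊗ const a) g ≈ pair f g * a
    pair-const-right f a =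
      trans (pair-cong g (P.*-comm f (const a))) (trans (pair-const a f g) (*-comm _ _))

    expand-pair : ∀ n {kP kR} → (∀ zs → pair (kP (map constColumn zs)) g ≈ kR zs) →
      ∀ cs → pair (DP.expand n kP (map constColumn cs)) g ≈ DR.expand n kR cs
    expand-pair n eq []       = refl
    expand-pair n {kP} eq (c ∷ cs) =
      trans (pair-minus (const (c n) ⊗ kP (map constColumn cs)) (DP.expand n (kP ∘ (constColumn c ∷_)) (map constColumn cs)))
            (+-cong (trans (pair-const (c n) (kP (map constColumn cs)) g) (*-congˡ (eq cs)))
                    (-‿cong (expand-pair n (λ zs → eq (c ∷ zs)) cs)))

    expand-compatible : ∀ n {kP kR} → PairCompatible kP kR → PairCompatible (DP.expand n kP) (DR.expand n kR)
    expand-compatible n C .onConst [] = by-image λ { zero → refl ; (suc i) → refl }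
    expand-compatible n {kP} {kR} C .onConst (c ∷ cs) =
      P.trans (P.+-cong (P.trans (P.*-congˡ {const (c n)} (onConst C cs)) (P.sym (const-* (c n) (kR cs))))
                        (P.-‿cong (expand-compatible n (compatible-∷ C c) .onConst cs)))
              (P.trans (P.+-congˡ {const (c n * kR cs)} (P.sym (const-neg (DR.expand n (kR ∘ (c ∷_)) cs))))
                       (P.sym (const-+ (c n * kR cs) (- DR.expand n (kR ∘ (c ∷_)) cs))))
    expand-compatible n {kP} {kR} C .onPair [] y post =
      trans (pair-minus (y n ⊗ kP (map constColumn post)) _)
            (+-cong (trans (pair-cong g (P.*-congˡ {y n} (onConst C post)))
                           (pair-const-right (y n) (kR post)))
                    (-‿cong (expand-pair n (λ zs → onPair C [] y zs) post)))
    expand-compatible n {kP} {kR} C .onPair (c ∷ pre) y post =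
      trans (pair-minus (const (c n) ⊗ kP cols) (DP.expand n (kP ∘ (constColumn c ∷_)) cols))
            (+-cong (trans (pair-const (c n) (kP cols) g) (*-congˡ (onPair C pre y post)))
                    (-‿cong (expand-compatible n (compatible-∷ C c) .onPair pre y post)))
      where cols = map constColumn pre ++ y ∷ map constColumn post

    det-compatible : ∀ ns → PairCompatible (DP.det ns) (DR.det ns)
    det-compatible [] .onConst []      = P.refl
    det-compatible [] .onConst (_ ∷ _) = by-image λ { zero → refl ; (suc n) → refl }
    det-compatible [] .onPair [] y post      = refl
    det-compatible [] .onPair (_ ∷ _) y post = refl
    det-compatible (n ∷ ns) = expand-compatible n (det-compatible ns)

    columns-const : ∀ (c : ℕ → DR.Column) j m →
      DP.columns (constColumn ∘ c) j m ≡ map constColumn (DR.columns c j m)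
    columns-const c j zero    = ≡.refl
    columns-const c j (suc m) = ≡.cong (_ ∷_) (columns-const c (suc j) m)

    replaceSum-pair : ∀ {kP kR} → PairCompatible kP kR → ∀ Y c j m →
      pair (DP.replaceSum Y (constColumn ∘ c) kP j m) g ≈ DR.replaceSum (pairColumn ∘ Y) c kR j m
    replaceSum-pair C Y c j zero    = refl
    replaceSum-pair {kP} C Y c j (suc m) rewrite columns-const c (suc j) m =
      trans (pair-⊕ (kP (Y j ∷ map constColumn (DR.columns c (suc j) m))) _ g)
            (+-cong (onPair C [] (Y j) _) (replaceSum-pair (compatible-∷ C (c j)) Y c (suc j) m))

-- The eigenvalue of the Jacobi-Trudi determinant over an abstract ring

rowLabels : ℕ → List ℕ → List ℤ
rowLabels i []      = []
rowLabels i (m ∷ μ) = (+ m ℤ.- + i) ∷ rowLabels (suc i) μ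

length-rowLabels : ∀ i μ → length (rowLabels i μ) ≡ length μ
length-rowLabels i []      = ≡.refl
length-rowLabels i (m ∷ μ) = ≡.cong suc (length-rowLabels (suc i) μ)

module EigenDeterminant (R : CommutativeRing 0ℓ 0ℓ) where
  open CommutativeRing R hiding (zero)
  open Series R
  open PolyRing R
  open import Relation.Binary.Reasoning.Setoid setoid
  open IntegerSolver R
  open FiniteSum R

  private
    module SP = Series polRing

  -- In terms of the paper: a = q^u, s = 1/q, h_n = s_n[X/(1−q)], ĥ_n = h_n[X + M[u]_q/z] as a polynomial
  -- in 1/z, and ĝ = Ω[−z[u]_t X].
  record EigenData : Set where
    field
      ν-cancel    : ∀ n {x y} → ν (suc n) * x ≈ ν (suc n) * y → x ≈ y
      a a⁻¹ s     : Carrier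
      a⁻¹-inverse : a⁻¹ * a ≈ 1#
      {y h ŷ ĝ}   : Ser
      h-exp       : IsExp y h
      ĝ-exp       : IsExp ŷ ĝ
      ŷ-def       : ∀ i → powers a (suc i) * (powers s (suc i) * ŷ i) + y i ≈ powers a (suc i) * y i
      {Q ĥ}       : ℕ → Pol
      ĥ-exp       : SP.IsExp Q ĥ
      Q-def       : ∀ i → Q i P.+ SP.powers (linearTerm s) (suc i)
                          P.≈ const (y i) P.+ SP.powers (const a P.* linearTerm s) (suc i)

  module Eigen (data° : EigenData) where
    open EigenData data°

    private
      module PSolver = IntegerSolver polRing
      open module PD = PairDet ℤ ĝ using (module DR; module DP)
      module M = SeriesMap constHom

    -- 1/(qz)
    x : Pol
    x = linearTerm s

    ax : Pol
    ax = const a P.* x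

    ν-cancelᴾ : ∀ n {f g} → SP.ν (suc n) P.* f P.≈ SP.ν (suc n) P.* g → f P.≈ g
    ν-cancelᴾ n {f} {g} eq = by-image λ i → ν-cancel n
      (trans (sym (coeff-const-⊗ (ν (suc n)) f i)) (trans (image step i) (coeff-const-⊗ (ν (suc n)) g i)))
      where
      step : const (ν (suc n)) P.* f P.≈ const (ν (suc n)) P.* g
      step = P.trans (P.*-congʳ (M.φ-ν (suc n))) (P.trans eq (P.*-congʳ (P.sym (M.φ-ν (suc n)))))

    -- Ω[w(Y + (a-1)x)] Ω[wx] = Ω[wY] Ω[wax] in a new variable w: `Q-def` is this identity on power
    -- sums, with the negative part of (a-1)x moved to the other side.
    ĥ-series : (ĥ SP.⊛ SP.powers x) SP.≋ ((const ∘ h) SP.⊛ SP.powers ax)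
    ĥ-series = SP.IsExp-unique ν-cancelᴾ
      (SP.IsExp-⊛ ĥ-exp (SP.IsExp-powers x))
      (SP.IsExp-cong (λ i → P.sym (Q-def i)) (SP.IsExp-⊛ (M.IsExp-map h-exp) (SP.IsExp-powers ax)))

    ⊛-powers-suc : ∀ f r n → (f SP.⊛ SP.powers r) (suc n) P.≈ r P.* (f SP.⊛ SP.powers r) n P.+ f (suc n)
    ⊛-powers-suc f r n = P.trans (SP.⊛-suc f (SP.powers r) n)
      (P.+-cong (P.trans (SP.⊛-comm f _ n) (P.trans (SP.⊛-scaleˡ r (SP.powers r) f n) (P.*-congˡ {r} (SP.⊛-comm _ f n))))
                (P.*-identityʳ _))

    -- The coefficients of (1 - axw) ĥ(w) = (1 - xw) h(w). The common value F of the two sides of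
    -- `ĥ-series` obeys one recursion from each factorisation, and F is eliminated between them.
    ĥ-rec : ∀ n → ĥ (suc n) P.≈ (const (h (suc n)) P.- x P.* const (h n)) P.+ ax P.* ĥ n
    ĥ-rec n = P.trans (isolate n) (P.trans (P.+-congˡ {const (h (suc n))} (expanded n))
      (PSolver.solve 3 (λ u v w → u PSolver.:+ (w PSolver.:- v) PSolver.:= (u PSolver.:- v) PSolver.:+ w) P.refl
        (const (h (suc n))) (x P.* const (h n)) (ax P.* ĥ n)))
      where
      F : ℕ → Pol
      F = ĥ SP.⊛ SP.powers x
      by-h : ∀ n → F (suc n) P.≈ ax P.* F n P.+ const (h (suc n))
      by-h n = P.trans (ĥ-series (suc n)) (P.trans (⊛-powers-suc (const ∘ h) ax n) (P.+-congʳ (P.*-congˡ {ax} (P.sym (ĥ-series n)))))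
      by-ĥ : ∀ n → F (suc n) P.≈ x P.* F n P.+ ĥ (suc n)
      by-ĥ = ⊛-powers-suc ĥ x
      isolate : ∀ n → ĥ (suc n) P.≈ const (h (suc n)) P.+ (ax P.* F n P.- x P.* F n)
      isolate n = P.trans
        (PSolver.solve 2 (λ u v → u PSolver.:= (v PSolver.:+ u) PSolver.:- v) P.refl (ĥ (suc n)) (x P.* F n))
        (P.trans (P.+-congʳ (P.trans (P.sym (by-ĥ n)) (by-h n)))
          (PSolver.solve 3 (λ u v w → (u PSolver.:+ v) PSolver.:- w PSolver.:= v PSolver.:+ (u PSolver.:- w)) P.refl
             (ax P.* F n) (const (h (suc n))) (x P.* F n)))
      expanded : ∀ n → ax P.* F n P.- x P.* F n P.≈ ax P.* ĥ n P.- x P.* const (h n)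
      expanded zero = P.+-cong (P.*-congˡ {ax} (P.*-identityʳ (ĥ 0)))
        (P.-‿cong (P.*-congˡ {x} (P.trans (ĥ-series 0) (P.*-identityʳ (const (h 0))))))
      expanded (suc n) = P.trans
        (P.+-cong (P.*-congˡ {ax} (by-ĥ n)) (P.-‿cong (P.*-congˡ {x} (by-h n))))
        (PSolver.solve 5 (λ ax x F u v → ax PSolver.:* (x PSolver.:* F PSolver.:+ u) PSolver.:- x PSolver.:* (ax PSolver.:* F PSolver.:+ v)
            PSolver.:= ax PSolver.:* u PSolver.:- x PSolver.:* v) P.refl ax x (F n) (ĥ (suc n)) (const (h (suc n))))

    hℤ′ : ℤ → Carrier
    hℤ′ (+ n)    = h n
    hℤ′ -[1+ _ ] = 0#

    ĥℤ : ℤ → Pol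
    ĥℤ (+ n)    = ĥ n
    ĥℤ -[1+ _ ] = []

    private
      const-0 : const 0# P.≈ []
      const-0 = by-image λ { zero → refl ; (suc _) → refl }

    -- Extension by zero preserves the recursion, at index -1 because ĥ₀ = h₀ = 1. Hence one column
    -- operation serves all rows, including those whose labels are negative.
    ĥℤ-rec : ∀ z → ĥℤ (ℤ.suc z) P.≈ (const (hℤ′ (ℤ.suc z)) P.- x P.* const (hℤ′ z)) P.+ ax P.* ĥℤ z
    ĥℤ-rec (+ n) = ĥ-rec n
    ĥℤ-rec -[1+ zero ] = P.trans (SP.IsExp.initial ĥ-exp) (P.trans (P.sym (const-cong (initial h-exp)))
      (P.sym (P.trans (P.+-cong (P.+-congˡ {const (h 0)} (P.-‿cong (P.*-congˡ {x} const-0))) (P.refl {ax P.* []}))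
        (PSolver.solve 3 (λ u x ax → (u PSolver.:- x PSolver.:* PSolver.con (+ 0)) PSolver.:+ ax PSolver.:* PSolver.con (+ 0) PSolver.:= u)
           P.refl (const (h 0)) x ax))))
    ĥℤ-rec -[1+ suc n ] =
      P.sym (P.trans (P.+-congʳ {ax P.* []} (P.+-cong const-0 (P.-‿cong (P.*-congˡ {x} const-0))))
        (PSolver.solve 2 (λ x ax → (PSolver.con (+ 0) PSolver.:- x PSolver.:* PSolver.con (+ 0)) PSolver.:+ ax PSolver.:* PSolver.con (+ 0) PSolver.:= PSolver.con (+ 0))
           P.refl x ax))

    shift-suc : ∀ n j → n ℤ.+ (+ suc j) ≡ ℤ.suc (n ℤ.+ (+ j))
    shift-suc n j = ≡.trans (≡.sym (ℤₚ.+-assoc n (+ 1) (+ j)))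
      (≡.trans (≡.cong (λ t → t ℤ.+ + j) (ℤₚ.+-comm n (+ 1))) (ℤₚ.+-assoc (+ 1) n (+ j)))

    c : ℕ → DR.Column
    c j n = hℤ′ (n ℤ.+ + j)

    ĉ e Y : ℕ → DP.Column
    ĉ j n = ĥℤ (n ℤ.+ + j)
    -- A dummy value: only positive indices of `e` enter.
    e zero    n = []
    e (suc j) n = const (c (suc j) n) P.- x P.* const (c j n)
    Y j n = SP.powers x j P.* ĉ 0 n

    ĉ-rel : ∀ j n → ĉ (suc j) n P.≈ e (suc j) n P.+ ax P.* ĉ j n
    ĉ-rel j n rewrite shift-suc n j = ĥℤ-rec (n ℤ.+ + j)

    c-rel : ∀ j n → const (c (suc j) n) P.≈ e (suc j) n P.+ x P.* const (c j n)
    c-rel j n = PSolver.solve 2 (λ u v → u PSolver.:= (u PSolver.:- v) PSolver.:+ v) P.refl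
                  (const (c (suc j) n)) (x P.* const (c j n))

    -- The columns `ĉ` and the constant columns have the same differences `e`, with respect to the
    -- multipliers ax and x. So `shear` with ax, followed by `unshear` with x, leads from one family
    -- to the other.
    det-ĉ : ∀ ns m → DP.det ns (DP.columns ĉ 0 (suc m)) P.≈ DP.replaceSum Y (λ j n → const (c j n)) (DP.det ns) 0 (suc m)
    det-ĉ ns m = P.trans (DP.shear A ax ĉ e ĉ-rel 0 m)
      (P.trans (P.sym (P.*-identityˡ _))
        (DP.unshear A x (SP.powers x) (λ j n → const (c j n)) e Y (ĉ 0) c-rel (λ _ → P.refl) (λ _ _ → P.refl) 0 m))
      where A = DP.det-alternating ns

    g : Ser
    g r = powers s r * ĝ r

    W : ℤ → ℕ → Carrier
    W z r = pair (SP.powers x r P.* ĥℤ z) ĝ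

    pair-powers : ∀ r g′ → pair (SP.powers x r) g′ ≈ powers s r * g′ r
    pair-powers zero    g′ = +-identityʳ _
    pair-powers (suc r) g′ = trans (pair-shift s (SP.powers x r) g′)
      (trans (*-congˡ (pair-powers r (g′ ∘ suc))) (sym (*-assoc _ _ _)))

    W-rec : ∀ z r → W (ℤ.suc z) r ≈ (g r * hℤ′ (ℤ.suc z) - g (suc r) * hℤ′ z) + a * W z (suc r)
    W-rec z r = begin
      pair (xʳ P.* ĥℤ (ℤ.suc z)) ĝ
        ≈⟨ pair-cong ĝ (P.trans (P.*-congˡ {xʳ} (ĥℤ-rec z))
             (PSolver.solve 6 (λ xʳ u x v a w → xʳ PSolver.:* ((u PSolver.:- x PSolver.:* v) PSolver.:+ (a PSolver.:* x) PSolver.:* w)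
                  PSolver.:= (u PSolver.:* xʳ PSolver.:- v PSolver.:* (x PSolver.:* xʳ)) PSolver.:+ a PSolver.:* (x PSolver.:* xʳ PSolver.:* w))
                P.refl xʳ (const u) x (const v) (const a) (ĥℤ z))) ⟩
      pair ((const u P.* xʳ P.- const v P.* (x P.* xʳ)) P.+ const a P.* (x P.* xʳ P.* ĥℤ z)) ĝ
        ≈⟨ trans (pair-⊕ (const u P.* xʳ P.- const v P.* (x P.* xʳ)) (const a P.* (x P.* xʳ P.* ĥℤ z)) ĝ)
             (+-cong (trans (PD.pair-minus (const u P.* xʳ) (const v P.* (x P.* xʳ)))
                       (+-cong (pairs u r) (-‿cong (pairs v (suc r)))))
                     (pair-const a (x P.* xʳ P.* ĥℤ z) ĝ)) ⟩
      (g r * u - g (suc r) * v) + a * W z (suc r) ∎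
      where
      xʳ = SP.powers x r
      u  = hℤ′ (ℤ.suc z)
      v  = hℤ′ z
      pairs : ∀ t r → pair (const t P.* SP.powers x r) ĝ ≈ g r * t
      pairs t r = trans (pair-const t (SP.powers x r) ĝ) (trans (*-congˡ (pair-powers r ĝ)) (*-comm _ _))

    zpow : ℤ → Carrier
    zpow (+ n)    = powers a n
    zpow -[1+ n ] = powers a⁻¹ (suc n)

    zpow-suc : ∀ z → zpow z ≈ a⁻¹ * zpow (ℤ.suc z)
    zpow-suc (+ n) = trans (sym (*-identityˡ _)) (trans (*-congʳ (sym a⁻¹-inverse)) (*-assoc _ _ _))
    zpow-suc -[1+ zero ]  = refl
    zpow-suc -[1+ suc n ] = refl

    g-0 : g 0 ≈ 1#
    g-0 = trans (*-identityˡ _) (initial ĝ-exp)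

    private
      1-a⁻¹ : Carrier
      1-a⁻¹ = 1# - a⁻¹

    -- The tail of g from degree r on, rescaled by z ↦ az; unrolling `W-rec` produces a convolution
    -- of h with it.
    G : ℕ → Ser
    G r k = powers a k * g (k ℕ.+ r)

    G-suc : ∀ r k → G r (suc k) ≈ a * G (suc r) k
    G-suc r k = trans (*-assoc _ _ _) (*-congˡ (*-congˡ (reflexive (≡.cong g (≡.sym (ℕₚ.+-suc k r))))))

    -- This is g(az) h(z) = h(az). By `ŷ-def` the power sums of g(az) are (a^k - 1) p_k[Y], and
    -- adding p_k[Y] gives a^k p_k[Y].
    aG-h : ∀ n → (G 0 ⊛ h) n ≈ powers a n * h n
    aG-h = IsExp-unique ν-cancel
      (IsExp-cong ŷ-def (IsExp-⊛ (record { initial = trans (*-cong refl (reflexive (≡.cong g (ℕₚ.+-identityʳ 0)))) (initial G-exp)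
                                         ; deriv = λ n → trans (*-congˡ (G0 (suc n))) (trans (deriv G-exp n)
                                             (⊛-cong {g = λ k → powers a k * g k} (λ _ → refl) (λ k → sym (G0 k)) n)) }) h-exp))
      (IsExp-rescale a h-exp)
      where
      G-exp : IsExp (λ i → powers a (suc i) * (powers s (suc i) * ŷ i)) (λ k → powers a k * g k)
      G-exp = IsExp-rescale a (IsExp-rescale s ĝ-exp)
      G0 : ∀ k → G 0 k ≈ powers a k * g k
      G0 k = *-congˡ (reflexive (≡.cong g (ℕₚ.+-identityʳ k)))

    -- The last summand is chosen so that -g_{r+1} h_n in `W-rec` cancels against a times the last
    -- summand for r + 1; what remains is the convolution with factor 1 - 1/a.
    W-nonneg : ∀ n r → W (+ n) r ≈ 1-a⁻¹ * (G r ⊛ h) n + a⁻¹ * (g r * h n)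
    W-nonneg zero r = begin
      pair (SP.powers x r P.* ĥ 0) ĝ
        ≈⟨ pair-cong ĝ (P.trans (P.*-congˡ {SP.powers x r} (SP.IsExp.initial ĥ-exp)) (P.*-identityʳ (SP.powers x r))) ⟩
      pair (SP.powers x r) ĝ
        ≈⟨ pair-powers r ĝ ⟩
      g r
        ≈⟨ solve 2 (λ i g → g := (con (+ 1) :- i) :* (con (+ 1) :* g :* con (+ 1)) :+ i :* (g :* con (+ 1))) refl a⁻¹ (g r) ⟩
      1-a⁻¹ * (1# * g r * 1#) + a⁻¹ * (g r * 1#)
        ≈⟨ +-cong (*-congˡ (*-congˡ (sym (initial h-exp)))) (*-congˡ (*-congˡ (sym (initial h-exp)))) ⟩
      1-a⁻¹ * (G r ⊛ h) 0 + a⁻¹ * (g r * h 0) ∎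
    W-nonneg (suc n) r = begin
      W (+ suc n) r
        ≈⟨ W-rec (+ n) r ⟩
      (g r * h (suc n) - g (suc r) * h n) + a * W (+ n) (suc r)
        ≈⟨ +-congˡ (*-congˡ (W-nonneg n (suc r))) ⟩
      (g r * h (suc n) - g (suc r) * h n) + a * (1-a⁻¹ * V + a⁻¹ * (g (suc r) * h n))
        ≈⟨ solve 7 (λ gr h1 gs h0 a i V → (gr :* h1 :- gs :* h0) :+ a :* ((con (+ 1) :- i) :* V :+ i :* (gs :* h0))
              := (con (+ 1) :- i) :* (con (+ 1) :* gr :* h1 :+ a :* V) :+ i :* (gr :* h1) :+ (i :* a :- con (+ 1)) :* (gs :* h0))
             refl (g r) (h (suc n)) (g (suc r)) (h n) a a⁻¹ V ⟩
      1-a⁻¹ * (1# * g r * h (suc n) + a * V) + a⁻¹ * (g r * h (suc n)) + (a⁻¹ * a - 1#) * (g (suc r) * h n)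
        ≈⟨ +-cong (+-congʳ (*-congˡ (+-congˡ (trans (sym (⊛-scaleˡ a (G (suc r)) h n))
              (⊛-cong {g = h} (λ k → sym (G-suc r k)) (λ _ → refl) n)))))
            (trans (*-congʳ (trans (+-congʳ a⁻¹-inverse) (-‿inverseʳ 1#))) (zeroˡ _)) ⟩
      1-a⁻¹ * (G r ⊛ h) (suc n) + a⁻¹ * (g r * h (suc n)) + 0#
        ≈⟨ +-identityʳ _ ⟩
      1-a⁻¹ * (G r ⊛ h) (suc n) + a⁻¹ * (g r * h (suc n)) ∎
      where V = (G (suc r) ⊛ h) n

    W-zero : ∀ z → W z 0 ≈ 1-a⁻¹ * (zpow z * hℤ′ z - hℤ′ z) + hℤ′ z
    W-zero (+ n) = trans (W-nonneg n 0)
      (trans (+-cong (*-congˡ (aG-h n)) (*-congˡ (trans (*-congʳ g-0) (*-identityˡ _))))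
        (solve 3 (λ i u h → (con (+ 1) :- i) :* u :+ i :* h := (con (+ 1) :- i) :* (u :- h) :+ h) refl a⁻¹ _ (h n)))
    W-zero -[1+ n ] = trans (pair-cong ĝ (P.zeroʳ (SP.powers x 0)))
      (solve 2 (λ i u → con (+ 0) := (con (+ 1) :- i) :* (u :* con (+ 0) :- con (+ 0)) :+ con (+ 0)) refl a⁻¹ (powers a⁻¹ (suc n)))

    B : ℕ → ℕ → Carrier
    B r i = powers a⁻¹ i * g (r ℕ.∸ i)

    lower : ℤ → ℕ → Carrier
    lower z r = ∑< (suc r) (λ i → B r i * hℤ′ (z ℤ.+ + i))

    lower-suc : ∀ z r → lower z (suc r) ≈ g (suc r) * hℤ′ z + a⁻¹ * lower (ℤ.suc z) r
    lower-suc z r = trans (∑<-head _ (suc r))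
      (+-cong (*-cong (*-identityˡ _) (reflexive (≡.cong hℤ′ (ℤₚ.+-identityʳ z))))
              (trans (∑<-cong (λ i → trans (*-cong (*-assoc _ _ _) (reflexive (≡.cong hℤ′ (shift z i)))) (*-assoc _ _ _)) (suc r))
                     (∑<-scale a⁻¹ _ (suc r))))
      where
      shift : ∀ z i → z ℤ.+ + suc i ≡ ℤ.suc z ℤ.+ + i
      shift z i = ≡.trans (shift-suc z i) (≡.sym (ℤₚ.+-assoc (+ 1) z (+ i)))

    W-formula : ∀ r z → W z r ≈ 1-a⁻¹ * (zpow z * hℤ′ (z ℤ.+ + r) - lower z r) + g r * hℤ′ z
    W-formula zero z = trans (W-zero z)
      (+-cong (*-congˡ (+-cong (*-congˡ z+0) (-‿cong (sym (trans (+-identityˡ _)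
                 (trans (*-cong (trans (*-identityˡ _) g-0) (sym z+0)) (*-identityˡ _)))))))
              (sym (trans (*-congʳ g-0) (*-identityˡ _))))
      where
      z+0 : hℤ′ z ≈ hℤ′ (z ℤ.+ + 0)
      z+0 = reflexive (≡.cong hℤ′ (≡.sym (ℤₚ.+-identityʳ z)))
    W-formula (suc r) z = begin
      W z (suc r)
        ≈⟨ trans (sym (*-identityˡ _)) (trans (*-congʳ (sym a⁻¹-inverse)) (*-assoc _ _ _)) ⟩
      a⁻¹ * (a * W z (suc r))
        ≈⟨ solve 4 (λ i p q w → i :* w := i :* (((p :- q) :+ w) :- p :+ q)) refl a⁻¹ (g r * hℤ′ (ℤ.suc z)) (g (suc r) * hℤ′ z) _ ⟩
      a⁻¹ * (((g r * hℤ′ (ℤ.suc z) - g (suc r) * hℤ′ z) + a * W z (suc r)) - g r * hℤ′ (ℤ.suc z) + g (suc r) * hℤ′ z)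
        ≈⟨ *-congˡ (+-congʳ (+-congʳ (trans (sym (W-rec z r)) (W-formula r (ℤ.suc z))))) ⟩
      a⁻¹ * ((1-a⁻¹ * (zpow (ℤ.suc z) * hℤ′ (ℤ.suc z ℤ.+ + r) - lower (ℤ.suc z) r) + g r * hℤ′ (ℤ.suc z)) - g r * hℤ′ (ℤ.suc z) + g (suc r) * hℤ′ z)
        ≈⟨ solve 6 (λ i p H l q k → i :* (((con (+ 1) :- i) :* (p :* H :- l) :+ q) :- q :+ k)
              := (con (+ 1) :- i) :* (i :* p :* H :- (k :+ i :* l)) :+ k) refl a⁻¹ (zpow (ℤ.suc z)) _ _ _ _ ⟩
      1-a⁻¹ * (a⁻¹ * zpow (ℤ.suc z) * hℤ′ (ℤ.suc z ℤ.+ + r) - (g (suc r) * hℤ′ z + a⁻¹ * lower (ℤ.suc z) r)) + g (suc r) * hℤ′ z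
        ≈⟨ +-congʳ (*-congˡ (+-cong (*-cong (sym (zpow-suc z)) (reflexive (≡.cong hℤ′ (≡.trans (ℤₚ.+-assoc (+ 1) z (+ r)) (≡.sym (shift-suc z r))))))
                                    (-‿cong (sym (lower-suc z r))))) ⟩
      1-a⁻¹ * (zpow z * hℤ′ (z ℤ.+ + suc r) - lower z (suc r)) + g (suc r) * hℤ′ z ∎

    eigenvalue : List ℤ → ℕ → Carrier
    eigenvalue ns m = 1# + 1-a⁻¹ * (DR.sumOver zpow ns - ∑< m (powers a⁻¹))

    pair-det : ∀ ns m → pair (DP.det ns (DP.columns ĉ 0 (suc m))) ĝ ≈ eigenvalue ns (suc m) * DR.det ns (DR.columns c 0 (suc m))
    pair-det ns m = begin
      pair (DP.det ns (DP.columns ĉ 0 (suc m))) ĝ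
        ≈⟨ pair-cong ĝ (det-ĉ ns m) ⟩
      pair (DP.replaceSum Y (λ j n → const (c j n)) (DP.det ns) 0 (suc m)) ĝ
        ≈⟨ PD.replaceSum-pair (PD.det-compatible ns) Y c 0 (suc m) ⟩
      rs (λ j n → pair (Y j n) ĝ)
        ≈⟨ DR.replaceSum-linear A c _ Y₁ Y₂ 1-a⁻¹ 1# Y-split 0 (suc m) ⟩
      1-a⁻¹ * rs Y₁ + 1# * rs Y₂
        ≈⟨ +-cong (*-congˡ (DR.replaceSum-linear A c Y₁ (DR.rowScaled zpow ∘ c) Yₗ 1# (- 1#)
                     (λ j n → solve 2 (λ u l → u :- l := con (+ 1) :* u :+ :- con (+ 1) :* l) refl _ _) 0 (suc m)))
                  (*-congˡ rs-Y₂) ⟩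
      1-a⁻¹ * (1# * rs (DR.rowScaled zpow ∘ c) + - 1# * rs Yₗ) + 1# * (1# * det)
        ≈⟨ +-congʳ (*-congˡ (+-cong (*-congˡ (trans (reflexive (DR.replaceSum-derivative zpow c (DR.det ns) 0 (suc m)))
                                                    (DR.derivative-det zpow ns _)))
                                    (*-congˡ rs-lower))) ⟩
      1-a⁻¹ * (1# * (DR.sumOver zpow ns * det) + - 1# * (∑< (suc m) (powers a⁻¹) * det)) + 1# * (1# * det)
        ≈⟨ solve 4 (λ t u v d → t :* (con (+ 1) :* (u :* d) :+ :- con (+ 1) :* (v :* d)) :+ con (+ 1) :* (con (+ 1) :* d)
             := (con (+ 1) :+ t :* (u :- v)) :* d) refl 1-a⁻¹ _ _ det ⟩
      eigenvalue ns (suc m) * det ∎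
      where
      A   = DR.det-alternating ns
      det = DR.det ns (DR.columns c 0 (suc m))
      rs : (ℕ → DR.Column) → Carrier
      rs Y = DR.replaceSum Y c (DR.det ns) 0 (suc m)
      Y₁ Y₂ Yₗ : ℕ → DR.Column
      Yₗ j n = lower n j
      Y₁ j n = zpow n * c j n - lower n j
      Y₂ j n = g j * c 0 n
      Y-split : ∀ j n → pair (Y j n) ĝ ≈ 1-a⁻¹ * Y₁ j n + 1# * Y₂ j n
      Y-split j n rewrite ℤₚ.+-identityʳ n = trans (W-formula j n) (+-congˡ (sym (*-identityˡ _)))
      triangular : ∀ (Y : ℕ → DR.Column) (B : ℕ → ℕ → Carrier) → (∀ j n → Y j n ≈ ∑< (suc j) (λ i → B j i * c i n)) →
        rs Y ≈ ∑< (suc m) (λ i → B i i) * det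
      triangular Y B eq = trans (sym (trans (+-congˡ (zeroˡ _)) (+-identityʳ _)))
        (trans (DR.replaceSum-triangular A c Y B eq 0 (suc m) (λ _ ()))
               (*-congʳ (reflexive (≡.cong (λ t → ∑< t (λ i → B i i)) (ℕₚ.+-identityʳ (suc m))))))
      rs-lower : rs Yₗ ≈ ∑< (suc m) (powers a⁻¹) * det
      rs-lower = trans (triangular Yₗ B (λ _ _ → refl))
        (*-congʳ (∑<-cong (λ i → trans (*-congˡ (trans (reflexive (≡.cong g (ℕₚ.n∸n≡0 i))) g-0)) (*-identityʳ _)) (suc m)))
      -- Column j is g_j times column 0. Among the diagonal coefficients only g 0 = 1 is not zero by
      -- definition, and it gives the summand 1 of the eigenvalue.
      first : ℕ → ℕ → Carrier
      first j zero    = g j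
      first j (suc i) = 0#
      rs-Y₂ : rs Y₂ ≈ 1# * det
      rs-Y₂ = trans (triangular Y₂ first (λ j n → sym (trans (∑<-head _ j)
                 (trans (+-congˡ (∑<-zero j (λ _ _ → zeroˡ _))) (+-identityʳ _)))))
        (*-congʳ (trans (∑<-head _ m) (trans (+-cong g-0 (∑<-zero m (λ _ _ → refl))) (+-identityʳ _))))

    pair-det-length : ∀ ns → pair (DP.det ns (DP.columns ĉ 0 (length ns))) ĝ
                             ≈ eigenvalue ns (length ns) * DR.det ns (DR.columns c 0 (length ns))
    -- The empty partition is treated apart, because `shear` starts from a first column.
    pair-det-length [] = trans (+-cong (*-congˡ (initial ĝ-exp)) refl)
      (solve 1 (λ i → con (+ 1) :* con (+ 1) :+ con (+ 0) := (con (+ 1) :+ (con (+ 1) :- i) :* (con (+ 0) :- con (+ 0))) :* con (+ 1)) refl a⁻¹)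
    pair-det-length (n ∷ ns) = pair-det (n ∷ ns) (length ns)

    geometric : ℕ → Carrier
    geometric zero    = 0#
    geometric (suc n) = 1# + a * geometric n

    biexponents : List ℕ → Carrier
    biexponents []      = 0#
    biexponents (m ∷ μ) = geometric m + a⁻¹ * biexponents μ

    geometric-sum : ∀ n → powers a n ≈ 1# - (1# - a) * geometric n
    geometric-sum zero    = solve 1 (λ a → con (+ 1) := con (+ 1) :- (con (+ 1) :- a) :* con (+ 0)) refl a
    geometric-sum (suc n) = trans (*-congˡ (geometric-sum n))
      (solve 2 (λ a s → a :* (con (+ 1) :- (con (+ 1) :- a) :* s) := con (+ 1) :- (con (+ 1) :- a) :* (con (+ 1) :+ a :* s)) refl a (geometric n))

    zpow-minus : ∀ m i → zpow (+ m ℤ.- + i) ≈ powers a⁻¹ i * powers a m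
    zpow-minus m zero    = trans (reflexive (≡.cong zpow (ℤₚ.+-identityʳ (+ m)))) (sym (*-identityˡ _))
    zpow-minus m (suc i) = trans (zpow-suc (+ m ℤ.- + suc i))
      (trans (*-congˡ (trans (reflexive (≡.cong zpow step)) (zpow-minus m i))) (sym (*-assoc _ _ _)))
      where
      step : ℤ.suc (+ m ℤ.- + suc i) ≡ + m ℤ.- + i
      step = ≡.trans (≡.cong (λ t → ℤ.suc (+ m ℤ.+ t)) (ℤₚ.neg-suc i))
        (≡.trans (≡.cong ℤ.suc (≡.trans (≡.cong (λ t → + m ℤ.+ t) (ℤₚ.+-comm -[1+ 0 ] (ℤ.- + i))) (≡.sym (ℤₚ.+-assoc (+ m) (ℤ.- + i) -[1+ 0 ]))))
        (≡.trans (ℤₚ.+-comm (+ 1) (+ m ℤ.- + i ℤ.+ -[1+ 0 ])) (≡.trans (ℤₚ.+-assoc (+ m ℤ.- + i) -[1+ 0 ] (+ 1)) (ℤₚ.+-identityʳ _))))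

    sumOver-zpow : ∀ i μ → DR.sumOver zpow (rowLabels i μ)
                           ≈ powers a⁻¹ i * (∑< (length μ) (powers a⁻¹) - (1# - a) * biexponents μ)
    sumOver-zpow i [] = solve 2 (λ p a → con (+ 0) := p :* (con (+ 0) :- (con (+ 1) :- a) :* con (+ 0))) refl _ a
    sumOver-zpow i (m ∷ μ) = begin
      zpow (+ m ℤ.- + i) + DR.sumOver zpow (rowLabels (suc i) μ)
        ≈⟨ +-cong (trans (zpow-minus m i) (*-congˡ (geometric-sum m))) (sumOver-zpow (suc i) μ) ⟩
      p * (1# - (1# - a) * geometric m) + a⁻¹ * p * (σ - (1# - a) * biexponents μ)
        ≈⟨ solve 6 (λ p a g j σ b → p :* (con (+ 1) :- (con (+ 1) :- a) :* g) :+ j :* p :* (σ :- (con (+ 1) :- a) :* b)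
              := p :* ((con (+ 1) :+ j :* σ) :- (con (+ 1) :- a) :* (g :+ j :* b))) refl p a (geometric m) a⁻¹ σ (biexponents μ) ⟩
      p * ((1# + a⁻¹ * σ) - (1# - a) * biexponents (m ∷ μ))
        ≈⟨ *-congˡ (+-congʳ (trans (∑<-head (powers a⁻¹) (length μ)) (+-congˡ (∑<-scale a⁻¹ (powers a⁻¹) (length μ))))) ⟨
      p * (∑< (suc (length μ)) (powers a⁻¹) - (1# - a) * biexponents (m ∷ μ)) ∎
      where
      p = powers a⁻¹ i
      σ = ∑< (length μ) (powers a⁻¹)

    eigenvalue-partition : ∀ μ → eigenvalue (rowLabels 0 μ) (length μ) ≈ 1# - (1# - a⁻¹) * (1# - a) * biexponents μ
    eigenvalue-partition μ = trans (+-congˡ (*-congˡ (+-congʳ (trans (sumOver-zpow 0 μ) (*-identityˡ _)))))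
      (solve 4 (λ i σ a b → con (+ 1) :+ (con (+ 1) :- i) :* ((σ :- (con (+ 1) :- a) :* b) :- σ)
          := con (+ 1) :- (con (+ 1) :- i) :* (con (+ 1) :- a) :* b) refl a⁻¹ _ a (biexponents μ))

-- Power-sum monomials as weakly decreasing lists

module Monomials where
  open import Defs using (insertPart; mergePart)
  open import Data.Nat using (_≥_; s≤s)
  open import Data.List.Relation.Binary.Equality.Propositional using (≋⇒≡)
  open import Data.List.Relation.Binary.Permutation.Propositional using (_↭_; prep; swap; ↭-refl; ↭-sym; ↭-trans; ↭⇒↭ₛ)
  import Data.List.Relation.Binary.Permutation.Propositional.Properties as Perm
  open import Data.List.Relation.Unary.Linked as Linked using (Linked; []; [-]; _∷_)
  import Data.List.Relation.Unary.Sorted.TotalOrder.Properties as Sorted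
  import Relation.Binary.Construct.Flip.EqAndOrd as Flip

  Descending : List ℕ → Set
  Descending = Linked _≥_

  insertPart-↭ : ∀ k ν → insertPart k ν ↭ k ∷ ν
  insertPart-↭ k []       = ↭-refl
  insertPart-↭ k (m ∷ ms) with m ℕ.≤? k
  ... | yes _ = ↭-refl
  ... | no  _ = ↭-trans (prep m (insertPart-↭ k ms)) (swap m k ↭-refl)

  mergePart-↭ : ∀ ν ρ → mergePart ν ρ ↭ ν ++ ρ
  mergePart-↭ []      ρ = ↭-refl
  mergePart-↭ (k ∷ ν) ρ = ↭-trans (insertPart-↭ k (mergePart ν ρ)) (prep k (mergePart-↭ ν ρ))

  insertPart-descending : ∀ k {ν} → Descending ν → Descending (insertPart k ν)
  insertPart-descending k {[]}     _ = [-]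
  insertPart-descending k {m ∷ ms} d with m ℕ.≤? k
  ... | yes m≤k = m≤k ∷ d
  ... | no  m≰k = below (ℕₚ.≰⇒≥ m≰k) d
    where
    below : ∀ {m ms} → m ≥ k → Descending (m ∷ ms) → Descending (m ∷ insertPart k ms)
    below m≥k [-] = m≥k ∷ [-]
    below {m} {m′ ∷ ms} m≥k (m≥m′ ∷ d) with m′ ℕ.≤? k | insertPart-descending k d
    ... | yes m′≤k | d′ = m≥k ∷ m′≤k ∷ d
    ... | no  _    | d′ = m≥m′ ∷ d′

  mergePart-descending : ∀ ν {ρ} → Descending ρ → Descending (mergePart ν ρ)
  mergePart-descending []      d = d
  mergePart-descending (k ∷ ν) d = insertPart-descending k (mergePart-descending ν d)

  -- Sorted lists are canonical forms of multisets, so the laws of `mergePart` follow from those of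
  -- `++` up to permutation.
  descending-↭⇒≡ : ∀ {ν ρ} → Descending ν → Descending ρ → ν ↭ ρ → ν ≡ ρ
  descending-↭⇒≡ d d′ p = ≋⇒≡ (Sorted.↗↭↗⇒≋ (Flip.totalOrder ℕₚ.≤-totalOrder) d d′ (↭⇒↭ₛ p))

  Monomial : Set
  Monomial = Σ (List ℕ) Descending

  infixl 7 _∙_
  _∙_ : Monomial → Monomial → Monomial
  (ν , _) ∙ (ρ , d) = mergePart ν ρ , mergePart-descending ν d

  ∙-comm : ∀ m n → proj₁ (m ∙ n) ≡ proj₁ (n ∙ m)
  ∙-comm (ν , dν) (ρ , dρ) = descending-↭⇒≡ (mergePart-descending ν dρ) (mergePart-descending ρ dν)
    (↭-trans (mergePart-↭ ν ρ) (↭-trans (Perm.++-comm ν ρ) (↭-sym (mergePart-↭ ρ ν))))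

  ∙-assoc : ∀ m n o → proj₁ ((m ∙ n) ∙ o) ≡ proj₁ (m ∙ (n ∙ o))
  ∙-assoc (ν , _) (ρ , _) (τ , dτ) = descending-↭⇒≡
    (mergePart-descending (mergePart ν ρ) dτ) (mergePart-descending ν (mergePart-descending ρ dτ))
    (↭-trans (mergePart-↭ (mergePart ν ρ) τ) (↭-trans (Perm.++⁺ʳ τ (mergePart-↭ ν ρ))
      (↭-trans (Perm.++-assoc ν ρ τ) (↭-sym (↭-trans (mergePart-↭ ν _) (Perm.++⁺ˡ ν (mergePart-↭ ρ τ)))))))

  -- The ring model stores the part k + 1 as k; the shift preserves comparisons, hence insertions.
  insertPart-suc : ∀ k ν → insertPart (suc k) (map suc ν) ≡ map suc (insertPart k ν)
  insertPart-suc k []       = ≡.refl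
  insertPart-suc k (m ∷ ms) with m ℕ.≤? k | suc m ℕ.≤? suc k
  ... | yes _   | yes _ = ≡.refl
  ... | no  _   | no  _ = ≡.cong (suc m ∷_) (insertPart-suc k ms)
  ... | yes m≤k | no  q = contradiction (s≤s m≤k) q
  ... | no  q   | yes (s≤s m≤k) = contradiction m≤k q

  mergePart-suc : ∀ ν ρ → mergePart (map suc ν) (map suc ρ) ≡ map suc (mergePart ν ρ)
  mergePart-suc []      ρ = ≡.refl
  mergePart-suc (k ∷ ν) ρ rewrite mergePart-suc ν ρ = insertPart-suc k (mergePart ν ρ)

-- The algebra spanned by power-sum monomials and its evaluations

module PowerSumAlgebra (𝕂 : CommutativeRing 0ℓ 0ℓ) where
  open import Data.List.Relation.Unary.Linked using ([]; [-])
  open import Data.Product using (_×_)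
  open import Defs using (mergePart; insertPart)
  open Monomials

  open CommutativeRing 𝕂 hiding (zero)
  open import Relation.Binary.Reasoning.Setoid setoid
  open IntegerSolver 𝕂

  Λ° : Set
  Λ° = List (Carrier × Monomial)

  ⟨_,_⟩ : Λ° → (List ℕ → Carrier) → Carrier
  ⟨ []              , φ ⟩ = 0#
  ⟨ (c , (ν , _)) ∷ F , φ ⟩ = c * φ ν + ⟨ F , φ ⟩

  termMul : Carrier × Monomial → Carrier × Monomial → Carrier × Monomial
  termMul (c , m) (d , n) = c * d , m ∙ n

  infixl 6 _⊕_
  infixl 7 _⊗_
  _⊕_ _⊗_ : Λ° → Λ° → Λ°
  F ⊕ G = F ++ G
  F ⊗ G = concatMap (λ s → map (termMul s) G) F

  scale : Carrier → Λ° → Λ°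
  scale c = map (λ t → c * proj₁ t , proj₂ t)

  ⊖_ : Λ° → Λ°
  ⊖_ = scale (- 1#)

  κ : Carrier → Λ°
  κ c = (c , [] , []) ∷ []

  -- p_{i+1}: parts are shifted by one, so that p_0, whose plethysms have zero denominators, cannot occur.
  powerSum : ℕ → Λ°
  powerSum i = (1# , i ∷ [] , [-]) ∷ []

  ⟨⟩-cong : ∀ F {φ ψ} → (∀ (m : Monomial) → φ (proj₁ m) ≈ ψ (proj₁ m)) → ⟨ F , φ ⟩ ≈ ⟨ F , ψ ⟩
  ⟨⟩-cong []            eq = refl
  ⟨⟩-cong ((c , m) ∷ F) eq = +-cong (*-congˡ (eq m)) (⟨⟩-cong F eq)

  ⟨⟩-linear : ∀ F a b φ ψ → ⟨ F , (λ ν → a * φ ν + b * ψ ν) ⟩ ≈ a * ⟨ F , φ ⟩ + b * ⟨ F , ψ ⟩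
  ⟨⟩-linear []            a b φ ψ = solve 2 (λ a b → con (+ 0) := a :* con (+ 0) :+ b :* con (+ 0)) refl a b
  ⟨⟩-linear ((c , m) ∷ F) a b φ ψ = trans (+-congˡ (⟨⟩-linear F a b φ ψ))
    (solve 7 (λ a b c p q u v → c :* (a :* p :+ b :* q) :+ (a :* u :+ b :* v)
       := a :* (c :* p :+ u) :+ b :* (c :* q :+ v)) refl a b c _ _ _ _)

  ⟨⟩-zero : ∀ F → ⟨ F , (λ _ → 0#) ⟩ ≈ 0#
  ⟨⟩-zero []            = refl
  ⟨⟩-zero ((c , m) ∷ F) = trans (+-cong (zeroʳ c) (⟨⟩-zero F)) (+-identityˡ _)

  ⟨⟩-⊕ : ∀ F G φ → ⟨ F ⊕ G , φ ⟩ ≈ ⟨ F , φ ⟩ + ⟨ G , φ ⟩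
  ⟨⟩-⊕ []            G φ = sym (+-identityˡ _)
  ⟨⟩-⊕ ((c , m) ∷ F) G φ = trans (+-congˡ (⟨⟩-⊕ F G φ)) (sym (+-assoc _ _ _))

  ⟨⟩-scale : ∀ c F φ → ⟨ scale c F , φ ⟩ ≈ c * ⟨ F , φ ⟩
  ⟨⟩-scale c []            φ = sym (zeroʳ c)
  ⟨⟩-scale c ((d , m) ∷ F) φ = trans (+-congˡ (⟨⟩-scale c F φ))
    (solve 4 (λ c d p q → c :* d :* p :+ c :* q := c :* (d :* p :+ q)) refl c d _ _)

  ⟨⟩-termMul : ∀ c m G φ → ⟨ map (termMul (c , m)) G , φ ⟩ ≈ c * ⟨ G , φ ∘ mergePart (proj₁ m) ⟩
  ⟨⟩-termMul c m []            φ = sym (zeroʳ c)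
  ⟨⟩-termMul c m ((d , n) ∷ G) φ = trans (+-congˡ (⟨⟩-termMul c m G φ))
    (solve 4 (λ c d p q → c :* d :* p :+ c :* q := c :* (d :* p :+ q)) refl c d _ _)

  ⟨⟩-⊗ : ∀ F G φ → ⟨ F ⊗ G , φ ⟩ ≈ ⟨ F , (λ ν → ⟨ G , φ ∘ mergePart ν ⟩) ⟩
  ⟨⟩-⊗ []            G φ = refl
  ⟨⟩-⊗ ((c , m) ∷ F) G φ =
    trans (⟨⟩-⊕ (map (termMul (c , m)) G) (F ⊗ G) φ) (+-cong (⟨⟩-termMul c m G φ) (⟨⟩-⊗ F G φ))

  ⟨⟩-fubini : ∀ F G (ψ : List ℕ → List ℕ → Carrier) → ⟨ F , (λ ν → ⟨ G , ψ ν ⟩) ⟩ ≈ ⟨ G , (λ ρ → ⟨ F , (λ ν → ψ ν ρ) ⟩) ⟩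
  ⟨⟩-fubini []            G ψ = sym (⟨⟩-zero G)
  ⟨⟩-fubini ((c , m) ∷ F) G ψ = trans (+-cong refl (⟨⟩-fubini F G ψ))
    (trans (+-congˡ (sym (*-identityˡ _))) (trans (sym (⟨⟩-linear G c 1# _ _)) (⟨⟩-cong G (λ _ → +-congˡ (*-identityˡ _)))))

  -- Equality is tested by all linear functionals rather than by coefficients: φ(FG) is then an iterated pairing,
  -- and commutativity of the product is the exchange of two finite sums.
  infix 4 _≃_
  record _≃_ (F G : Λ°) : Set where
    constructor by-functionals
    field functional : ∀ φ → ⟨ F , φ ⟩ ≈ ⟨ G , φ ⟩
  open _≃_ public

  ⊗-comm : ∀ F G → F ⊗ G ≃ G ⊗ F
  ⊗-comm F G = by-functionals λ φ → begin
    ⟨ F ⊗ G , φ ⟩                                   ≈⟨ ⟨⟩-⊗ F G φ ⟩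
    ⟨ F , (λ ν → ⟨ G , φ ∘ mergePart ν ⟩) ⟩           ≈⟨ ⟨⟩-fubini F G _ ⟩
    ⟨ G , (λ ρ → ⟨ F , (λ ν → φ (mergePart ν ρ)) ⟩) ⟩ ≈⟨ ⟨⟩-cong G (λ n → ⟨⟩-cong F (λ m → reflexive (≡.cong φ (∙-comm m n)))) ⟩
    ⟨ G , (λ ρ → ⟨ F , φ ∘ mergePart ρ ⟩) ⟩           ≈⟨ ⟨⟩-⊗ G F φ ⟨
    ⟨ G ⊗ F , φ ⟩                                   ∎

  ⊗-assoc : ∀ F G H → (F ⊗ G) ⊗ H ≃ F ⊗ (G ⊗ H)
  ⊗-assoc F G H = by-functionals λ φ → begin
    ⟨ (F ⊗ G) ⊗ H , φ ⟩
      ≈⟨ trans (⟨⟩-⊗ (F ⊗ G) H φ) (⟨⟩-⊗ F G _) ⟩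
    ⟨ F , (λ ν → ⟨ G , (λ ρ → ⟨ H , φ ∘ mergePart (mergePart ν ρ) ⟩) ⟩) ⟩
      ≈⟨ ⟨⟩-cong F (λ m → ⟨⟩-cong G (λ n → ⟨⟩-cong H (λ o → reflexive (≡.cong φ (∙-assoc m n o))))) ⟩
    ⟨ F , (λ ν → ⟨ G , (λ ρ → ⟨ H , φ ∘ mergePart ν ∘ mergePart ρ ⟩) ⟩) ⟩
      ≈⟨ ⟨⟩-cong F (λ m → ⟨⟩-⊗ G H _) ⟨
    ⟨ F , (λ ν → ⟨ G ⊗ H , φ ∘ mergePart ν ⟩) ⟩
      ≈⟨ ⟨⟩-⊗ F (G ⊗ H) φ ⟨
    ⟨ F ⊗ (G ⊗ H) , φ ⟩ ∎

  ⊗-cong : ∀ {F F′ G G′} → F ≃ F′ → G ≃ G′ → F ⊗ G ≃ F′ ⊗ G′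
  ⊗-cong {F} {F′} {G} {G′} p q = by-functionals λ φ →
    trans (⟨⟩-⊗ F G φ) (trans (functional p _)
      (trans (⟨⟩-cong F′ (λ _ → functional q _)) (sym (⟨⟩-⊗ F′ G′ φ))))

  ⟨⟩-κ⊗ : ∀ c F φ → ⟨ κ c ⊗ F , φ ⟩ ≈ c * ⟨ F , φ ⟩
  ⟨⟩-κ⊗ c F φ = trans (⟨⟩-⊗ (κ c) F φ) (+-identityʳ _)

  ⊗-identityˡ : ∀ F → κ 1# ⊗ F ≃ F
  ⊗-identityˡ F = by-functionals λ φ → trans (⟨⟩-κ⊗ 1# F φ) (*-identityˡ _)

  ⊗-distribʳ : ∀ F G H → (G ⊕ H) ⊗ F ≃ (G ⊗ F) ⊕ (H ⊗ F)
  ⊗-distribʳ F G H = by-functionals λ φ →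
    trans (⟨⟩-⊗ (G ⊕ H) F φ) (trans (⟨⟩-⊕ G H _)
      (sym (trans (⟨⟩-⊕ (G ⊗ F) (H ⊗ F) φ) (+-cong (⟨⟩-⊗ G F φ) (⟨⟩-⊗ H F φ)))))

  ⊕-cong : ∀ {F F′ G G′} → F ≃ F′ → G ≃ G′ → F ⊕ G ≃ F′ ⊕ G′
  ⊕-cong {F} {F′} {G} {G′} p q = by-functionals λ φ →
    trans (⟨⟩-⊕ F G φ) (trans (+-cong (functional p φ) (functional q φ)) (sym (⟨⟩-⊕ F′ G′ φ)))

  ⊕-comm : ∀ F G → F ⊕ G ≃ G ⊕ F
  ⊕-comm F G = by-functionals λ φ → trans (⟨⟩-⊕ F G φ) (trans (+-comm _ _) (sym (⟨⟩-⊕ G F φ)))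

  ⊖-inverseˡ : ∀ F → (⊖ F) ⊕ F ≃ []
  ⊖-inverseˡ F = by-functionals λ φ → trans (⟨⟩-⊕ (⊖ F) F φ) (trans (+-congʳ (⟨⟩-scale (- 1#) F φ))
    (solve 1 (λ u → :- con (+ 1) :* u :+ u := con (+ 0)) refl _))

  ≃-refl : ∀ {F} → F ≃ F
  ≃-refl = by-functionals λ _ → refl

  ≃-sym : ∀ {F G} → F ≃ G → G ≃ F
  ≃-sym p = by-functionals λ φ → sym (functional p φ)

  ≃-trans : ∀ {F G H} → F ≃ G → G ≃ H → F ≃ H
  ≃-trans p q = by-functionals λ φ → trans (functional p φ) (functional q φ)

  monAlg : CommutativeRing 0ℓ 0ℓ
  monAlg = record
    { Carrier = Λ° ; _≈_ = _≃_ ; _+_ = _⊕_ ; _*_ = _⊗_ ; -_ = ⊖_ ; 0# = [] ; 1# = κ 1#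
    ; isCommutativeRing = record
      { isRing = record
        { +-isAbelianGroup = record
          { isGroup = record
            { isMonoid = record
              { isSemigroup = record
                { isMagma = record
                  { isEquivalence = record { refl = ≃-refl ; sym = ≃-sym ; trans = ≃-trans }
                  ; ∙-cong = ⊕-cong }
                ; assoc = λ F G H → by-functionals λ φ →
                    trans (trans (⟨⟩-⊕ (F ⊕ G) H φ) (+-congʳ (⟨⟩-⊕ F G φ)))
                      (trans (+-assoc _ _ _) (sym (trans (⟨⟩-⊕ F (G ⊕ H) φ) (+-congˡ (⟨⟩-⊕ G H φ))))) }
              ; identity = (λ F → ≃-refl) , (λ F → ⊕-comm F []) }
            ; inverse = ⊖-inverseˡ , (λ F → ≃-trans (⊕-comm F (⊖ F)) (⊖-inverseˡ F))
            ; ⁻¹-cong = λ {F} {G} p → by-functionals λ φ →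
                trans (⟨⟩-scale (- 1#) F φ) (trans (*-congˡ (functional p φ)) (sym (⟨⟩-scale (- 1#) G φ))) }
          ; comm = ⊕-comm }
        ; *-cong = ⊗-cong
        ; *-assoc = ⊗-assoc
        ; *-identity = ⊗-identityˡ , (λ F → ≃-trans (⊗-comm F (κ 1#)) (⊗-identityˡ F))
        ; distrib = (λ F G H → ≃-trans (⊗-comm F (G ⊕ H)) (≃-trans (⊗-distribʳ F G H) (⊕-cong (⊗-comm G F) (⊗-comm H F))))
                  , ⊗-distribʳ }
      ; *-comm = ⊗-comm } }

  κ-cong : ∀ {c d} → c ≈ d → κ c ≃ κ d
  κ-cong eq = by-functionals λ φ → +-congʳ (*-congʳ eq)

  κ-+ : ∀ c d → κ (c + d) ≃ κ c ⊕ κ d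
  κ-+ c d = by-functionals λ φ → trans (+-congʳ (distribʳ _ _ _)) (+-assoc _ _ _)

  κ-* : ∀ c d → κ (c * d) ≃ κ c ⊗ κ d
  κ-* c d = ≃-refl

  κ-0 : κ 0# ≃ []
  κ-0 = by-functionals λ φ → trans (+-congʳ (zeroˡ _)) (+-identityˡ _)

  κ-neg : ∀ c → κ (- c) ≃ ⊖ κ c
  κ-neg c = by-functionals λ φ → +-congʳ (*-congʳ (solve 1 (λ c → :- c := :- con (+ 1) :* c) refl c))

  scale-κ : ∀ c F → scale c F ≃ κ c ⊗ F
  scale-κ c F = by-functionals λ φ → trans (⟨⟩-scale c F φ) (sym (⟨⟩-κ⊗ c F φ))

  κHom : RingHom 𝕂 monAlg
  κHom = record { φ = κ ; φ-cong = κ-cong ; φ-+ = κ-+ ; φ-* = κ-* ; φ-0 = κ-0 ; φ-1 = ≃-refl }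

  -- The functionals make evaluation of formal combinations in A compatible with _≃_.
  record SeparatedAlgebra : Set₁ where
    field
      A : CommutativeRing 0ℓ 0ℓ
    module A = CommutativeRing A
    field
      ι           : Carrier → A.Carrier
      ι-*         : ∀ c d → ι (c * d) A.≈ ι c A.* ι d
      ι-1         : ι 1# A.≈ A.1#
      {Index}     : Set
      ℓ           : Index → A.Carrier → Carrier
      ℓ-+         : ∀ i x y → ℓ i (x A.+ y) ≈ ℓ i x + ℓ i y
      ℓ-0         : ∀ i → ℓ i A.0# ≈ 0#
      ℓ-scale     : ∀ i c x → ℓ i (ι c A.* x) ≈ c * ℓ i x
      ℓ-separates : ∀ {x y} → (∀ i → ℓ i x ≈ ℓ i y) → x A.≈ y

  selfSeparated : SeparatedAlgebra
  selfSeparated = record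
    { A = monAlg ; ι = κ ; ι-* = κ-* ; ι-1 = ≃-refl
    ; ℓ = λ φ F → ⟨ F , φ ⟩ ; ℓ-+ = λ φ F G → ⟨⟩-⊕ F G φ ; ℓ-0 = λ _ → refl
    ; ℓ-scale = λ φ c F → ⟨⟩-κ⊗ c F φ ; ℓ-separates = by-functionals }

  module Eval (S : SeparatedAlgebra) (P : ℕ → CommutativeRing.Carrier (SeparatedAlgebra.A S)) where
    open SeparatedAlgebra S

    private module AS = IntegerSolver A

    evalMonomial : List ℕ → A.Carrier
    evalMonomial = foldr (λ k acc → P k A.* acc) A.1#

    eval : Λ° → A.Carrier
    eval []            = A.0#
    eval ((c , m) ∷ F) = ι c A.* evalMonomial (proj₁ m) A.+ eval F

    -- Evaluation followed by ℓ is itself a functional on formal combinations, and these are what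
    -- `_≃_` tests; `eval-cong` is immediate from this.
    eval-functional : ∀ i F → ℓ i (eval F) ≈ ⟨ F , ℓ i ∘ evalMonomial ⟩
    eval-functional i []            = ℓ-0 i
    eval-functional i ((c , m) ∷ F) = trans (ℓ-+ i _ _) (+-cong (ℓ-scale i c _) (eval-functional i F))

    eval-cong : ∀ {F G} → F ≃ G → eval F A.≈ eval G
    eval-cong {F} {G} p = ℓ-separates λ i →
      trans (eval-functional i F) (trans (functional p _) (sym (eval-functional i G)))

    evalMonomial-insert : ∀ k ν → evalMonomial (insertPart k ν) A.≈ P k A.* evalMonomial ν
    evalMonomial-insert k []       = A.refl
    evalMonomial-insert k (m ∷ ms) with m ℕ.≤? k
    ... | yes _ = A.refl
    ... | no  _ = A.trans (A.*-congˡ (evalMonomial-insert k ms))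
      (AS.solve 3 (λ m k p → m AS.:* (k AS.:* p) AS.:= k AS.:* (m AS.:* p)) A.refl (P m) (P k) _)

    evalMonomial-merge : ∀ ν ρ → evalMonomial (mergePart ν ρ) A.≈ evalMonomial ν A.* evalMonomial ρ
    evalMonomial-merge []      ρ = A.sym (A.*-identityˡ _)
    evalMonomial-merge (k ∷ ν) ρ = A.trans (evalMonomial-insert k (mergePart ν ρ))
      (A.trans (A.*-congˡ (evalMonomial-merge ν ρ)) (A.sym (A.*-assoc _ _ _)))

    eval-⊕ : ∀ F G → eval (F ⊕ G) A.≈ eval F A.+ eval G
    eval-⊕ []            G = A.sym (A.+-identityˡ _)
    eval-⊕ ((c , m) ∷ F) G = A.trans (A.+-congˡ (eval-⊕ F G)) (A.sym (A.+-assoc _ _ _))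

    eval-termMul : ∀ c m G → eval (map (termMul (c , m)) G) A.≈ ι c A.* evalMonomial (proj₁ m) A.* eval G
    eval-termMul c m []            = A.sym (A.zeroʳ _)
    eval-termMul c m ((d , n) ∷ G) = A.trans
      (A.+-cong (A.*-cong (ι-* c d) (evalMonomial-merge (proj₁ m) (proj₁ n))) (eval-termMul c m G))
      (AS.solve 5 (λ c d m n g → c AS.:* d AS.:* (m AS.:* n) AS.:+ c AS.:* m AS.:* g
          AS.:= c AS.:* m AS.:* (d AS.:* n AS.:+ g)) A.refl (ι c) (ι d) (evalMonomial (proj₁ m)) (evalMonomial (proj₁ n)) (eval G))

    eval-⊗ : ∀ F G → eval (F ⊗ G) A.≈ eval F A.* eval G
    eval-⊗ []            G = A.sym (A.zeroˡ _)
    eval-⊗ ((c , m) ∷ F) G = A.trans (eval-⊕ (map (termMul (c , m)) G) (F ⊗ G))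
      (A.trans (A.+-cong (eval-termMul c m G) (eval-⊗ F G)) (A.sym (A.distribʳ _ _ _)))

    eval-κ : ∀ c → eval (κ c) A.≈ ι c
    eval-κ c = A.trans (A.+-identityʳ _) (A.*-identityʳ _)

    eval-1 : eval (κ 1#) A.≈ A.1#
    eval-1 = A.trans (eval-κ 1#) ι-1

    eval-powerSum : ∀ i → eval (powerSum i) A.≈ P i
    eval-powerSum i = A.trans (A.+-identityʳ _)
      (A.trans (A.*-cong ι-1 (A.*-identityʳ _)) (A.*-identityˡ _))

    evalHom : RingHom monAlg A
    evalHom = record
      { φ = eval ; φ-cong = eval-cong ; φ-+ = eval-⊕ ; φ-* = eval-⊗ ; φ-0 = A.refl ; φ-1 = eval-1 }

-- The field ℚ(q) as fractions of integer polynomials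

module Fractions where
  open import Algebra.Structures using (IsCommutativeRing)
  open import Data.Empty using (⊥-elim)
  open import Defs

  module Sℤ = Series ℤₚ.+-*-commutativeRing

  coeffP-padd : ∀ f g n → coeffP (padd f g) n ≡ coeffP f n ℤ.+ coeffP g n
  coeffP-padd []      g       n       = ≡.sym (ℤₚ.+-identityˡ _)
  coeffP-padd (a ∷ f) []      n       = ≡.sym (ℤₚ.+-identityʳ _)
  coeffP-padd (a ∷ f) (b ∷ g) zero    = ≡.refl
  coeffP-padd (a ∷ f) (b ∷ g) (suc n) = coeffP-padd f g n

  coeffP-pscale : ∀ c f n → coeffP (pscale c f) n ≡ c ℤ.* coeffP f n
  coeffP-pscale c []      n       = ≡.sym (ℤₚ.*-zeroʳ c)
  coeffP-pscale c (a ∷ f) zero    = ≡.refl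
  coeffP-pscale c (a ∷ f) (suc n) = coeffP-pscale c f n

  coeffP-pmul : ∀ f g n → coeffP (pmul f g) n ≡ (coeffP f Sℤ.⊛ coeffP g) n
  coeffP-pmul []      g n       = ≡.sym (Sℤ.⊛-zeroˡ _ (coeffP g) (λ _ → ≡.refl) n)
  coeffP-pmul (a ∷ f) g zero    = ≡.trans (coeffP-padd (pscale a g) (+ 0 ∷ pmul f g) 0)
    (≡.trans (ℤₚ.+-identityʳ _) (coeffP-pscale a g 0))
  coeffP-pmul (a ∷ f) g (suc n) = ≡.trans (coeffP-padd (pscale a g) (+ 0 ∷ pmul f g) (suc n))
    (≡.cong₂ ℤ._+_ (coeffP-pscale a g (suc n)) (coeffP-pmul f g n))

  pneg : Poly → Poly
  pneg = pscale (ℤ.- (+ 1))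

  private
    coeffP-pneg : ∀ f n → coeffP (pneg f) n ≡ ℤ.- coeffP f n
    coeffP-pneg f n = ≡.trans (coeffP-pscale (ℤ.- (+ 1)) f n) (ℤₚ.-1*i≡-i (coeffP f n))

    coeffP-pone : ∀ n → coeffP pone n ≡ Sℤ.one n
    coeffP-pone zero    = ≡.refl
    coeffP-pone (suc n) = ≡.refl

  coefficients : Embedding Poly Sℤ.series
  coefficients = record
    { ι = coeffP ; _⊕_ = padd ; _⊗_ = pmul ; ⊖_ = pneg ; 𝟘 = [] ; 𝟙 = pone
    ; ⊕-homo = coeffP-padd ; ⊗-homo = coeffP-pmul ; ⊖-homo = coeffP-pneg ; 𝟘-homo = λ _ → ≡.refl ; 𝟙-homo = coeffP-pone }

  open Pullback coefficients public
    using (by-image; image) renaming (pullback to ℤ[q]; _≃_ to _≃P_)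

  module Pℤ = CommutativeRing ℤ[q]
  module PS = IntegerSolver ℤ[q]

  shift-cancel : ∀ f → (+ 0 ∷ f) ≃P [] → f ≃P []
  shift-cancel f p = by-image (λ n → image p (suc n))

  -- Comparison of lowest coefficients: a zero constant term of f is stripped off; once it is
  -- nonzero, that of g must vanish, and g is shortened.
  *-integral : ∀ f g → ¬ (f ≈P []) → pmul f g ≃P [] → g ≃P []
  *-integral []      g f≉0 p = ⊥-elim (f≉0 (λ _ → ≡.refl))
  *-integral (a ∷ f) g f≉0 p with a ℤ.≟ + 0
  ... | yes ≡.refl = *-integral f g (λ f≈0 → f≉0 (λ { zero → ≡.refl ; (suc n) → f≈0 n }))
          (shift-cancel (pmul f g) (Pℤ.trans (Pℤ.sym (by-image (λ n → ≡.trans (coeffP-padd (pscale (+ 0) g) (+ 0 ∷ pmul f g) n)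
             (≡.trans (≡.cong (ℤ._+ coeffP (+ 0 ∷ pmul f g) n) (coeffP-pscale (+ 0) g n)) (ℤₚ.+-identityˡ _))))) p))
  ... | no a≢0 = go g p
    where
    go : ∀ g → pmul (a ∷ f) g ≃P [] → g ≃P []
    go []      p = Pℤ.refl
    go (b ∷ g) p with ℤₚ.i*j≡0⇒i≡0∨j≡0 a (≡.trans (≡.sym (coeffP-pmul (a ∷ f) (b ∷ g) 0)) (image p 0))
    ... | inj₁ a≡0    = ⊥-elim (a≢0 a≡0)
    ... | inj₂ ≡.refl = by-image λ { zero → ≡.refl ; (suc n) → image (go g q) n }
      where
      q : pmul (a ∷ f) g ≃P []
      -- With b = 0 the given product is q times `pmul (a ∷ f) g`; `⊛-suc` performs the shift of
      -- degree.
      q = by-image λ n → ≡.trans (coeffP-pmul (a ∷ f) g n)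
        (≡.trans (≡.sym (ℤₚ.+-identityʳ _))
        (≡.trans (≡.cong (λ t → (coeffP (a ∷ f) Sℤ.⊛ coeffP g) n ℤ.+ t) (≡.sym (ℤₚ.*-zeroʳ (coeffP f n))))
        (≡.trans (≡.sym (Sℤ.⊛-suc (coeffP (a ∷ f)) (coeffP (+ 0 ∷ g)) n))
        (≡.trans (≡.sym (coeffP-pmul (a ∷ f) (+ 0 ∷ g) (suc n))) (image p (suc n))))))

  NonZeroP : Poly → Set
  NonZeroP f = ¬ (f ≈P [])

  pmul-nonzero : ∀ {f g} → NonZeroP f → NonZeroP g → NonZeroP (pmul f g)
  pmul-nonzero {f} {g} f≉0 g≉0 p = g≉0 (image (*-integral f g f≉0 (by-image p)))

  pmul-cancelˡ : ∀ f {g h} → NonZeroP f → pmul f g ≃P pmul f h → g ≃P h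
  pmul-cancelˡ f {g} {h} f≉0 p = Pℤ.trans
    (PS.solve 2 (λ g h → g PS.:= (g PS.:- h) PS.:+ h) Pℤ.refl g h)
    (Pℤ.trans (Pℤ.+-congʳ (*-integral f (g Pℤ.- h) f≉0 (Pℤ.trans
      (PS.solve 3 (λ f g h → f PS.:* (g PS.:- h) PS.:= f PS.:* g PS.:- f PS.:* h) Pℤ.refl f g h)
      (Pℤ.trans (Pℤ.+-congʳ p) (Pℤ.-‿inverseʳ (pmul f h)))))) (Pℤ.+-identityˡ h))

  pone-nonzero : NonZeroP pone
  pone-nonzero p with p 0
  ... | ()

  -- Transitivity of cross-multiplication cancels the middle denominator, so fractions carry a proof
  -- that theirs is nonzero.
  K° : Set
  K° = Σ K (NonZeroP ∘ proj₂)

  infix 4 _≃K_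
  record _≃K_ (x y : K°) : Set where
    constructor cross-multiply
    field cross : pmul (proj₁ (proj₁ x)) (proj₂ (proj₁ y)) ≃P pmul (proj₁ (proj₁ y)) (proj₂ (proj₁ x))
  open _≃K_ public

  ≃K-trans : ∀ {x y z} → x ≃K y → y ≃K z → x ≃K z
  ≃K-trans {(a , b) , _} {(c , d) , d≉0} {(e , f) , _} p q = cross-multiply (pmul-cancelˡ d d≉0
    (Pℤ.trans (PS.solve 3 (λ a d f → d PS.:* (a PS.:* f) PS.:= a PS.:* d PS.:* f) Pℤ.refl a d f)
    (Pℤ.trans (Pℤ.*-congʳ (cross p))
    (Pℤ.trans (PS.solve 3 (λ c b f → c PS.:* b PS.:* f PS.:= c PS.:* f PS.:* b) Pℤ.refl c b f)
    (Pℤ.trans (Pℤ.*-congʳ (cross q))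
    (PS.solve 3 (λ e d b → e PS.:* d PS.:* b PS.:= d PS.:* (e PS.:* b)) Pℤ.refl e d b))))))

  infixl 6 _+K_
  infixl 7 _*K_
  -- Opaque: unification would otherwise unfold fractions to coefficient lists.
  opaque
    _+K_ _*K_ : K° → K° → K°
    (x , x≉0) +K (y , y≉0) = kadd x y , pmul-nonzero {proj₂ x} {proj₂ y} x≉0 y≉0
    (x , x≉0) *K (y , y≉0) = kmul x y , pmul-nonzero {proj₂ x} {proj₂ y} x≉0 y≉0

    -K_ : K° → K°
    -K (x , x≉0) = kneg x , x≉0

  0K 1K : K°
  0K = k0 , pone-nonzero
  1K = k1 , pone-nonzero

  opaque
    unfolding _+K_ _*K_ -K_

    ℚ[q]-isCommutativeRing : IsCommutativeRing _≃K_ _+K_ _*K_ -K_ 0K 1K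
    ℚ[q]-isCommutativeRing = record
        { isRing = record
          { +-isAbelianGroup = record
            { isGroup = record
              { isMonoid = record
                { isSemigroup = record
                  { isMagma = record
                    { isEquivalence = record
                      { refl = cross-multiply Pℤ.refl
                      ; sym = λ p → cross-multiply (Pℤ.sym (cross p))
                      ; trans = ≃K-trans }
                    ; ∙-cong = λ { {(a , b) , _} {(a′ , b′) , _} {(c , d) , _} {(c′ , d′) , _} p q → cross-multiply
                        (Pℤ.trans (solve 6 (λ a b c d b′ d′ → (a :* d :+ c :* b) :* (b′ :* d′) := a :* b′ :* (d :* d′) :+ c :* d′ :* (b :* b′)) Pℤ.refl a b c d b′ d′)
                        (Pℤ.trans (Pℤ.+-cong (Pℤ.*-congʳ (cross p)) (Pℤ.*-congʳ (cross q)))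
                        (solve 6 (λ a′ b c′ d b′ d′ → a′ :* b :* (d :* d′) :+ c′ :* d :* (b :* b′) := (a′ :* d′ :+ c′ :* b′) :* (b :* d)) Pℤ.refl a′ b c′ d b′ d′))) } }
                  ; assoc = λ { ((a , b) , _) ((c , d) , _) ((e , f) , _) → cross-multiply
                      (solve 6 (λ a b c d e f → ((a :* d :+ c :* b) :* f :+ e :* (b :* d)) :* (b :* (d :* f))
                         := (a :* (d :* f) :+ (c :* f :+ e :* d) :* b) :* (b :* d :* f)) Pℤ.refl a b c d e f) } }
                ; identity = (λ { ((a , b) , _) → cross-multiply (solve 2 (λ a b → (con (+ 0) :* b :+ a :* con (+ 1)) :* b := a :* (con (+ 1) :* b)) Pℤ.refl a b) })
                           , (λ { ((a , b) , _) → cross-multiply (solve 2 (λ a b → (a :* con (+ 1) :+ con (+ 0) :* b) :* b := a :* (b :* con (+ 1))) Pℤ.refl a b) }) }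
              ; inverse = (λ { ((a , b) , _) → cross-multiply (solve 2 (λ a b → ((:- a) :* b :+ a :* b) :* con (+ 1) := con (+ 0) :* (b :* b)) Pℤ.refl a b) })
                        , (λ { ((a , b) , _) → cross-multiply (solve 2 (λ a b → (a :* b :+ (:- a) :* b) :* con (+ 1) := con (+ 0) :* (b :* b)) Pℤ.refl a b) })
              ; ⁻¹-cong = λ { {(a , b) , _} {(c , d) , _} p → cross-multiply
                  (Pℤ.trans (solve 2 (λ a d → (:- a) :* d := :- (a :* d)) Pℤ.refl a d)
                  (Pℤ.trans (Pℤ.-‿cong (cross p)) (solve 2 (λ c b → :- (c :* b) := (:- c) :* b) Pℤ.refl c b))) } }
            ; comm = λ { ((a , b) , _) ((c , d) , _) → cross-multiply
                (solve 4 (λ a b c d → (a :* d :+ c :* b) :* (d :* b) := (c :* b :+ a :* d) :* (b :* d)) Pℤ.refl a b c d) } }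
          ; *-cong = λ { {(a , b) , _} {(a′ , b′) , _} {(c , d) , _} {(c′ , d′) , _} p q → cross-multiply
              (Pℤ.trans (solve 4 (λ a c b′ d′ → a :* c :* (b′ :* d′) := a :* b′ :* (c :* d′)) Pℤ.refl a c b′ d′)
              (Pℤ.trans (Pℤ.*-cong (cross p) (cross q))
              (solve 4 (λ a′ c′ b d → a′ :* b :* (c′ :* d) := a′ :* c′ :* (b :* d)) Pℤ.refl a′ c′ b d))) }
          ; *-assoc = λ { ((a , b) , _) ((c , d) , _) ((e , f) , _) → cross-multiply
              (solve 6 (λ a b c d e f → a :* c :* e :* (b :* (d :* f)) := a :* (c :* e) :* (b :* d :* f)) Pℤ.refl a b c d e f) }
          ; *-identity = (λ { ((a , b) , _) → cross-multiply (solve 2 (λ a b → con (+ 1) :* a :* b := a :* (con (+ 1) :* b)) Pℤ.refl a b) })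
                       , (λ { ((a , b) , _) → cross-multiply (solve 2 (λ a b → a :* con (+ 1) :* b := a :* (b :* con (+ 1))) Pℤ.refl a b) })
          ; distrib = (λ { ((a , b) , _) ((c , d) , _) ((e , f) , _) → cross-multiply
                        (solve 6 (λ a b c d e f → a :* (c :* f :+ e :* d) :* (b :* d :* (b :* f))
                           := (a :* c :* (b :* f) :+ a :* e :* (b :* d)) :* (b :* (d :* f))) Pℤ.refl a b c d e f) })
                    , (λ { ((a , b) , _) ((c , d) , _) ((e , f) , _) → cross-multiply
                        (solve 6 (λ a b c d e f → (c :* f :+ e :* d) :* a :* (d :* b :* (f :* b))
                           := (c :* a :* (f :* b) :+ e :* a :* (d :* b)) :* (d :* f :* b)) Pℤ.refl a b c d e f) }) }
        ; *-comm = λ { ((a , b) , _) ((c , d) , _) → cross-multiply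
            (solve 4 (λ a b c d → a :* c :* (d :* b) := c :* a :* (b :* d)) Pℤ.refl a b c d) } }
      where
      open PS

  ℚ[q] : CommutativeRing 0ℓ 0ℓ
  ℚ[q] = record { isCommutativeRing = ℚ[q]-isCommutativeRing }

-- Plethysm on scalars, and the scalar identities behind the operator

module Scalars where
  open import Defs
  open Fractions

  open CommutativeRing ℚ[q] hiding (zero)
  open import Relation.Binary.Reasoning.Setoid setoid
  open IntegerSolver ℚ[q]
  open Series ℚ[q] using (ν; ν-suc; powers; powers-cong)

  module _ (k : ℕ) where
    private
      Q = ppow pvar k

    psubst-padd : ∀ f g → psubst k (padd f g) ≃P padd (psubst k f) (psubst k g)
    psubst-padd []      g       = Pℤ.refl
    psubst-padd (a ∷ f) []      = Pℤ.sym (Pℤ.+-identityʳ (psubst k (a ∷ f)))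
    psubst-padd (a ∷ f) (b ∷ g) = Pℤ.trans
      (Pℤ.+-congˡ {(a ℤ.+ b) ∷ []} (Pℤ.*-congˡ {Q} (psubst-padd f g)))
      (PS.solve 5 (λ a b Q f g → (a PS.:+ b) PS.:+ Q PS.:* (f PS.:+ g) PS.:= (a PS.:+ Q PS.:* f) PS.:+ (b PS.:+ Q PS.:* g))
         Pℤ.refl (a ∷ []) (b ∷ []) Q (psubst k f) (psubst k g))

    private
      const0 : (+ 0 ∷ []) ≃P []
      const0 = by-image λ { zero → ≡.refl ; (suc _) → ≡.refl }

    psubst-zero : ∀ f → f ≃P [] → psubst k f ≃P []
    psubst-zero []      p = Pℤ.refl
    psubst-zero (a ∷ f) p with image p 0
    ... | ≡.refl = Pℤ.trans (Pℤ.+-cong const0 (Pℤ.*-congˡ {Q} (psubst-zero f (shift-cancel f p))))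
                     (PS.solve 1 (λ Q → PS.con (+ 0) PS.:+ Q PS.:* PS.con (+ 0) PS.:= PS.con (+ 0)) Pℤ.refl Q)

    psubst-cong : ∀ f g → f ≃P g → psubst k f ≃P psubst k g
    psubst-cong []      g       p = Pℤ.sym (psubst-zero g (Pℤ.sym p))
    psubst-cong (a ∷ f) []      p = psubst-zero (a ∷ f) p
    psubst-cong (a ∷ f) (b ∷ g) p with image p 0
    ... | ≡.refl = Pℤ.+-congˡ {a ∷ []} (Pℤ.*-congˡ {Q} (psubst-cong f g (by-image (λ n → image p (suc n)))))

    psubst-pscale : ∀ c f → psubst k (pscale c f) ≃P pmul (c ∷ []) (psubst k f)
    psubst-pscale c []      = Pℤ.sym (Pℤ.zeroʳ (c ∷ []))
    psubst-pscale c (a ∷ f) = Pℤ.trans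
      (Pℤ.+-cong (const-mul c a) (Pℤ.*-congˡ {Q} (psubst-pscale c f)))
      (PS.solve 4 (λ c a Q f → c PS.:* a PS.:+ Q PS.:* (c PS.:* f) PS.:= c PS.:* (a PS.:+ Q PS.:* f))
         Pℤ.refl (c ∷ []) (a ∷ []) Q (psubst k f))
      where
      const-mul : ∀ c a → (c ℤ.* a ∷ []) ≃P pmul (c ∷ []) (a ∷ [])
      const-mul c a = by-image λ { zero → ≡.sym (ℤₚ.+-identityʳ _) ; (suc _) → ≡.refl }

    psubst-pmul : ∀ f g → psubst k (pmul f g) ≃P pmul (psubst k f) (psubst k g)
    psubst-pmul []      g = Pℤ.refl
    psubst-pmul (a ∷ f) g = Pℤ.trans (psubst-padd (pscale a g) (+ 0 ∷ pmul f g))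
      (Pℤ.trans (Pℤ.+-cong (psubst-pscale a g) (Pℤ.+-cong const0 (Pℤ.*-congˡ {Q} (psubst-pmul f g))))
      (PS.solve 4 (λ a Q f g → a PS.:* g PS.:+ (PS.con (+ 0) PS.:+ Q PS.:* (f PS.:* g)) PS.:= (a PS.:+ Q PS.:* f) PS.:* g)
         Pℤ.refl (a ∷ []) Q (psubst k f) (psubst k g)))

    psubst-pone : psubst k pone ≃P pone
    psubst-pone = Pℤ.trans (Pℤ.+-congˡ {pone} (Pℤ.zeroʳ Q)) (Pℤ.+-identityʳ pone)

    psubst-pvar : psubst k pvar ≃P Q
    psubst-pvar = Pℤ.trans (Pℤ.+-cong const0 (Pℤ.*-congˡ {Q} psubst-pone))
      (PS.solve 1 (λ Q → PS.con (+ 0) PS.:+ Q PS.:* PS.con (+ 1) PS.:= Q) Pℤ.refl Q)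

  pvar-nonzero : NonZeroP pvar
  pvar-nonzero p with p 1
  ... | ()

  ppow-nonzero : ∀ n → NonZeroP (ppow pvar n)
  ppow-nonzero zero    = pone-nonzero
  ppow-nonzero (suc n) = pmul-nonzero {pvar} {ppow pvar n} pvar-nonzero (ppow-nonzero n)

  -- For a positive exponent k + 1, f and f(q^{k+1}) have the same constant term, and the rest
  -- carries a factor q^{k+1} that can be cancelled. This keeps denominators nonzero under plethysm;
  -- exponent 0 would evaluate at q = 1.
  psubst-injective : ∀ k f → psubst (suc k) f ≃P [] → f ≃P []
  psubst-injective k []      p = Pℤ.refl
  psubst-injective k (a ∷ f) p with constant
    where
    Z = pmul (ppow pvar k) (psubst (suc k) f)
    constant : a ≡ + 0
    constant = ≡.trans (≡.sym (ℤₚ.+-identityʳ a)) (≡.trans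
      (≡.cong (λ t → a ℤ.+ t) (≡.sym (≡.trans (image (Pℤ.*-assoc pvar (ppow pvar k) (psubst (suc k) f)) 0) (coeffP-pmul pvar Z 0))))
      (≡.trans (≡.sym (coeffP-padd (a ∷ []) (pmul (ppow pvar (suc k)) (psubst (suc k) f)) 0)) (image p 0)))
  ... | ≡.refl = by-image λ { zero → ≡.refl ; (suc n) → image (psubst-injective k f rest) n }
    where
    rest : psubst (suc k) f ≃P []
    rest = *-integral (ppow pvar (suc k)) (psubst (suc k) f) (ppow-nonzero (suc k))
      (Pℤ.trans (by-image (λ { zero → ≡.sym (≡.trans (coeffP-padd (+ 0 ∷ []) X 0) (ℤₚ.+-identityˡ _))
                             ; (suc n) → ≡.sym (≡.trans (coeffP-padd (+ 0 ∷ []) X (suc n)) (ℤₚ.+-identityˡ _)) })) p)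
      where X = pmul (ppow pvar (suc k)) (psubst (suc k) f)

  psubst-nonzero : ∀ k {f} → NonZeroP f → NonZeroP (psubst (suc k) f)
  psubst-nonzero k {f} f≉0 p = f≉0 (image (psubst-injective k f (by-image p)))

  -- The plethysm p_{i+1} on scalars.
  π : ℕ → K° → K°
  π i (c , c≉0) = kpk (suc i) c , psubst-nonzero i {proj₂ c} c≉0

  opaque
    unfolding _+K_ _*K_ -K_

    π-cong : ∀ i {x y} → x ≈ y → π i x ≈ π i y
    π-cong i {(a , b) , _} {(c , d) , _} p = cross-multiply
      (Pℤ.trans (Pℤ.sym (psubst-pmul (suc i) a d)) (Pℤ.trans (psubst-cong (suc i) (pmul a d) (pmul c b) (cross p)) (psubst-pmul (suc i) c b)))

    π-+ : ∀ i x y → π i (x + y) ≈ π i x + π i y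
    π-+ i ((a , b) , _) ((c , d) , _) = cross-multiply (Pℤ.*-cong
      (Pℤ.trans (psubst-padd (suc i) (pmul a d) (pmul c b)) (Pℤ.+-cong (psubst-pmul (suc i) a d) (psubst-pmul (suc i) c b)))
      (Pℤ.sym (psubst-pmul (suc i) b d)))

    π-* : ∀ i x y → π i (x * y) ≈ π i x * π i y
    π-* i ((a , b) , _) ((c , d) , _) = cross-multiply (Pℤ.*-cong (psubst-pmul (suc i) a c) (Pℤ.sym (psubst-pmul (suc i) b d)))

    π-1 : ∀ i → π i 1# ≈ 1#
    π-1 i = cross-multiply (Pℤ.*-cong (psubst-pone (suc i)) (Pℤ.sym (psubst-pone (suc i))))

    π-neg : ∀ i x → π i (- x) ≈ - π i x
    π-neg i ((a , b) , _) = cross-multiply (Pℤ.*-congʳ {psubst (suc i) b} (Pℤ.trans (psubst-pscale (suc i) (ℤ.- (+ 1)) a)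
      (Pℤ.trans (Pℤ.*-congʳ {psubst (suc i) a} {(ℤ.- (+ 1)) ∷ []} {Pℤ.- pone} (by-image λ { zero → ≡.refl ; (suc _) → ≡.refl }))
        (PS.solve 1 (λ a → (PS.:- PS.con (+ 1)) PS.:* a PS.:= PS.:- a) Pℤ.refl (psubst (suc i) a)))))

  infix 4 _⊩_
  -- A raw fraction with nonzero denominator on the left, its value on the right: raw operations are
  -- followed on the left, identities are proved on the right, and `⊩-≈K` returns to `_≈K_`.
  _⊩_ : K → K° → Set
  c ⊩ x = Σ (NonZeroP (proj₂ c)) λ c≉0 → (c , c≉0) ≈ x

  ⊩-cong : ∀ {c x y} → c ⊩ x → x ≈ y → c ⊩ y
  ⊩-cong (c≉0 , p) q = c≉0 , trans p q

  ⊩-≈K : ∀ {c d x y} → c ⊩ x → d ⊩ y → x ≈ y → c ≈K d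
  ⊩-≈K (c≉0 , p) (d≉0 , q) r = c≉0 , d≉0 , image (cross (trans p (trans r (sym q))))

  opaque
    unfolding _+K_ _*K_ -K_

    ⊩-add : ∀ {c d x y} → c ⊩ x → d ⊩ y → kadd c d ⊩ x + y
    ⊩-add {c} {d} (c≉0 , p) (d≉0 , q) = proj₂ ((c , c≉0) + (d , d≉0)) , +-cong p q

    ⊩-mul : ∀ {c d x y} → c ⊩ x → d ⊩ y → kmul c d ⊩ x * y
    ⊩-mul {c} {d} (c≉0 , p) (d≉0 , q) = proj₂ ((c , c≉0) * (d , d≉0)) , *-cong p q

    ⊩-neg : ∀ {c x} → c ⊩ x → kneg c ⊩ - x
    ⊩-neg (c≉0 , p) = c≉0 , -‿cong p

    ⊩-sub : ∀ {c d x y} → c ⊩ x → d ⊩ y → ksub c d ⊩ x - y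
    ⊩-sub {c} {d} p q = ⊩-add {c} {kneg d} p (⊩-neg {d} q)

    ⊩-self : ∀ (x : K°) → proj₁ x ⊩ x
    ⊩-self (c , c≉0) = c≉0 , refl

    ⊩-kpk : ∀ i {c x} → c ⊩ x → kpk (suc i) c ⊩ π i x
    ⊩-kpk i {c} (c≉0 , p) = psubst-nonzero i {proj₂ c} c≉0 , π-cong i p

  fraction : ∀ {c d} → NonZeroP (proj₂ c) → NonZeroP (proj₁ d) → K°
  fraction {c} {d} c≉0 n≉0 = kdiv c d , pmul-nonzero {proj₂ c} {proj₁ d} c≉0 n≉0

  opaque
    unfolding _+K_ _*K_ -K_

    numerator-nonzero : ∀ {c c≉0 z} → (c , c≉0) * z ≈ 1# → NonZeroP (proj₁ c)
    numerator-nonzero {a , b} {b≉0} {(c , d) , d≉0} p a≈0 = pmul-nonzero {b} {d} b≉0 d≉0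
      (image (Pℤ.trans (Pℤ.sym (Pℤ.*-identityˡ (pmul b d))) (Pℤ.trans (Pℤ.sym (cross p))
        (Pℤ.*-congʳ {pone} (Pℤ.*-congʳ {c} {a} {[]} (by-image a≈0))))))

    fraction-cancel : ∀ {c d} c≉0 n≉0 d≉0 → fraction {c} {d} c≉0 n≉0 * (d , d≉0) ≈ (c , c≉0)
    fraction-cancel {a , b} {c , d} _ _ _ = cross-multiply
      (PS.solve 4 (λ a b c d → a PS.:* d PS.:* c PS.:* b PS.:= a PS.:* (b PS.:* c PS.:* d)) Pℤ.refl a b c d)

  -- An explicit inverse z of the divisor both names the value of the quotient and shows that the
  -- numerator of d, which enters the new denominator, is nonzero.
  ⊩-div : ∀ {c d x y z} → c ⊩ x → d ⊩ y → y * z ≈ 1# → kdiv c d ⊩ x * z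
  ⊩-div {c} {d} {x} {y} {z} (c≉0 , p) (d≉0 , r) yz = proj₂ quotient , (begin
      quotient                     ≈⟨ *-identityʳ quotient ⟨
      quotient * 1#                ≈⟨ *-congˡ {quotient} yz′ ⟨
      quotient * ((d , d≉0) * z)   ≈⟨ *-assoc quotient (d , d≉0) z ⟨
      quotient * (d , d≉0) * z     ≈⟨ *-congʳ {z} (trans (fraction-cancel c≉0 n≉0 d≉0) p) ⟩
      x * z                        ∎)
    where
    yz′ : (d , d≉0) * z ≈ 1#
    yz′ = trans (*-congʳ r) yz
    n≉0 : NonZeroP (proj₁ d)
    n≉0 = numerator-nonzero yz′
    quotient : K°
    quotient = fraction {c} {d} c≉0 n≉0

  opaque
    unfolding _+K_ _*K_ -K_

    kconst-neg1 : kconstℤ (ℤ.- (+ 1)) ⊩ - 1#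
    kconst-neg1 = pone-nonzero , cross-multiply Pℤ.refl

    kconst-ν : ∀ n → kconstℤ (+ n) ⊩ ν n
    kconst-ν n = pone-nonzero , go n
      where
      go : ∀ n → (kconstℤ (+ n) , pone-nonzero) ≈ ν n
      go zero    = cross-multiply (by-image λ { zero → ≡.refl ; (suc _) → ≡.refl })
      go (suc n) = trans (cross-multiply (Pℤ.trans (Pℤ.*-congʳ {pmul pone pone} {(+ suc n) ∷ []} {padd pone ((+ n) ∷ [])} Pℤ.refl)
        (PS.solve 1 (λ n → (PS.con (+ 1) PS.:+ n) PS.:* (PS.con (+ 1) PS.:* PS.con (+ 1))
            PS.:= (PS.con (+ 1) PS.:* PS.con (+ 1) PS.:+ n PS.:* PS.con (+ 1)) PS.:* PS.con (+ 1)) Pℤ.refl ((+ n) ∷ []))))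
        (trans (+-congˡ {1#} (go n)) (sym (ν-suc n)))

  inv : ℕ → K°
  inv i = (pone , (+ suc i) ∷ []) , λ p → contradiction (p 0) (λ ())

  opaque
    unfolding _+K_ _*K_ -K_

    inv-ν : ∀ i → ν (suc i) * inv i ≈ 1#
    inv-ν i = trans (*-congʳ {inv i} (sym (proj₂ (kconst-ν (suc i))))) (cross-multiply
      (PS.solve 1 (λ n → n PS.:* PS.con (+ 1) PS.:* PS.con (+ 1) PS.:= PS.con (+ 1) PS.:* (PS.con (+ 1) PS.:* n)) Pℤ.refl ((+ suc i) ∷ [])))

  -- `θ` is t = 1/q and will be the constant s of `EigenData`; `b` is the factor 1/(1 - q) of the
  -- plethysm X ↦ X/(1 - q).
  q θ b : K°
  q = kq , pone-nonzero
  θ = (pone , pvar) , pvar-nonzero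
  b = (pone , padd pone (pneg pvar)) , λ p → contradiction (p 0) (λ ())

  opaque
    unfolding _+K_ _*K_ -K_

    θq : θ * q ≈ 1#
    θq = cross-multiply (PS.solve 1 (λ q → PS.con (+ 1) PS.:* q PS.:* PS.con (+ 1) PS.:= PS.con (+ 1) PS.:* (q PS.:* PS.con (+ 1))) Pℤ.refl pvar)

    1-q-b : (1# - q) * b ≈ 1#
    1-q-b = cross-multiply (PS.solve 1 (λ q → (PS.con (+ 1) PS.:* PS.con (+ 1) PS.:+ (PS.:- q) PS.:* PS.con (+ 1)) PS.:* PS.con (+ 1) PS.:* PS.con (+ 1)
       PS.:= PS.con (+ 1) PS.:* (PS.con (+ 1) PS.:* PS.con (+ 1) PS.:* (PS.con (+ 1) PS.:- q))) Pℤ.refl pvar)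

  powers-* : ∀ x y n → powers (x * y) n ≈ powers x n * powers y n
  powers-* x y zero    = sym (*-identityˡ _)
  powers-* x y (suc n) = trans (*-congˡ (powers-* x y n))
    (solve 4 (λ x y p q → x :* y :* (p :* q) := x :* p :* (y :* q)) refl x y _ _)

  powers-1 : ∀ n → powers 1# n ≈ 1#
  powers-1 zero    = refl
  powers-1 (suc n) = trans (*-identityˡ _) (powers-1 n)

  powers-swap : ∀ x k n → powers (powers x k) n ≈ powers (powers x n) k
  powers-swap x zero    n = powers-1 n
  powers-swap x (suc k) n = trans (powers-* x (powers x k) n) (*-congˡ (powers-swap x k n))

  powers-inverse : ∀ {x y} n → x * y ≈ 1# → powers x n * powers y n ≈ 1#
  powers-inverse {x} {y} n p = trans (sym (powers-* x y n)) (trans (powers-cong n p) (powers-1 n))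

  inverse-unique : ∀ {x y z} → x * y ≈ 1# → z * y ≈ 1# → x ≈ z
  inverse-unique {x} {y} {z} p r = begin
    x             ≈⟨ *-identityʳ x ⟨
    x * 1#        ≈⟨ *-congˡ r ⟨
    x * (z * y)   ≈⟨ solve 3 (λ x y z → x :* (z :* y) := x :* y :* z) refl x y z ⟩
    x * y * z     ≈⟨ trans (*-congʳ p) (*-identityˡ z) ⟩
    z             ∎

  opaque
    unfolding _+K_ _*K_ -K_

    ppow-powers : ∀ n → (ppow pvar n , pone) ⊩ powers q n
    ppow-powers n = pone-nonzero , go n
      where
      go : ∀ n → ((ppow pvar n , pone) , pone-nonzero) ≈ powers q n
      go zero    = refl
      go (suc n) = trans (cross-multiply (PS.solve 2 (λ q p → q PS.:* p PS.:* (PS.con (+ 1) PS.:* PS.con (+ 1)) PS.:= q PS.:* p PS.:* PS.con (+ 1))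
                            Pℤ.refl pvar (ppow pvar n))) (*-congˡ {q} (go n))

  opaque
    unfolding _+K_ _*K_ -K_

    qpow-inverse : ∀ n {nz} → _*_ ((pone , ppow pvar n) , nz) ((ppow pvar n , pone) , pone-nonzero) ≈ 1#
    qpow-inverse n = cross-multiply (PS.solve 1 (λ p → PS.con (+ 1) PS.:* p PS.:* PS.con (+ 1) PS.:= PS.con (+ 1) PS.:* (p PS.:* PS.con (+ 1))) Pℤ.refl (ppow pvar n))

  qpow-neg : ∀ n → qpow (ℤ.- (+ n)) ⊩ powers θ n
  qpow-neg zero    = ⊩-self 1#
  qpow-neg (suc n) = ppow-nonzero (suc n) , inverse-unique
    (trans (*-congˡ (sym (proj₂ (ppow-powers (suc n))))) (qpow-inverse (suc n)))
    (powers-inverse (suc n) θq)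

  module _ (i : ℕ) where

    π-q : π i q ≈ powers q (suc i)
    π-q = trans (cross-multiply (Pℤ.*-cong (psubst-pvar (suc i)) (Pℤ.sym (psubst-pone (suc i))))) (proj₂ (ppow-powers (suc i)))

    π-θ : π i θ ≈ powers θ (suc i)
    π-θ = inverse-unique (trans (*-congˡ (sym π-q)) (trans (sym (π-* i θ q)) (trans (π-cong i θq) (π-1 i))))
                         (powers-inverse (suc i) θq)

    π-powers : ∀ x n → π i (powers x n) ≈ powers (π i x) n
    π-powers x zero    = π-1 i
    π-powers x (suc n) = trans (π-* i x (powers x n)) (*-congˡ (π-powers x n))

  geo : K° → ℕ → K°
  geo x zero    = 0#
  geo x (suc n) = 1# + x * geo x n

  ⊩-geo : ∀ {c x} n → c ⊩ x → geomK c n ⊩ geo x n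
  ⊩-geo zero    p = ⊩-self 0#
  ⊩-geo {c} (suc n) p = ⊩-add {k1} (⊩-self 1#) (⊩-mul {c} p (⊩-geo {c} n p))

  bμ : List ℕ → K° → K° → K°
  bμ []      x y = 0#
  bμ (m ∷ μ) x y = geo x m + y * bμ μ x y

  ⊩-bμ : ∀ {c d x y} μ → c ⊩ x → d ⊩ y → Bμ μ c d ⊩ bμ μ x y
  ⊩-bμ []      p r = ⊩-self 0#
  ⊩-bμ {c} {d} (m ∷ μ) p r = ⊩-add {geomK c m} (⊩-geo {c} m p) (⊩-mul {d} r (⊩-bμ {c} {d} μ p r))

  -- For u = + n, ε is M[u]_q and τ is [u]_t.
  module _ (n : ℕ) where

    α α⁻¹ ε τ : K°
    α   = powers q n
    α⁻¹ = powers θ n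
    ε   = (1# - θ) * (1# - q) * ((1# - α) * b)
    τ   = (1# - α⁻¹) * (- (q * b))

    α⁻¹-inverse : α⁻¹ * α ≈ 1#
    α⁻¹-inverse = powers-inverse n θq

    private
      1-q⊩ : ksub k1 kq ⊩ 1# - q
      1-q⊩ = ⊩-sub {k1} {kq} (⊩-self 1#) (⊩-self q)

      kt⊩ : kt ⊩ θ
      kt⊩ = ⊩-cong {kt} (qpow-neg 1) (*-identityʳ θ)

    ⊩-ε : kmul kM (qint (+ n)) ⊩ ε
    ⊩-ε = ⊩-mul {kM} (⊩-mul {ksub k1 kt} (⊩-sub {k1} {kt} (⊩-self 1#) kt⊩) 1-q⊩)
      (⊩-div {ksub k1 (qpow (+ n))} {ksub k1 kq} (⊩-sub {k1} {qpow (+ n)} (⊩-self 1#) (ppow-powers n)) 1-q⊩ 1-q-b)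

    -- The second factor of `τ` is the inverse of 1 - 1/q, namely -q/(1 - q).
    ⊩-τ : tint (+ n) ⊩ τ
    ⊩-τ = ⊩-div {ksub k1 (qpow (ℤ.- (+ n)))} {ksub k1 kt} (⊩-sub {k1} {qpow (ℤ.- (+ n))} (⊩-self 1#) (qpow-neg n)) (⊩-sub {k1} {kt} (⊩-self 1#) kt⊩) (begin
      (1# - θ) * - (q * b)   ≈⟨ solve 3 (λ θ q b → (con (+ 1) :- θ) :* :- (q :* b) := (θ :* q :- con (+ 1)) :* b :+ (con (+ 1) :- q) :* b) refl θ q b ⟩
      (θ * q - 1#) * b + (1# - q) * b ≈⟨ +-cong (trans (*-congʳ (trans (+-congʳ θq) (-‿inverseʳ 1#))) (zeroˡ b)) 1-q-b ⟩
      0# + 1# ≈⟨ +-identityˡ 1# ⟩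
      1# ∎)

    ⊩-b : kdiv k1 (ksub k1 kq) ⊩ b
    ⊩-b = ⊩-cong {kdiv k1 (ksub k1 kq)} (⊩-div {k1} {ksub k1 kq} (⊩-self 1#) 1-q⊩ 1-q-b) (*-identityˡ b)

    -- M[u]_q/(1 - q) = (a - 1)/q, because (1 - 1/q)/(1 - q) = -1/q. The term 1/q stands on the left
    -- so that p_k turns the equation into `Q-def`.
    b-ε : b * ε + θ ≈ α * θ
    b-ε = begin
      b * ((1# - θ) * (1# - q) * ((1# - α) * b)) + θ
        ≈⟨ solve 5 (λ b t q r a → b :* ((con (+ 1) :- t) :* q :* ((con (+ 1) :- a) :* b)) :+ t
              := (q :* b) :* (((con (+ 1) :- t) :* b) :* (con (+ 1) :- a)) :+ t) refl b θ (1# - q) q α ⟩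
      ((1# - q) * b) * (((1# - θ) * b) * (1# - α)) + θ
        ≈⟨ +-congʳ (*-cong 1-q-b (*-congʳ 1-θ-b)) ⟩
      1# * (- θ * (1# - α)) + θ
        ≈⟨ solve 2 (λ t a → con (+ 1) :* ((:- t) :* (con (+ 1) :- a)) :+ t := a :* t) refl θ α ⟩
      α * θ ∎
      where
      1-θ-b : (1# - θ) * b ≈ - θ
      1-θ-b = begin
        (1# - θ) * b
          ≈⟨ solve 3 (λ t q b → (con (+ 1) :- t) :* b := (con (+ 1) :- t :* q) :* b :+ (:- t) :* ((con (+ 1) :- q) :* b)) refl θ q b ⟩
        (1# - θ * q) * b + - θ * ((1# - q) * b)
          ≈⟨ +-cong (trans (*-congʳ (trans (+-congˡ (-‿cong θq)) (-‿inverseʳ 1#))) (zeroˡ b)) (*-congˡ 1-q-b) ⟩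
        0# + - θ * 1#
          ≈⟨ trans (+-identityˡ _) (*-identityʳ _) ⟩
        - θ ∎

    -- -[u]_t/q = (1 - 1/a)/(1 - q), multiplied by a to clear 1/a; p_k turns it into `ŷ-def`.
    b-τ : α * (θ * - τ) + b ≈ α * b
    b-τ = begin
      α * (θ * - ((1# - α⁻¹) * - (q * b))) + b
        ≈⟨ solve 5 (λ a t i q b → a :* (t :* :- ((con (+ 1) :- i) :* :- (q :* b))) :+ b
             := (t :* q) :* ((a :- i :* a) :* b) :+ b) refl α θ α⁻¹ q b ⟩
      (θ * q) * ((α - α⁻¹ * α) * b) + b
        ≈⟨ +-congʳ (*-cong θq (*-congʳ (+-congˡ (-‿cong α⁻¹-inverse)))) ⟩
      1# * ((α - 1#) * b) + b
        ≈⟨ solve 2 (λ a b → con (+ 1) :* ((a :- con (+ 1)) :* b) :+ b := a :* b) refl α b ⟩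
      α * b ∎

    π-α : ∀ i → π i α ≈ powers α (suc i)
    π-α i = trans (π-powers i q n) (trans (powers-cong n (π-q i)) (powers-swap q (suc i) n))

    π-b-ε : ∀ i → π i b * π i ε + powers θ (suc i) ≈ powers (α * θ) (suc i)
    π-b-ε i = begin
      π i b * π i ε + powers θ (suc i)
        ≈⟨ +-cong (π-* i b ε) (π-θ i) ⟨
      π i (b * ε) + π i θ
        ≈⟨ trans (π-cong i (sym b-ε)) (π-+ i (b * ε) θ) ⟨
      π i (α * θ)
        ≈⟨ trans (π-* i α θ) (*-cong (π-α i) (π-θ i)) ⟩
      powers α (suc i) * powers θ (suc i)
        ≈⟨ powers-* α θ (suc i) ⟨
      powers (α * θ) (suc i) ∎

    π-b-τ : ∀ i → powers α (suc i) * (powers θ (suc i) * - π i τ) + π i b ≈ powers α (suc i) * π i b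
    π-b-τ i = begin
      powers α (suc i) * (powers θ (suc i) * - π i τ) + π i b
        ≈⟨ +-congʳ (*-cong (π-α i) (*-cong (π-θ i) (π-neg i τ))) ⟨
      π i α * (π i θ * π i (- τ)) + π i b
        ≈⟨ +-congʳ (trans (π-* i α (θ * - τ)) (*-congˡ (π-* i θ (- τ)))) ⟨
      π i (α * (θ * - τ)) + π i b
        ≈⟨ π-+ i (α * (θ * - τ)) b ⟨
      π i (α * (θ * - τ) + b)
        ≈⟨ trans (π-cong i b-τ) (π-* i α b) ⟩
      π i α * π i b
        ≈⟨ *-congʳ (π-α i) ⟩
      powers α (suc i) * π i b ∎

-- Raw symmetric functions and the ring elements they represent

module Realization where
  open import Data.List.Relation.Binary.Pointwise as Pointwise using (Pointwise; []; _∷_)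
  open import Data.List.Relation.Unary.Linked using ([]; [-])
  open import Data.Product using (_×_)
  open import Data.Bool using (if_then_else_)
  open import Relation.Nullary.Decidable using (⌊_⌋)
  open import Defs hiding (Λ)
  open import Defs using () renaming (Λ to SymF)
  open Monomials
  open Fractions using (K°; ℚ[q])
  open Scalars

  module 𝕂 = CommutativeRing ℚ[q]
  open PowerSumAlgebra ℚ[q]
  module Λ = CommutativeRing monAlg
  open Series monAlg
  open PolyRing monAlg using (Pol; coeff; const; polRing; module P; by-image; image; coeff-⊕; coeff-⊗; coeff-one; coeff-const-⊗)

  -- Besides relating the coefficients, this forces ν to be weakly decreasing with positive parts,
  -- so that p_0 never meets a plethysm.
  TermRealizes : K × List ℕ → K° × Monomial → Set
  TermRealizes (c , ν) (x , m) = c ⊩ x × ν ≡ map suc (proj₁ m)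

  Realizes : SymF → Λ° → Set
  Realizes = Pointwise TermRealizes

  infix 4 _⊩Λ_ _⊩S_
  -- Two stages: F° mirrors the raw list term by term, and may then be replaced by any equal element
  -- of the algebra.
  _⊩Λ_ : SymF → Λ° → Set
  F ⊩Λ x = ∃ λ F° → Realizes F F° × F° ≃ x

  ⊩Λ-cong : ∀ {F x y} → F ⊩Λ x → x ≃ y → F ⊩Λ y
  ⊩Λ-cong (F° , r , p) q = F° , r , ≃-trans p q

  ⊩Λ-0 : Λ0 ⊩Λ []
  ⊩Λ-0 = [] , [] , ≃-refl

  ⊩Λ-0-inv : ∀ {x} → Λ0 ⊩Λ x → x ≃ []
  ⊩Λ-0-inv ([] , [] , p) = ≃-sym p

  ⊩Λ-1 : Λ1 ⊩Λ κ 𝕂.1#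
  ⊩Λ-1 = κ 𝕂.1# , (⊩-self 𝕂.1# , ≡.refl) ∷ [] , ≃-refl

  ⊩Λ-pΛ : ∀ i → pΛ (suc i) ⊩Λ powerSum i
  ⊩Λ-pΛ i = powerSum i , (⊩-self 𝕂.1# , ≡.refl) ∷ [] , ≃-refl

  ⊩Λ-add : ∀ {F G x y} → F ⊩Λ x → G ⊩Λ y → Λadd F G ⊩Λ x ⊕ y
  ⊩Λ-add (F° , r , p) (G° , s , q) = F° ⊕ G° , Pointwise.++⁺ r s , ⊕-cong p q

  ⊩Λ-scale : ∀ {c x F y} → c ⊩ x → F ⊩Λ y → Λscale c F ⊩Λ κ x ⊗ y
  ⊩Λ-scale {c} {x} u (F° , r , p) = scale x F° , go r , ≃-trans (scale-κ x F°) (⊗-cong (≃-refl {κ x}) p)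
    where
    go : ∀ {F F°} → Realizes F F° → Realizes (Λscale c F) (scale x F°)
    go []                               = []
    go {(d , _) ∷ _} ((v , ν≡) ∷ r) = (⊩-mul {c} {d} u v , ν≡) ∷ go r

  ⊩Λ-mul : ∀ {F G x y} → F ⊩Λ x → G ⊩Λ y → Λmul F G ⊩Λ x ⊗ y
  ⊩Λ-mul {F} {G} (F° , r , p) (G° , s , q) = F° ⊗ G° , rows r , ⊗-cong p q
    where
    term : ∀ {t t° G G°} → TermRealizes t t° → Realizes G G° →
      Realizes (map (λ t′ → kmul (proj₁ t) (proj₁ t′) , mergePart (proj₂ t) (proj₂ t′)) G) (map (termMul t°) G°)
    term _ [] = []
    term {c , _} {x , m} {(d , _) ∷ _} {(y , n) ∷ _} (u , ≡.refl) ((v , ≡.refl) ∷ s) =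
      (⊩-mul {c} {d} u v , mergePart-suc (proj₁ m) (proj₁ n)) ∷ term {c , map suc (proj₁ m)} {x , m} (u , ≡.refl) s
    rows : ∀ {F F°} → Realizes F F° → Realizes (Λmul F G) (F° ⊗ G°)
    rows []                        = []
    rows {t ∷ _} {t° ∷ _} (u ∷ r) = Pointwise.++⁺ (term {t} {t°} u s) (rows r)

  indicator : List ℕ → List ℕ → K°
  indicator λ₁ ν = if ⌊ Listₚ.≡-dec ℕ._≟_ (map suc ν) λ₁ ⌋ then 𝕂.1# else 𝕂.0#

  -- Extraction of a coefficient is one of the functionals, hence equality in the algebra yields
  -- `_≈Λ_`.
  ⊩-coeffΛ : ∀ {F F°} λ₁ → Realizes F F° → coeffΛ F λ₁ ⊩ ⟨ F° , indicator λ₁ ⟩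
  ⊩-coeffΛ λ₁ [] = ⊩-self 𝕂.0#
  ⊩-coeffΛ {(c , ν) ∷ F} {(x , m) ∷ F°} λ₁ ((u , ≡.refl) ∷ r) with Listₚ.≡-dec ℕ._≟_ (map suc (proj₁ m)) λ₁
  ... | yes _ = ⊩-cong {kadd c (coeffΛ F λ₁)} (⊩-add {c} {coeffΛ F λ₁} u (⊩-coeffΛ λ₁ r)) (𝕂.+-congʳ (𝕂.sym (𝕂.*-identityʳ x)))
  ... | no  _ = ⊩-cong {coeffΛ F λ₁} (⊩-coeffΛ λ₁ r) (𝕂.sym (𝕂.trans (𝕂.+-congʳ (𝕂.zeroʳ x)) (𝕂.+-identityˡ _)))

  ⊩Λ-≈Λ : ∀ {F G x y} → F ⊩Λ x → G ⊩Λ y → x ≃ y → F ≈Λ G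
  ⊩Λ-≈Λ {F} {G} (F° , r , p) (G° , s , q) e λ₁ =
    ⊩-≈K {coeffΛ F λ₁} {coeffΛ G λ₁} (⊩-coeffΛ λ₁ r) (⊩-coeffΛ λ₁ s)
      (functional (≃-trans p (≃-trans e (≃-sym q))) (indicator λ₁))

  _⊩S_ : ΛPoly → Ser → Set
  f ⊩S s = ∀ n → wcoeff f n ⊩Λ s n

  ⊩S-cong : ∀ f {s t} → f ⊩S s → s ≋ t → f ⊩S t
  ⊩S-cong f r p n = ⊩Λ-cong (r n) (p n)

  ⊩S-[] : [] ⊩S (λ _ → [])
  ⊩S-[] n = ⊩Λ-0

  ⊩S-add : ∀ f g {s t} → f ⊩S s → g ⊩S t → wadd f g ⊩S s ⊞ t
  ⊩S-add []      g       r r′ n       = ⊩Λ-cong (r′ n) (Λ.sym (Λ.trans (Λ.+-congʳ (⊩Λ-0-inv (r n))) ≃-refl))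
  ⊩S-add (a ∷ f) []      r r′ n       = ⊩Λ-cong (r n) (Λ.sym (Λ.trans (Λ.+-congˡ (⊩Λ-0-inv (r′ n))) (Λ.+-identityʳ _)))
  ⊩S-add (a ∷ f) (b ∷ g) r r′ zero    = ⊩Λ-add (r 0) (r′ 0)
  ⊩S-add (a ∷ f) (b ∷ g) r r′ (suc n) = ⊩S-add f g (r ∘ suc) (r′ ∘ suc) n

  -- The condition on zero is for degrees past the end of the list.
  ⊩S-map : ∀ (φ : SymF → SymF) (ψ : Λ° → Λ°) → (∀ {F x} → F ⊩Λ x → φ F ⊩Λ ψ x) → (∀ {x} → x ≃ [] → ψ x ≃ []) →
    ∀ f {s} → f ⊩S s → map φ f ⊩S ψ ∘ s
  ⊩S-map φ ψ p z []      r n       = ⊩Λ-cong ⊩Λ-0 (≃-sym (z (⊩Λ-0-inv (r n))))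
  ⊩S-map φ ψ p z (a ∷ f) r zero    = p (r 0)
  ⊩S-map φ ψ p z (a ∷ f) r (suc n) = ⊩S-map φ ψ p z f (r ∘ suc) n

  ⊩S-mul : ∀ f g {s t} → f ⊩S s → g ⊩S t → wmul f g ⊩S s ⊛ t
  ⊩S-mul []      g {s} {t} r r′ n = ⊩Λ-cong ⊩Λ-0 (≃-sym (⊛-zeroˡ s t (λ i → ⊩Λ-0-inv (r i)) n))
  ⊩S-mul (a ∷ f) g {s} {t} r r′ = ⊩S-cong (wmul (a ∷ f) g)
    (⊩S-add (map (Λmul a) g) (Λ0 ∷ wmul f g) {t = λ { zero → [] ; (suc n) → ((s ∘ suc) ⊛ t) n }}
      (⊩S-map (Λmul a) (s 0 ⊗_) (λ {F} u → ⊩Λ-mul {a} {F} (r 0) u) (λ e → Λ.trans (⊗-cong (≃-refl {s 0}) e) (Λ.zeroʳ (s 0))) g r′)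
      (λ { zero → ⊩Λ-0 ; (suc n) → ⊩S-mul f g (r ∘ suc) r′ n }))
    (λ { zero → Λ.+-identityʳ (s 0 ⊗ t 0) ; (suc n) → ≃-refl })

  ⊩S-scale : ∀ {c x} f {s} → c ⊩ x → f ⊩S s → wscale c f ⊩S (λ n → κ x ⊗ s n)
  ⊩S-scale {c} {x} f u = ⊩S-map (Λscale c) (κ x ⊗_) (λ {F} → ⊩Λ-scale {c} {x} {F} u)
    (λ e → Λ.trans (⊗-cong (≃-refl {κ x}) e) (Λ.zeroʳ (κ x))) f

  monomialSeries : ℕ → Λ° → Ser
  monomialSeries zero    x zero    = x
  monomialSeries zero    x (suc n) = []
  monomialSeries (suc k) x zero    = []
  monomialSeries (suc k) x (suc n) = monomialSeries k x n

  ⊩S-mono : ∀ k {F x} → F ⊩Λ x → wmono k F ⊩S monomialSeries k x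
  ⊩S-mono zero    r zero    = r
  ⊩S-mono zero    r (suc n) = ⊩Λ-0
  ⊩S-mono (suc k) r zero    = ⊩Λ-0
  ⊩S-mono (suc k) r (suc n) = ⊩S-mono k r n

  ⊩S-one : (Λ1 ∷ []) ⊩S one
  ⊩S-one zero    = ⊩Λ-1
  ⊩S-one (suc n) = ⊩Λ-0

  module EvalΛ = Eval selfSeparated

  module _ (P : ℕ → SymF) (P° : ℕ → Λ°) (P⊩ : ∀ i → P (suc i) ⊩Λ P° i) where
    open EvalΛ P°

    ⊩Λ-evalMonomial : ∀ ν → foldr (λ k acc → Λmul (P k) acc) Λ1 (map suc ν) ⊩Λ evalMonomial ν
    ⊩Λ-evalMonomial []      = ⊩Λ-1
    ⊩Λ-evalMonomial (k ∷ ν) = ⊩Λ-mul {P (suc k)} (P⊩ k) (⊩Λ-evalMonomial ν)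

    ⊩Λ-subst : ∀ {F x} → F ⊩Λ x → substΛ P F ⊩Λ eval x
    ⊩Λ-subst (F° , r , p) = ⊩Λ-cong (go r) (eval-cong p)
      where
      go : ∀ {F F°} → Realizes F F° → substΛ P F ⊩Λ eval F°
      go []                                             = ⊩Λ-0
      go {(c , _) ∷ F} {(x , m) ∷ F°} ((u , ≡.refl) ∷ r) =
        ⊩Λ-add {Λscale c (foldr (λ k acc → Λmul (P k) acc) Λ1 (map suc (proj₁ m)))}
          (⊩Λ-scale {c} {x} u (⊩Λ-evalMonomial (proj₁ m))) (go r)

  polSeparated : SeparatedAlgebra
  polSeparated = record
    { A = polRing
    ; ι = const ∘ κ
    ; ι-* = λ c d → by-image λ { zero → Λ.trans (κ-* c d) (Λ.sym (Λ.+-identityʳ (κ c ⊗ κ d))) ; (suc n) → ≃-refl }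
    ; ι-1 = P.refl
    ; ℓ = λ { (n , φ) f → ⟨ coeff f n , φ ⟩ }
    ; ℓ-+ = λ { (n , φ) f g → 𝕂.trans (functional (coeff-⊕ f g n) φ) (⟨⟩-⊕ (coeff f n) (coeff g n) φ) }
    ; ℓ-0 = λ _ → 𝕂.refl
    ; ℓ-scale = λ { (n , φ) c f → 𝕂.trans (functional (coeff-const-⊗ (κ c) f n) φ) (⟨⟩-κ⊗ c (coeff f n) φ) }
    ; ℓ-separates = λ e → by-image λ n → by-functionals λ φ → e (n , φ) }

  module EvalPol = Eval polSeparated

  module _ (P : ℕ → ΛPoly) (P° : ℕ → Pol) (P⊩ : ∀ i → P (suc i) ⊩S coeff (P° i)) where
    open EvalPol P°

    ⊩S-evalMonomial : ∀ ν → foldr (λ k acc → wmul (P k) acc) (Λ1 ∷ []) (map suc ν) ⊩S coeff (evalMonomial ν)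
    ⊩S-evalMonomial []      = ⊩S-cong (Λ1 ∷ []) ⊩S-one (λ n → ≃-sym (coeff-one n))
    ⊩S-evalMonomial (k ∷ ν) = ⊩S-cong (wmul (P (suc k)) f) (⊩S-mul (P (suc k)) f (P⊩ k) (⊩S-evalMonomial ν))
      (λ n → ≃-sym (coeff-⊗ (P° k) (evalMonomial ν) n))
      where f = foldr (λ k acc → wmul (P k) acc) (Λ1 ∷ []) (map suc ν)

    ⊩S-subst : ∀ {F x} → F ⊩Λ x → substΛw P F ⊩S coeff (eval x)
    ⊩S-subst {F} (F° , r , p) = ⊩S-cong (substΛw P F) (go r) (image (eval-cong p))
      where
      go : ∀ {F F°} → Realizes F F° → substΛw P F ⊩S coeff (eval F°)
      go []                                             = ⊩S-[]
      go {(c , _) ∷ F} {(x , m) ∷ F°} ((u , ≡.refl) ∷ r) = ⊩S-cong (wadd (wscale c f) (substΛw P F))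
        (⊩S-add (wscale c f) (substΛw P F) (⊩S-scale {c} {x} f u (⊩S-evalMonomial (proj₁ m))) (go r))
        (λ n → ≃-sym (≃-trans (coeff-⊕ (const (κ x) P.* evalMonomial (proj₁ m)) (eval F°) n)
                              (⊕-cong (coeff-const-⊗ (κ x) (evalMonomial (proj₁ m)) n) ≃-refl)))
        where f = foldr (λ k acc → wmul (P k) acc) (Λ1 ∷ []) (map suc (proj₁ m))

-- Ω-series, Schur functions and the operator D in terms of ring elements

module PlethysticOperator where
  open import Data.Nat using (s≤s)
  open import Data.List.Relation.Binary.Pointwise as Pointwise using (Pointwise; []; _∷_)
  open import Defs hiding (Λ)
  open import Defs using () renaming (Λ to SymF)
  open Fractions using (K°; ℚ[q])
  open Scalars
  open Realization
  import Algebra.Properties.Semiring.Mult.TCOptimised as Mult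

  open PowerSumAlgebra ℚ[q] using (Λ°; _≃_; ≃-refl; ≃-sym; ≃-trans; _⊕_; _⊗_; κ; κ-cong; κ-+; κ-*; κ-0; κ-neg; ⊗-cong; ⊕-cong; powerSum; monAlg; κHom)
  open EigenDeterminant monAlg using (EigenData; module Eigen)
  open Series monAlg hiding (θ)
  open FiniteSum monAlg
  private
    module SK = Series ℚ[q]
    module κMap = SeriesMap κHom
    module ΛSolver = IntegerSolver monAlg
    module D = Determinant monAlg ℤ

  ⊩-inv : ∀ i → kdiv k1 (kconstℤ (+ suc i)) ⊩ inv i
  ⊩-inv i = ⊩-cong {kdiv k1 (kconstℤ (+ suc i))}
    (⊩-div {k1} {kconstℤ (+ suc i)} (⊩-self 𝕂.1#) (kconst-ν (suc i)) (inv-ν i)) (𝕂.*-identityˡ (inv i))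

  invFactK : ℕ → K°
  invFactK zero    = 𝕂.1#
  invFactK (suc j) = inv j 𝕂.* invFactK j

  invFactK-ν : ∀ j → SK.ν (fact j) 𝕂.* invFactK j 𝕂.≈ 𝕂.1#
  invFactK-ν zero    = 𝕂.*-identityˡ 𝕂.1#
  invFactK-ν (suc j) = begin
    SK.ν (suc j ℕ.* fact j) 𝕂.* (inv j 𝕂.* invFactK j)
      ≈⟨ 𝕂.*-congʳ (Mult.×1-homo-* 𝕂.semiring (suc j) (fact j)) ⟩
    SK.ν (suc j) 𝕂.* SK.ν (fact j) 𝕂.* (inv j 𝕂.* invFactK j)
      ≈⟨ solve 4 (λ a b c d → a :* b :* (c :* d) := (a :* c) :* (b :* d)) 𝕂.refl (SK.ν (suc j)) (SK.ν (fact j)) (inv j) (invFactK j) ⟩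
    (SK.ν (suc j) 𝕂.* inv j) 𝕂.* (SK.ν (fact j) 𝕂.* invFactK j)
      ≈⟨ 𝕂.trans (𝕂.*-cong (inv-ν j) (invFactK-ν j)) (𝕂.*-identityˡ 𝕂.1#) ⟩
    𝕂.1# ∎
    where
    open IntegerSolver ℚ[q]
    open import Relation.Binary.Reasoning.Setoid 𝕂.setoid

  ⊩-invFact : ∀ j → kdiv k1 (kconstℤ (+ fact j)) ⊩ invFactK j
  ⊩-invFact j = ⊩-cong {kdiv k1 (kconstℤ (+ fact j))}
    (⊩-div {k1} {kconstℤ (+ fact j)} (⊩-self 𝕂.1#) (kconst-ν (fact j)) (invFactK-ν j)) (𝕂.*-identityˡ (invFactK j))

  inverses : NatInverses monAlg
  inverses = record
    { inv   = κ ∘ inv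
    ; inv-ν = λ i → Λ.trans (Λ.*-congʳ {κ (inv i)} (≃-sym (κMap.φ-ν (suc i)))) (κ-cong (inv-ν i)) }

  open ExpSeries inverses using (expSeries; expSeries-IsExp; antiderivative; spow; invFact; ν-cancel; expSeries-truncated)

  κ-invFact : ∀ j → κ (invFactK j) ≃ invFact j
  κ-invFact zero    = ≃-refl
  κ-invFact (suc j) = ≃-trans (κ-* (inv j) (invFactK j)) (⊗-cong (≃-refl {κ (inv j)}) (κ-invFact j))

  ⊩S-sumTo : ∀ m (f : ℕ → ΛPoly) {s : ℕ → Ser} → (∀ i → f i ⊩S s i) → sumTo m f ⊩S (λ n → ∑< m (λ i → s i n))
  ⊩S-sumTo zero    f r = ⊩S-[]
  ⊩S-sumTo (suc m) f r = ⊩S-add (sumTo m f) (f m) (⊩S-sumTo m f r) (r m)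

  ⊩S-pow : ∀ f {s} → f ⊩S s → ∀ n → wpow f n ⊩S spow s n
  ⊩S-pow f r zero    = ⊩S-one
  ⊩S-pow f r (suc n) = ⊩S-mul f (wpow f n) r (⊩S-pow f r n)

  monomialSeries-diagonal : ∀ k x → monomialSeries k x k ≃ x
  monomialSeries-diagonal zero    x = ≃-refl
  monomialSeries-diagonal (suc k) x = monomialSeries-diagonal k x

  monomialSeries-off : ∀ k x n → k ≢ n → monomialSeries k x n ≃ []
  monomialSeries-off zero    x zero    k≢n = contradiction ≡.refl k≢n
  monomialSeries-off zero    x (suc n) k≢n = ≃-refl
  monomialSeries-off (suc k) x zero    k≢n = ≃-refl
  monomialSeries-off (suc k) x (suc n) k≢n = monomialSeries-off k x n (k≢n ∘ ≡.cong suc)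

  -- `omegaCoeff` truncates both the exponent and the exponential at m. The truncated exponent
  -- agrees up to degree m with the antiderivative of Y, so `expSeries-truncated` applies.
  ⊩-omegaCoeff : ∀ (y : ℕ → SymF) {Y : Ser} → (∀ i → y (suc i) ⊩Λ Y i) → ∀ m → omegaCoeff y m ⊩Λ expSeries Y m
  ⊩-omegaCoeff y {Y} r m = ⊩Λ-cong
    (⊩S-sumTo (suc m) (λ j → wscale (kdiv k1 (kconstℤ (+ fact j))) (wpow S j))
      (λ j → ⊩S-scale {kdiv k1 (kconstℤ (+ fact j))} (wpow S j) (⊩-invFact j) (⊩S-pow S S⊩ j)) m)
    (≃-trans (∑<-cong (λ j → ⊗-cong (κ-invFact j) (≃-refl {spow σ j m})) (suc m))
             (expSeries-truncated Y m σ truncation))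
    where
    S : ΛPoly
    S = sumTo m (λ i → wmono (suc i) (Λscale (kdiv k1 (kconstℤ (+ suc i))) (y (suc i))))
    term : ℕ → Ser
    term i = monomialSeries (suc i) (κ (inv i) ⊗ Y i)
    σ : Ser
    σ n = ∑< m (λ i → term i n)
    S⊩ : S ⊩S σ
    S⊩ = ⊩S-sumTo m _ (λ i → ⊩S-mono (suc i) (⊩Λ-scale {kdiv k1 (kconstℤ (+ suc i))} (⊩-inv i) (r i)))
    truncation : ∀ n → n ℕ.≤ m → σ n ≃ antiderivative Y n
    truncation zero    _         = ∑<-zero m (λ _ _ → ≃-refl)
    truncation (suc n) n<m = ≃-trans
      (∑<-single n m n<m (λ i i≢n → monomialSeries-off (suc i) _ (suc n) (i≢n ∘ ℕₚ.suc-injective)))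
      (monomialSeries-diagonal (suc n) _)

  -- Jacobi–Trudi determinants

  complete : Ser
  complete = expSeries powerSum

  completeℤ : ℤ → Λ°
  completeℤ (+ n)    = complete n
  completeℤ -[1+ _ ] = []

  ⊩-hℤ : ∀ z → hℤ z ⊩Λ completeℤ z
  ⊩-hℤ (+ n)    = ⊩-omegaCoeff pΛ ⊩Λ-pΛ n
  ⊩-hℤ -[1+ _ ] = ⊩Λ-0

  jtColumn : ℕ → D.Column
  jtColumn j z = completeℤ (z ℤ.+ + j)

  RowRealizes : List D.Column → List SymF → ℤ → Set
  RowRealizes cols row z = Pointwise (λ F c → F ⊩Λ c z) row cols

  removeAt-realizes : ∀ {z} pre c suf {row} → RowRealizes (pre ++ c ∷ suf) row z →
    RowRealizes (pre ++ suf) (removeAt (length pre) row) z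
  removeAt-realizes []        c suf (_ ∷ r) = r
  removeAt-realizes (_ ∷ pre) c suf (u ∷ r) = u ∷ removeAt-realizes pre c suf r

  sign : ℕ → K°
  sign = SK.powers (𝕂.- 𝕂.1#)

  ⊩-sign : ∀ j → kpowℕ (kconstℤ (ℤ.- (+ 1))) j ⊩ sign j
  ⊩-sign zero    = ⊩-self 𝕂.1#
  ⊩-sign (suc j) = ⊩-mul {kconstℤ (ℤ.- (+ 1))} {kpowℕ (kconstℤ (ℤ.- (+ 1))) j} kconst-neg1 (⊩-sign j)

  mutual
    ⊩-detN : ∀ zs {rows} cols → length cols ≡ length zs →
      Pointwise (RowRealizes cols) rows zs → detN (length zs) rows ⊩Λ D.det zs cols
    ⊩-detN []       []   eq []       = ⊩Λ-1
    ⊩-detN (z ∷ zs) cols eq (r ∷ rs) = ⊩Λ-cong (⊩-detRow z zs [] cols ≡.refl eq rs r) (Λ.*-identityˡ _)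

    -- The raw expansion carries an explicit sign and deletes column j from every row, whereas
    -- `expand` alternates by subtraction and retains the columns it has passed. The invariant is
    -- that those form `pre`, with j its length.
    ⊩-detRow : ∀ z zs {rows all} pre suf {row} → all ≡ pre ++ suf → length all ≡ suc (length zs) →
      Pointwise (RowRealizes all) rows zs → RowRealizes suf row z →
      detRow (length zs) rows (length pre) row ⊩Λ κ (sign (length pre)) ⊗ D.expand z (λ ys → D.det zs (pre ++ ys)) suf
    ⊩-detRow z zs pre [] eq len rs [] = ⊩Λ-cong ⊩Λ-0 (≃-sym (Λ.zeroʳ (κ (sign (length pre)))))
    ⊩-detRow z zs {rows} pre (c ∷ suf) {F ∷ row} ≡.refl len rs (u ∷ r) = ⊩Λ-cong
      (⊩Λ-add {Λscale (kpowℕ (kconstℤ (ℤ.- (+ 1))) (length pre)) (Λmul F (detN (length zs) (map (removeAt (length pre)) rows)))}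
        (⊩Λ-scale {kpowℕ (kconstℤ (ℤ.- (+ 1))) (length pre)} (⊩-sign (length pre))
          (⊩Λ-mul {F} u (⊩-detN zs (pre ++ suf) minorLength (minors rs)))) rest)
      combine
      where
      s = κ (sign (length pre))
      minorLength : length (pre ++ suf) ≡ length zs
      minorLength = ℕₚ.suc-injective (≡.trans (≡.sym (≡.trans (Listₚ.length-++ pre)
        (≡.trans (ℕₚ.+-suc (length pre) (length suf)) (≡.cong suc (≡.sym (Listₚ.length-++ pre)))))) len)
      minors : ∀ {rows zs} → Pointwise (RowRealizes (pre ++ c ∷ suf)) rows zs →
        Pointwise (RowRealizes (pre ++ suf)) (map (removeAt (length pre)) rows) zs
      minors []       = []
      minors (r ∷ rs) = removeAt-realizes pre c suf r ∷ minors rs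
      E : Λ°
      E = D.expand z (λ ys → D.det zs (pre ++ c ∷ ys)) suf
      rest : detRow (length zs) rows (suc (length pre)) row ⊩Λ κ (sign (suc (length pre))) ⊗ E
      rest = ≡.subst (λ j → detRow (length zs) rows j row ⊩Λ κ (sign j) ⊗ E)
        (≡.trans (Listₚ.length-++ pre) (ℕₚ.+-comm (length pre) 1))
        (⊩Λ-cong (⊩-detRow z zs (pre ++ c ∷ []) suf (≡.sym (Listₚ.++-assoc pre (c ∷ []) suf)) len rs r)
          (⊗-cong (≃-refl {κ (sign (length (pre ++ c ∷ [])))})
            (D.expand-cong z (λ ys → Λ.reflexive (≡.cong (D.det zs) (Listₚ.++-assoc pre (c ∷ []) ys))) suf)))
      combine : (s ⊗ (c z ⊗ D.det zs (pre ++ suf))) ⊕ (κ (sign (suc (length pre))) ⊗ E)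
                ≃ s ⊗ D.expand z (λ ys → D.det zs (pre ++ ys)) (c ∷ suf)
      combine = ≃-trans
        (⊕-cong (≃-refl {s ⊗ (c z ⊗ D.det zs (pre ++ suf))})
          (⊗-cong (≃-trans (κ-* (𝕂.- 𝕂.1#) (sign (length pre))) (⊗-cong (κ-neg 𝕂.1#) (≃-refl {s}))) (≃-refl {E})))
        (ΛSolver.solve 3 (λ s d e → s ΛSolver.:* d ΛSolver.:+ ((ΛSolver.:- ΛSolver.con (+ 1)) ΛSolver.:* s) ΛSolver.:* e
            ΛSolver.:= s ΛSolver.:* (d ΛSolver.:- e)) ≃-refl s (c z ⊗ D.det zs (pre ++ suf)) E)

  -- Needed because `upTo` grows at the right end and `columns` at the left.
  columns-snoc : ∀ (c : ℕ → D.Column) j m → D.columns c j (suc m) ≡ D.columns c j m ++ c (m ℕ.+ j) ∷ []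
  columns-snoc c j zero    = ≡.refl
  columns-snoc c j (suc m) = ≡.cong (c j ∷_) (≡.trans (columns-snoc c (suc j) m)
    (≡.cong (λ t → D.columns c (suc j) m ++ c t ∷ []) (ℕₚ.+-suc m j)))

  columns-length : ∀ (c : ℕ → D.Column) j m → length (D.columns c j m) ≡ m
  columns-length c j zero    = ≡.refl
  columns-length c j (suc m) = ≡.cong suc (columns-length c (suc j) m)

  jtRow-realizes : ∀ z m → RowRealizes (D.columns jtColumn 0 m) (map (λ j → hℤ (z ℤ.+ + j)) (upTo m)) z
  jtRow-realizes z zero    = []
  jtRow-realizes z (suc m)
    rewrite columns-snoc jtColumn 0 m | ℕₚ.+-identityʳ m
          | Listₚ.map-++ (λ j → hℤ (z ℤ.+ + j)) (upTo m) (m ∷ [])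
    = Pointwise.++⁺ (jtRow-realizes z m) (⊩-hℤ (z ℤ.+ + m) ∷ [])

  jtRows-realize : ∀ ℓ i μ → Pointwise (RowRealizes (D.columns jtColumn 0 ℓ)) (jtRows ℓ i μ) (rowLabels i μ)
  jtRows-realize ℓ i []      = []
  jtRows-realize ℓ i (m ∷ μ) = jtRow-realizes (+ m ℤ.- + i) ℓ ∷ jtRows-realize ℓ (suc i) μ

  schurDet : List ℕ → Λ°
  schurDet μ = D.det (rowLabels 0 μ) (D.columns jtColumn 0 (length μ))

  ⊩-schur : ∀ μ → schur μ ⊩Λ schurDet μ
  ⊩-schur μ = ≡.subst (λ ℓ → detN ℓ rows ⊩Λ schurDet μ) (≡.sym (Pointwise.Pointwise-length realize))
    (⊩-detN (rowLabels 0 μ) _ (≡.trans (columns-length jtColumn 0 (length μ)) (≡.sym (length-rowLabels 0 μ))) realize)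
    where
    rows = jtRows (length μ) 0 μ
    realize = jtRows-realize (length μ) 0 μ

  -- The operator D_{u,0}

  translate : ℤ → SymF → ΛPoly
  translate u = substΛw (λ k → wadd (pΛ k ∷ []) (wmono k (Λscale (kpk k (kmul kM (qint u))) Λ1)))

  multiplier : ℤ → ℕ → SymF
  multiplier u k = Λscale (kneg (kpk k (tint u))) (pΛ k)

  pairUpTo : ΛPoly → (ℤ → SymF) → List ℕ → SymF
  pairUpTo G y []       = Λ0
  pairUpTo G y (m ∷ ms) = Λadd (Λmul (wcoeff G m) (y (+ m))) (pairUpTo G y ms)

  -- A sum is characterised by its two recursion equations, so that the sum local to `Dop` can be
  -- reached through them.
  pairUpTo-unique : ∀ G y (f : List ℕ → SymF) → f [] ≡ Λ0 →
    (∀ m ms → f (m ∷ ms) ≡ Λadd (Λmul (wcoeff G m) (y (+ m))) (f ms)) → ∀ ms → f ms ≡ pairUpTo G y ms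
  pairUpTo-unique G y f p q []       = p
  pairUpTo-unique G y f p q (m ∷ ms) = ≡.trans (q m ms) (≡.cong (Λadd _) (pairUpTo-unique G y f p q ms))

  Dop-pair : ∀ u v F → Dop u v F ≡ pairUpTo (translate u F) (λ m → omegaCoeffℤ (multiplier u) (m ℤ.+ v)) (upTo (length (translate u F)))
  Dop-pair u v F = main
    where
    -- Unification identifies localSum with the local function sumΛ of Dop, which cannot be named here.
    localSum : List ℕ → SymF
    localSum = _
    main : Dop u v F ≡ pairUpTo (translate u F) (λ m → omegaCoeffℤ (multiplier u) (m ℤ.+ v)) (upTo (length (translate u F)))
    -- Generalising the index list to a variable lets unification solve for `localSum` as a function
    -- of it.
    main with upTo (length (translate u F))
    ... | ms = ≡.trans {j = localSum ms} ≡.refl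
      (pairUpTo-unique (translate u F) (λ m → omegaCoeffℤ (multiplier u) (m ℤ.+ v)) localSum ≡.refl (λ _ _ → ≡.refl) ms)

  open PolyRing monAlg
    using (Pol; coeff; const; linearTerm; monomial; monomial-cong; monomial-linear; powers-linearTerm; pair; pair-cong; pair-∑<;
           polRing; module P; by-image; coeff-⊕; coeff-const-⊗; const-*)

  wcoeff-length : ∀ f m → length f ℕ.≤ m → wcoeff f m ≡ Λ0
  wcoeff-length []      m       _         = ≡.refl
  wcoeff-length (a ∷ f) (suc m) (s≤s f≤m) = wcoeff-length f m f≤m

  module _ (G : ΛPoly) (y : ℤ → SymF) {s Y : Ser} (G⊩ : G ⊩S s) (y⊩ : ∀ m → y (+ m) ⊩Λ Y m) where

    private
      total : List ℕ → Λ°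
      total []       = []
      total (k ∷ ks) = (s k ⊗ Y k) ⊕ total ks

      total-++ : ∀ ks ls → total (ks ++ ls) ≃ total ks ⊕ total ls
      total-++ []       ls = ≃-refl
      total-++ (k ∷ ks) ls = ≃-trans (⊕-cong (≃-refl {s k ⊗ Y k}) (total-++ ks ls)) (≃-sym (Λ.+-assoc (s k ⊗ Y k) (total ks) (total ls)))

      total-upTo : ∀ n → total (upTo n) ≃ ∑< n (λ m → s m ⊗ Y m)
      total-upTo zero    = ≃-refl
      total-upTo (suc n) = ≃-trans (total-++ (upTo n) (n ∷ []))
        (⊕-cong (total-upTo n) (Λ.+-identityʳ (s n ⊗ Y n)))

      pairUpTo-total : ∀ ms → pairUpTo G y ms ⊩Λ total ms
      pairUpTo-total []       = ⊩Λ-0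
      pairUpTo-total (m ∷ ms) = ⊩Λ-add {Λmul (wcoeff G m) (y (+ m))}
        (⊩Λ-mul {wcoeff G m} (G⊩ m) (y⊩ m)) (pairUpTo-total ms)

    ⊩-pairUpTo : ∀ n → pairUpTo G y (upTo n) ⊩Λ ∑< n (λ m → s m ⊗ Y m)
    ⊩-pairUpTo n = ⊩Λ-cong (pairUpTo-total (upTo n)) (total-upTo n)

  coeff-monomial : ∀ k x → monomialSeries k x ≋ coeff (monomial k x)
  coeff-monomial zero    x zero    = ≃-refl
  coeff-monomial zero    x (suc i) = ≃-refl
  coeff-monomial (suc k) x zero    = ≃-refl
  coeff-monomial (suc k) x (suc i) = coeff-monomial k x i

  module Translation (e : K°) where

    -- The factor `κ 𝕂.1#` mirrors the raw `Λscale _ Λ1`.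
    translation : ℕ → Λ°
    translation i = κ (π i e) ⊗ κ 𝕂.1#

    translated : ℕ → Pol
    translated i = const (powerSum i) P.+ monomial (suc i) (translation i)

    open EvalPol translated public

    module _ (E : K) (E⊩ : E ⊩ e) where

      private
        shifted : ℕ → ΛPoly
        shifted k = wadd (pΛ k ∷ []) (wmono k (Λscale (kpk k E) Λ1))

        shifted⊩ : ∀ i → shifted (suc i) ⊩S coeff (translated i)
        shifted⊩ i = ⊩S-cong (shifted (suc i))
          (⊩S-add (pΛ (suc i) ∷ []) (wmono (suc i) (Λscale (kpk (suc i) E) Λ1)) {coeff (const (powerSum i))}
            (λ { zero → ⊩Λ-pΛ i ; (suc _) → ⊩Λ-0 })
            (⊩S-mono (suc i) (⊩Λ-scale {kpk (suc i) E} (⊩-kpk i {E} E⊩) ⊩Λ-1)))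
          (λ m → ≃-trans (⊕-cong (≃-refl {coeff (const (powerSum i)) m}) (coeff-monomial (suc i) (translation i) m))
                         (≃-sym (coeff-⊕ (const (powerSum i)) (monomial (suc i) (translation i)) m)))

      ⊩-translateBy : ∀ {F x} → F ⊩Λ x → substΛw shifted F ⊩S coeff (eval x)
      ⊩-translateBy = ⊩S-subst shifted translated shifted⊩

  ⊩-scaledOmega : ∀ T {t} → T ⊩ t → ∀ m →
    omegaCoeffℤ (λ k → Λscale (kneg (kpk k T)) (pΛ k)) (+ m ℤ.+ + 0) ⊩Λ expSeries (λ i → κ (𝕂.- π i t) ⊗ powerSum i) m
  ⊩-scaledOmega T {t} T⊩ m = ≡.subst (λ z → omegaCoeffℤ y z ⊩Λ expSeries Y m) (≡.cong +_ (≡.sym (ℕₚ.+-identityʳ m)))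
    (⊩-omegaCoeff y (λ i → ⊩Λ-scale {kneg (kpk (suc i) T)} (⊩-neg {kpk (suc i) T} (⊩-kpk i {T} T⊩)) (⊩Λ-pΛ i)) m)
    where
    y : ℕ → SymF
    y k = Λscale (kneg (kpk k T)) (pΛ k)
    Y : Ser
    Y i = κ (𝕂.- π i t) ⊗ powerSum i

  module Operator (n : ℕ) where

    plethysm multiplier° : ℕ → Λ°
    plethysm i    = κ (π i b) ⊗ powerSum i
    multiplier° i = κ (𝕂.- π i (τ n)) ⊗ powerSum i

    module E₁ = EvalΛ plethysm
    module E₂ = Translation (ε n)
    open E₂ using (translation; ⊩-translateBy)

    ⊩-plethysm : ∀ {F x} → F ⊩Λ x → plethXover1mq F ⊩Λ E₁.eval x
    ⊩-plethysm = ⊩Λ-subst (λ k → Λscale (kpk k (kdiv k1 (ksub k1 kq))) (pΛ k)) plethysm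
      (λ i → ⊩Λ-scale {kpk (suc i) (kdiv k1 (ksub k1 kq))} (⊩-kpk i {kdiv k1 (ksub k1 kq)} (⊩-b n)) (⊩Λ-pΛ i))

    ⊩-translate : ∀ {F x} → F ⊩Λ x → translate (+ n) F ⊩S coeff (E₂.eval x)
    ⊩-translate = ⊩-translateBy (kmul kM (qint (+ n))) (⊩-ε n)

    ĝ : Ser
    ĝ = expSeries multiplier°

    ⊩-omegaCoeffℤ : ∀ m → omegaCoeffℤ (multiplier (+ n)) (+ m ℤ.+ + 0) ⊩Λ ĝ m
    ⊩-omegaCoeffℤ = ⊩-scaledOmega (tint (+ n)) (⊩-τ n)

    ⊩-Dop : ∀ {F x} → F ⊩Λ x → Dop (+ n) (+ 0) F ⊩Λ pair (E₂.eval x) ĝ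
    ⊩-Dop {F} {x} r = ≡.subst (_⊩Λ pair (E₂.eval x) ĝ) (≡.sym (Dop-pair (+ n) (+ 0) F))
      (⊩Λ-cong (⊩-pairUpTo G (λ m → omegaCoeffℤ (multiplier (+ n)) (m ℤ.+ + 0)) G⊩ ⊩-omegaCoeffℤ (length G))
        (≃-sym (pair-∑< (E₂.eval x) ĝ (length G) (λ m G≤m →
          ⊩Λ-0-inv (≡.subst (_⊩Λ coeff (E₂.eval x) m) (wcoeff-length G m G≤m) (G⊩ m))))))
      where
      G : ΛPoly
      G = translate (+ n) F
      G⊩ : G ⊩S coeff (E₂.eval x)
      G⊩ = ⊩-translate r

    private
      module SP = Series polRing
      module E₁Map = SeriesMap E₁.evalHom
      module E₂Map = SeriesMap E₂.evalHom
      module E₁Det = DeterminantMap E₁.evalHom ℤ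
      module E₂Det = DeterminantMap E₂.evalHom ℤ
      module PD = Determinant polRing ℤ

    h : Ser
    h = E₁.eval ∘ complete

    -- Substitution is a ring homomorphism, so Newton's identity for h_n[X] passes to
    -- h_n[X/(1 - q)]; it passes once more to `ĥ`.
    h-exp : IsExp plethysm h
    h-exp = IsExp-cong E₁.eval-powerSum (E₁Map.IsExp-map (expSeries-IsExp powerSum))

    ĥ : ℕ → Pol
    ĥ = E₂.eval ∘ h

    ĥ-exp : SP.IsExp (E₂.eval ∘ plethysm) ĥ
    ĥ-exp = E₂Map.IsExp-map h-exp

    κ-powers : ∀ x k → κ (SK.powers x k) ≃ powers (κ x) k
    κ-powers x zero    = ≃-refl
    κ-powers x (suc k) = ≃-trans (κ-* x (SK.powers x k)) (⊗-cong (≃-refl {κ x}) (κ-powers x k))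

    -- `π-b-τ` multiplied by p_{i+1}[X], in the form of `ŷ-def`.
    multiplier-relation : ∀ i → powers (κ (α n)) (suc i) ⊗ (powers (κ θ) (suc i) ⊗ multiplier° i) ⊕ plethysm i
                                ≃ powers (κ (α n)) (suc i) ⊗ plethysm i
    multiplier-relation i = begin
      powers (κ (α n)) k ⊗ (powers (κ θ) k ⊗ (κ t ⊗ p)) ⊕ κ c ⊗ p
        ≈⟨ ⊕-cong (⊗-cong (κ-powers (α n) k) (⊗-cong (κ-powers θ k) (≃-refl {κ t ⊗ p}))) (≃-refl {κ c ⊗ p}) ⟨
      κ a ⊗ (κ s ⊗ (κ t ⊗ p)) ⊕ κ c ⊗ p
        ≈⟨ ΛSolver.solve 5 (λ a s t c p → a ΛSolver.:* (s ΛSolver.:* (t ΛSolver.:* p)) ΛSolver.:+ c ΛSolver.:* p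
             ΛSolver.:= (a ΛSolver.:* (s ΛSolver.:* t) ΛSolver.:+ c) ΛSolver.:* p) ≃-refl (κ a) (κ s) (κ t) (κ c) p ⟩
      (κ a ⊗ (κ s ⊗ κ t) ⊕ κ c) ⊗ p
        ≈⟨ ⊗-cong (≃-trans (κ-+ (a 𝕂.* (s 𝕂.* t)) c) (⊕-cong (≃-trans (κ-* a (s 𝕂.* t)) (⊗-cong (≃-refl {κ a}) (κ-* s t))) (≃-refl {κ c}))) (≃-refl {p}) ⟨
      κ (a 𝕂.* (s 𝕂.* t) 𝕂.+ c) ⊗ p
        ≈⟨ ⊗-cong (≃-trans (κ-cong (π-b-τ n i)) (≃-trans (κ-* a c) (⊗-cong (κ-powers (α n) k) (≃-refl {κ c})))) (≃-refl {p}) ⟩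
      powers (κ (α n)) k ⊗ κ c ⊗ p
        ≈⟨ Λ.*-assoc (powers (κ (α n)) k) (κ c) p ⟩
      powers (κ (α n)) k ⊗ (κ c ⊗ p) ∎
      where
      open import Relation.Binary.Reasoning.Setoid Λ.setoid
      k = suc i
      p = powerSum i
      a = SK.powers (α n) k
      s = SK.powers θ k
      t = 𝕂.- π i (τ n)
      c = π i b

    linearTerm-scale : const (κ (α n)) P.* linearTerm (κ θ) P.≈ linearTerm (κ (α n 𝕂.* θ))
    linearTerm-scale = by-image λ m → ≃-trans (coeff-const-⊗ (κ (α n)) (linearTerm (κ θ)) m)
      (λ-cases m)
      where
      λ-cases : ∀ m → κ (α n) ⊗ coeff (linearTerm (κ θ)) m ≃ coeff (linearTerm (κ (α n 𝕂.* θ))) m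
      λ-cases zero          = Λ.zeroʳ (κ (α n))
      λ-cases (suc zero)    = ≃-sym (κ-* (α n) θ)
      λ-cases (suc (suc m)) = Λ.zeroʳ (κ (α n))

    translation-relation : ∀ i → E₂.eval (plethysm i) P.+ SP.powers (linearTerm (κ θ)) (suc i)
                                 P.≈ const (plethysm i) P.+ SP.powers (const (κ (α n)) P.* linearTerm (κ θ)) (suc i)
    translation-relation i = P.trans
      (P.+-cong (P.trans (E₂.eval-⊗ (κ c) (powerSum i)) (P.*-cong (E₂.eval-κ c) (E₂.eval-powerSum i)))
                (powers-linearTerm (κ θ) k))
      (P.trans (PSolver.solve 4 (λ c p m r → c PSolver.:* (p PSolver.:+ m) PSolver.:+ r
                   PSolver.:= c PSolver.:* p PSolver.:+ (c PSolver.:* m PSolver.:+ r)) P.refl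
                 (const (κ c)) (const (powerSum i)) (monomial k (translation i)) (monomial k (powers (κ θ) k)))
      (P.+-cong {const (κ c) P.* const (powerSum i)} {const (plethysm i)}
         {const (κ c) P.* monomial k (translation i) P.+ monomial k (powers (κ θ) k)} (P.sym (const-* (κ c) (powerSum i)))
        (P.trans (by-image λ m → ≃-trans (coeff-⊕ (const (κ c) P.* monomial k (translation i)) (monomial k (powers (κ θ) k)) m)
                    (≃-trans (⊕-cong (coeff-const-⊗ (κ c) (monomial k (translation i)) m) (≃-refl {coeff (monomial k (powers (κ θ) k)) m}))
                      (≃-trans (≃-sym (monomial-linear k (κ c) (translation i) (powers (κ θ) k) m)) (monomial-cong k scalars m))))
          (P.sym (P.trans (SP.powers-cong k linearTerm-scale) (powers-linearTerm (κ (α n 𝕂.* θ)) k))))))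
      where
      module PSolver = IntegerSolver polRing
      k = suc i
      c = π i b
      scalars : κ c ⊗ translation i ⊕ powers (κ θ) k ≃ powers (κ (α n 𝕂.* θ)) k
      scalars = ≃-trans (⊕-cong (⊗-cong (≃-refl {κ c}) (Λ.*-identityʳ (κ (π i (ε n))))) (≃-sym (κ-powers θ k)))
        (≃-trans (⊕-cong (≃-sym (κ-* c (π i (ε n)))) (≃-refl {κ (SK.powers θ k)}))
        (≃-trans (≃-sym (κ-+ (c 𝕂.* π i (ε n)) (SK.powers θ k)))
        (≃-trans (κ-cong (π-b-ε n i)) (κ-powers (α n 𝕂.* θ) k))))

    eigenData : EigenData
    eigenData = record
      { ν-cancel = ν-cancel ; a = κ (α n) ; a⁻¹ = κ (α⁻¹ n) ; s = κ θ
      ; a⁻¹-inverse = ≃-trans (≃-sym (κ-* (α⁻¹ n) (α n))) (κ-cong (α⁻¹-inverse n))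
      ; h-exp = h-exp ; ĝ-exp = expSeries-IsExp multiplier° ; ŷ-def = multiplier-relation
      ; ĥ-exp = ĥ-exp ; Q-def = translation-relation }

    module C = Eigen eigenData

    eval-schur : ∀ μ → E₁.eval (schurDet μ) ≃ D.det (rowLabels 0 μ) (D.columns C.c 0 (length μ))
    eval-schur μ = ≃-trans (E₁Det.φ-det (rowLabels 0 μ) (D.columns jtColumn 0 (length μ)))
      (≃-trans (Λ.reflexive (≡.cong (D.det (rowLabels 0 μ)) (E₁Det.map-columns jtColumn 0 (length μ))))
        (D.columns-cong (D.det-alternating (rowLabels 0 μ)) (λ j z → evalℤ (z ℤ.+ + j)) 0 (length μ)))
      where
      evalℤ : ∀ z → E₁.eval (completeℤ z) ≃ C.hℤ′ z
      evalℤ (+ _)    = ≃-refl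
      evalℤ -[1+ _ ] = ≃-refl

    eval-eval-schur : ∀ μ → E₂.eval (E₁.eval (schurDet μ)) P.≈ PD.det (rowLabels 0 μ) (PD.columns C.ĉ 0 (length μ))
    eval-eval-schur μ = P.trans (E₂.eval-cong (eval-schur μ))
      (P.trans (E₂Det.φ-det (rowLabels 0 μ) (D.columns C.c 0 (length μ)))
      (P.trans (P.reflexive (≡.cong (PD.det (rowLabels 0 μ)) (E₂Det.map-columns C.c 0 (length μ))))
        (PD.columns-cong (PD.det-alternating (rowLabels 0 μ)) (λ j z → evalℤ (z ℤ.+ + j)) 0 (length μ))))
      where
      evalℤ : ∀ z → E₂.eval (C.hℤ′ z) P.≈ C.ĥℤ z
      evalℤ (+ _)    = P.refl
      evalℤ -[1+ _ ] = P.refl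

    κ-geo : ∀ m → κ (geo (α n) m) ≃ C.geometric m
    κ-geo zero    = κ-0
    κ-geo (suc m) = ≃-trans (κ-+ 𝕂.1# (α n 𝕂.* geo (α n) m)) (⊕-cong (≃-refl {κ 𝕂.1#})
      (≃-trans (κ-* (α n) (geo (α n) m)) (⊗-cong (≃-refl {κ (α n)}) (κ-geo m))))

    κ-bμ : ∀ μ → κ (bμ μ (α n) (α⁻¹ n)) ≃ C.biexponents μ
    κ-bμ []      = κ-0
    κ-bμ (m ∷ μ) = ≃-trans (κ-+ (geo (α n) m) (α⁻¹ n 𝕂.* bμ μ (α n) (α⁻¹ n))) (⊕-cong (κ-geo m)
      (≃-trans (κ-* (α⁻¹ n) (bμ μ (α n) (α⁻¹ n))) (⊗-cong (≃-refl {κ (α⁻¹ n)}) (κ-bμ μ))))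

    eigenvalueK : List ℕ → K°
    eigenvalueK μ = 𝕂.1# 𝕂.- (𝕂.1# 𝕂.- α⁻¹ n) 𝕂.* (𝕂.1# 𝕂.- α n) 𝕂.* bμ μ (α n) (α⁻¹ n)

    κ-minus : ∀ c d → κ (c 𝕂.- d) ≃ κ c Λ.- κ d
    κ-minus c d = ≃-trans (κ-+ c (𝕂.- d)) (⊕-cong (≃-refl {κ c}) (κ-neg d))

    κ-eigenvalue : ∀ μ → κ (eigenvalueK μ) ≃ C.eigenvalue (rowLabels 0 μ) (length μ)
    κ-eigenvalue μ = ≃-trans (κ-minus 𝕂.1# ((𝕂.1# 𝕂.- α⁻¹ n) 𝕂.* (𝕂.1# 𝕂.- α n) 𝕂.* B))
      (≃-trans (Λ.+-congˡ {κ 𝕂.1#} (Λ.-‿cong (≃-trans (κ-* ((𝕂.1# 𝕂.- α⁻¹ n) 𝕂.* (𝕂.1# 𝕂.- α n)) B)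
          (⊗-cong (≃-trans (κ-* (𝕂.1# 𝕂.- α⁻¹ n) (𝕂.1# 𝕂.- α n)) (⊗-cong (κ-minus 𝕂.1# (α⁻¹ n)) (κ-minus 𝕂.1# (α n)))) (κ-bμ μ)))))
        (≃-sym (C.eigenvalue-partition μ)))
      where B = bμ μ (α n) (α⁻¹ n)

    eigen : ∀ μ → pair (E₂.eval (E₁.eval (schurDet μ))) ĝ ≃ κ (eigenvalueK μ) ⊗ E₁.eval (schurDet μ)
    eigen μ = ≃-trans (pair-cong ĝ (eval-eval-schur μ))
      (≃-trans (≡.subst (λ ℓ → pair (PD.det (rowLabels 0 μ) (PD.columns C.ĉ 0 ℓ)) ĝ
                               ≃ C.eigenvalue (rowLabels 0 μ) ℓ ⊗ D.det (rowLabels 0 μ) (D.columns C.c 0 ℓ))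
                         (length-rowLabels 0 μ) (C.pair-det-length (rowLabels 0 μ)))
        (⊗-cong (≃-sym (κ-eigenvalue μ)) (≃-sym (eval-schur μ))))

    ⊩-eigenvalue : ∀ μ → ksub k1 (kmul (kmul (ksub k1 (qpow (ℤ.- (+ n)))) (ksub k1 (qpow (+ n)))) (Bμ μ (qpow (+ n)) (qpow (ℤ.- (+ n)))))
                         ⊩ eigenvalueK μ
    ⊩-eigenvalue μ = ⊩-sub {k1} {kmul (kmul (ksub k1 q⁻) (ksub k1 q⁺)) (Bμ μ q⁺ q⁻)} (⊩-self 𝕂.1#)
      (⊩-mul {kmul (ksub k1 q⁻) (ksub k1 q⁺)} {Bμ μ q⁺ q⁻}
        (⊩-mul {ksub k1 q⁻} {ksub k1 q⁺} (⊩-sub {k1} {q⁻} (⊩-self 𝕂.1#) (qpow-neg n)) (⊩-sub {k1} {q⁺} (⊩-self 𝕂.1#) (ppow-powers n)))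
        (⊩-bμ {q⁺} {q⁻} μ (ppow-powers n) (qpow-neg n)))
      where
      q⁺ = qpow (+ n)
      q⁻ = qpow (ℤ.- (+ n))

-- Transfer of the eigenvalue equation to the raw definitions

open import Defs
open import Data.Integer using (_≤_; -_)
open Scalars using (_⊩_)
open Realization using (_⊩Λ_; ⊩Λ-≈Λ; ⊩Λ-scale)
open PlethysticOperator using (module Operator; schurDet; ⊩-schur)

theoremI5 : (u : ℤ) → + 1 ≤ u → (μ : List ℕ) → IsPartition μ →
    Dop u (+ 0) (plethXover1mq (schur μ))
    ≈Λ Λscale (ksub k1 (kmul (kmul (ksub k1 (qpow (- u))) (ksub k1 (qpow u))) (Bμ μ (qpow u) (qpow (- u)))))
    (plethXover1mq (schur μ))
theoremI5 (+ n) _ μ _ = ⊩Λ-≈Λ {Dop (+ n) (+ 0) F} {Λscale e F}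
  (⊩-Dop {F} F⊩) (⊩Λ-scale {e} {eigenvalueK μ} {F} (⊩-eigenvalue μ) F⊩) (eigen μ)
  where
  open Operator n
  F : Λ
  F = plethXover1mq (schur μ)
  F⊩ : F ⊩Λ E₁.eval (schurDet μ)
  F⊩ = ⊩-plethysm {schur μ} (⊩-schur μ)
  e : K
  e = ksub k1 (kmul (kmul (ksub k1 (qpow (- (+ n)))) (ksub k1 (qpow (+ n)))) (Bμ μ (qpow (+ n)) (qpow (- (+ n)))))
theoremI5 -[1+ _ ] () _ _
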